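{- If $q\in(1,q_3)\setminus\left\{\frac{1+\sqrt5}{2}\right\}$, then $1$ has $2^{\aleph_0}$ different $q$-expansions.
   Context: For $q\in(1,2)$, a $q$-expansion of a real number $x\in[0,\frac{1}{q-1}]$ is a sequence $(\delta_i)_{i=1}^\infty\in\{0,1\}^{\mathbb{N}}$ with $x=\sum_{i=1}^\infty \delta_i q^{ -i}$. The number $q_3\approx1.68042$ is the unique root of $x^5-x^4-x^3-x+1=0$ in $(1,2)$. -}

module Defs where

open import Algebra.Bundles using (CommutativeRing; Semiring)
import Algebra.Definitions.RawSemiring as RawSemiringDefinitions
open import Data.Fin.Base using (Fin; toℕ)
open import Data.Nat.Base as ℕ using (ℕ; suc)
open import Data.Product.Base using (Σ; ∃; _×_; proj₁)
open import Function.Bundles using (Bijection)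
open import Level using (0ℓ) renaming (suc to lsuc)
open import Relation.Binary.Bundles using (Setoid)
import Relation.Binary.Construct.On as On
import Relation.Binary.Construct.StrictToNonStrict as StrictToNonStrict
open import Relation.Binary.Core using (Rel)
open import Relation.Binary.PropositionalEquality using (_→-setoid_)
open import Relation.Binary.Structures using (IsStrictTotalOrder)
open import Relation.Nullary.Negation.Core using (¬_)
open import Relation.Unary using (Pred)

-- The classical axioms of the real numbers, which determine them up to unique
-- isomorphism. The inverse is a total function, but nothing is said about the
-- value of 0# ⁻¹.
record CompleteOrderedField : Set (lsuc 0ℓ) where
  infix  4 _<_ _≤_
  infix  9 _⁻¹
  infixl 7 _/_
  field
    commutativeRing : CommutativeRing 0ℓ 0ℓ

  open CommutativeRing commutativeRing public

  field
    _⁻¹                : Carrier → Carrier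
    ⁻¹-cong            : ∀ {x y} → x ≈ y → x ⁻¹ ≈ y ⁻¹
    ⁻¹-inverse         : ∀ {x} → ¬ (x ≈ 0#) → x * x ⁻¹ ≈ 1#
    0≉1                : ¬ (0# ≈ 1#)
    _<_                : Rel Carrier 0ℓ
    isStrictTotalOrder : IsStrictTotalOrder _≈_ _<_
    +-monoˡ-<          : ∀ {x y} z → x < y → x + z < y + z
    *-pos              : ∀ {x y} → 0# < x → 0# < y → 0# < x * y

  _≤_ : Rel Carrier 0ℓ
  _≤_ = StrictToNonStrict._≤_ _≈_ _<_

  UpperBound : Pred Carrier 0ℓ → Pred Carrier 0ℓ
  UpperBound P b = ∀ x → P x → x ≤ b

  LeastUpperBound : Pred Carrier 0ℓ → Pred Carrier 0ℓ
  LeastUpperBound P s = UpperBound P s × (∀ b → UpperBound P b → s ≤ b)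

  field
    complete : ∀ P → ∃ P → ∃ (UpperBound P) → ∃ (LeastUpperBound P)

  _/_ : Carrier → Carrier → Carrier
  x / y = x * y ⁻¹

  -- n · x is the n-fold sum x + ⋯ + x
  open RawSemiringDefinitions (Semiring.rawSemiring semiring) public
    using (_^_; sum) renaming (_×_ to _·_)

module Expansions (ℝ : CompleteOrderedField) where
  open CompleteOrderedField ℝ

  fromℕ : ℕ → Carrier
  fromℕ n = n · 1#

  IsSqrt : Carrier → Pred Carrier 0ℓ
  IsSqrt x s = 0# ≤ s × s * s ≈ x

  -- This describes a single real number: the quintic is negative at 1,
  -- positive at 2, and has exactly one root in between.
  IsQ₃ : Pred Carrier 0ℓ
  IsQ₃ x = 1# < x × x < fromℕ 2 × x ^ 5 - x ^ 4 - x ^ 3 - x + 1# ≈ 0#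

  ConvergesTo : (ℕ → Carrier) → Pred Carrier 0ℓ
  ConvergesTo a x = ∀ ε → 0# < ε →
    ∃ λ N → ∀ n → N ℕ.≤ n → x - ε < a n × a n < x + ε

  -- δ is indexed from 0, so its entry at i is the coefficient of q^-(i+1).
  partialSum : Carrier → (ℕ → Fin 2) → ℕ → Carrier
  partialSum q δ n = sum {n} λ i → fromℕ (toℕ (δ (toℕ i))) / q ^ suc (toℕ i)

  IsExpansion : Carrier → Carrier → Pred (ℕ → Fin 2) 0ℓ
  IsExpansion q x δ = ConvergesTo (partialSum q δ) x

  -- Two expansions are equal when they have the same digits; the proofs of
  -- convergence are ignored.
  expansions : Carrier → Carrier → Setoid 0ℓ 0ℓ
  expansions q x = On.setoid {B = Σ (ℕ → Fin 2) (IsExpansion q x)} (ℕ →-setoid Fin 2) proj₁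

HasCardinalityContinuum : Setoid 0ℓ 0ℓ → Set
HasCardinalityContinuum S = Bijection S (ℕ →-setoid Fin 2)

-- Put K = q² - 1 and scale points by K, so that the expansions of 1 become the
-- itineraries of K under X ↦ q X and X ↦ q X - K within [0, q + 1], an interval
-- that the reflection X ↦ q + 1 - X preserves. If every point of a set Q has a
-- descendant both of whose children lie in Q, then each point of Q has a
-- complete binary tree of itineraries, and Cantor–Schröder–Bernstein applies.
-- Let u = q² - q - 1. If u < 0, the open interval serves as Q.
--
-- If u > 0, the points with a unique itinerary are, up to reflection, 0 and the
-- powers of q⁻¹, and Q consists of the other points. Every point of Q reaches a
-- node with two children; if one of them is q⁻ᵐ, then the other is, up to
-- reflection, D - q⁻ᵐ with D = 1 - u, so it suffices that every D - q⁻ᵐ and D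
-- itself have a descendant with both children in Q. The next two children after
-- D - q⁻ᵐ are again powers of q⁻¹ only for special q, and for q < q₃ such
-- coincidences never chain up indefinitely, except for two values of q.
--
-- Each of these two is a root of a sextic f that is irreducible modulo 2, with
-- f(1) = -p for p = 5 and p = 3 respectively. Hence q ↦ 1 defines a homomorphism
-- ℤ[q] → ℤ/p. It maps the descendants of K and their reflections to 0 or 2 but
-- the powers of q to 1, so no descendant of K has a unique itinerary, except
-- possibly 0 and its reflection.

module Submission where

open import Defs
open import Algebra.Bundles using (CommutativeRing)
import Algebra.Properties.Ring as RingProperties
import Algebra.Properties.Semiring.Mult as SemiringMult
import Algebra.Solver.Ring as RingSolver
open import Algebra.Solver.Ring.AlmostCommutativeRing using (fromCommutativeRing; _-Raw-AlmostCommutative⟶_)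
open import Axiom.ExcludedMiddle using (ExcludedMiddle)
open import Data.Bool.Base using (Bool; true; false; _∧_; _∨_; _xor_; not; T)
open import Data.Bool.Properties using (T-∨; T-∧; xor-assoc; xor-identityʳ)
open import Data.Empty using (⊥; ⊥-elim)
open import Data.Fin.Base using (Fin; zero; suc; toℕ)
open import Data.Integer.Base as ℤ using (ℤ; +_; -[1+_]; ∣_∣)
import Data.Integer.Properties as ℤₚ
open import Data.Integer.Solver using (module +-*-Solver)
open import Data.List.Base as List using (List; []; _∷_)
import Data.Maybe.Base as Maybe
open import Data.Nat.Base as ℕ using (ℕ; zero; suc)
import Data.Nat.Properties as ℕₚ
open import Data.Product.Base using (∃; _×_; _,_; proj₁; proj₂)
import Data.Sign.Base as Sign
open import Data.Sum.Base using (_⊎_; inj₁; inj₂)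
open import Data.Unit.Base using (⊤; tt)
open import Data.Vec.Base as Vec using (Vec; []; _∷_; lookup; zipWith; map; replicate)
import Data.Vec.Properties as Vecₚ
open import Data.Vec.Relation.Binary.Pointwise.Inductive as Pointwise using (Pointwise; []; _∷_)
open import Function.Base using (_∘_)
open import Function.Bundles using (Bijection; Equivalence)
open import Level using (0ℓ)
open import Relation.Binary.Bundles using (Setoid)
open import Relation.Binary.Definitions using (tri<; tri≈; tri>)
open import Relation.Binary.PropositionalEquality as ≡ using (_≡_; _≗_; _→-setoid_)
open import Relation.Binary.Structures using (IsStrictTotalOrder)
open import Relation.Nullary.Decidable.Core using (Dec; yes; no; dec⇒maybe)
open import Relation.Nullary.Negation.Core using (¬_)

-- Why q₃ is the limit: up to reflection, `D` (the reflection of K) leads to a node with the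
-- children `V` and `w` = `D` - `V`, and `D` - q⁻¹ to one with `s₁` and `ρ₁` = `D` - `s₁`. Both `V`
-- = q⁻¹ and `s₁` = q⁻¹ hold exactly when the quintic vanishes. At q₃ the tree thus degenerates to a
-- line with univoque side branches. Below q₃ a branch must be found in finitely many steps, so the
-- references from one `D` - q⁻ᵐ to another must be well-founded. Those from m >= 5 soon lead to m
-- <= 4, but among 1, ..., 4 their direction changes with q. Hence the interval is subdivided, with
-- a separate order of proof on each piece. The two exceptional q are those with `V` - q⁻¹ = q⁻³ or
-- `ρ₁` = q⁻¹, where `D` - q⁻³ or `D` - q⁻¹ refers to itself. There irreducibility modulo 2 makes 1,
-- q, ..., q⁵ linearly independent over ℤ, so that q ↦ 1 is well defined modulo p. The numerical
-- comparisons are sign conditions on integer polynomials over rational intervals, decided by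
-- evaluation during type checking.

-- The Cantor-Schröder-Bernstein theorem for setoids.

module _ (em : ExcludedMiddle 0ℓ) (A B : Setoid 0ℓ 0ℓ) where
  private
    module A = Setoid A
    module B = Setoid B

  cantorSchröderBernstein :
    (f : B.Carrier → A.Carrier) → (∀ {b b′} → b B.≈ b′ → f b A.≈ f b′) → (∀ {b b′} → f b A.≈ f b′ → b B.≈ b′) →
    (g : A.Carrier → B.Carrier) → (∀ {a a′} → a A.≈ a′ → g a B.≈ g a′) → (∀ {a a′} → g a B.≈ g a′ → a A.≈ a′) →
    Bijection A B
  cantorSchröderBernstein f f-cong f-inj g g-cong g-inj = record
    { to = to ; cong = to-cong ; bijective = to-inj , to-surj }
    where
    -- The orbits under `g` ∘ `f` of the points that `g` misses. The bijection undoes `f` on the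
    -- `f`-images of these points and is `g` elsewhere.
    data Chain : B.Carrier → Set where
      start : ∀ {b} → ¬ (∃ λ a → g a B.≈ b) → Chain b
      next  : ∀ {b c} → Chain b → g (f b) B.≈ c → Chain c

    Chain-resp : ∀ {b c} → b B.≈ c → Chain b → Chain c
    Chain-resp e (start n)  = start λ (a , p) → n (a , B.trans p (B.sym e))
    Chain-resp e (next c p) = next c (B.trans p e)

    InChain : A.Carrier → Set
    InChain a = ∃ λ b → Chain b × f b A.≈ a

    -- The decision is an argument so that the lemmas below can match on it instead of on `em`.
    choose : ∀ a → Dec (InChain a) → B.Carrier
    choose a (yes (b , _)) = b
    choose a (no _)        = g a

    to : A.Carrier → B.Carrier
    to a = choose a em

    -- A chain point in the image of `g` is not a start, and injectivity of `g` puts its preimage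
    -- `a′` on the same chain.
    mixed : ∀ {a a′} → ((b , _) : InChain a) → ¬ InChain a′ → ¬ b B.≈ g a′
    mixed (b , start n , _)          out e = n (_ , B.sym e)
    mixed (b , next {c} ch p , _)    out e = out (c , ch , g-inj (B.trans p e))

    choose-cong : ∀ {a a′} d d′ → a A.≈ a′ → choose a d B.≈ choose a′ d′
    choose-cong (yes (b , _ , p)) (yes (b′ , _ , p′)) e = f-inj (A.trans p (A.trans e (A.sym p′)))
    choose-cong (yes (b , c , p)) (no n)              e = ⊥-elim (n (b , c , A.trans p e))
    choose-cong (no n)            (yes (b , c , p))   e = ⊥-elim (n (b , c , A.trans p (A.sym e)))
    choose-cong (no _)            (no _)              e = g-cong e

    to-cong : ∀ {a a′} → a A.≈ a′ → to a B.≈ to a′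
    to-cong = choose-cong em em

    choose-inj : ∀ {a a′} d d′ → choose a d B.≈ choose a′ d′ → a A.≈ a′
    choose-inj (yes (b , _ , p)) (yes (b′ , _ , p′)) e = A.trans (A.sym p) (A.trans (f-cong e) p′)
    choose-inj (yes i)           (no n)              e = ⊥-elim (mixed i n e)
    choose-inj (no n)            (yes i)             e = ⊥-elim (mixed i n (B.sym e))
    choose-inj (no _)            (no _)              e = g-inj e

    to-inj : ∀ {a a′} → to a B.≈ to a′ → a A.≈ a′
    to-inj = choose-inj em em

    on-chain : ∀ {b} → Chain b → ∀ d → choose (f b) d B.≈ b
    on-chain c (yes (b′ , _ , p)) = f-inj p
    on-chain c (no n)             = ⊥-elim (n (_ , c , A.refl))

    off-chain : ∀ {a} → ¬ Chain (g a) → ∀ d → choose a d B.≈ g a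
    off-chain n (yes (b , c , p)) = ⊥-elim (n (next c (g-cong p)))
    off-chain n (no _)            = B.refl

    to-surj : ∀ b → ∃ λ a → ∀ {z} → z A.≈ a → to z B.≈ b
    to-surj b with em {Chain b}
    ... | yes c = f b , λ e → B.trans (to-cong e) (on-chain c em)
    ... | no n with em {∃ λ a → g a B.≈ b}
    ...   | yes (a , p) = a , λ e → B.trans (to-cong e) (B.trans (off-chain (n ∘ Chain-resp p) em) p)
    ...   | no m = ⊥-elim (n (start m))

-- Integer vectors as polynomials modulo a monic sextic, and their reduction modulo 2.

module Parity where
  open +-*-Solver

  bit : Bool → ℤ
  bit false = + 0
  bit true  = + 1

  record HasParity (a : ℤ) (b : Bool) : Set where
    constructor _,_
    field
      half     : ℤ
      equation : a ≡ + 2 ℤ.* half ℤ.+ bit b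

  parity-suc : ∀ {a b} → HasParity a b → HasParity (+ 1 ℤ.+ a) (not b)
  parity-suc {b = false} (k , ≡.refl) = k , solve 1 (λ k → con (+ 1) :+ (con (+ 2) :* k :+ con (+ 0)) := con (+ 2) :* k :+ con (+ 1)) ≡.refl k
  parity-suc {b = true}  (k , ≡.refl) = k ℤ.+ + 1 , solve 1 (λ k → con (+ 1) :+ (con (+ 2) :* k :+ con (+ 1)) := con (+ 2) :* (k :+ con (+ 1)) :+ con (+ 0)) ≡.refl k

  parity-neg : ∀ {a b} → HasParity a b → HasParity (ℤ.- a) b
  parity-neg {b = false} (k , ≡.refl) = ℤ.- k , solve 1 (λ k → :- (con (+ 2) :* k :+ con (+ 0)) := con (+ 2) :* (:- k) :+ con (+ 0)) ≡.refl k
  parity-neg {b = true}  (k , ≡.refl) = ℤ.- k ℤ.- + 1 , solve 1 (λ k → :- (con (+ 2) :* k :+ con (+ 1)) := con (+ 2) :* (:- k :- con (+ 1)) :+ con (+ 1)) ≡.refl k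

  parity-of : ∀ i → ∃ (HasParity i)
  parity-of (+ n)    = natural n
    where
    natural : ∀ n → ∃ (HasParity (+ n))
    natural zero    = false , + 0 , ≡.refl
    natural (suc n) = let b , h = natural n in not b , parity-suc h
  parity-of -[1+ n ] = let b , h = parity-of (+ suc n) in b , parity-neg h

  parity-+ : ∀ {a b x y} → HasParity a x → HasParity b y → HasParity (a ℤ.+ b) (x xor y)
  parity-+ {x = false} {y} (k , ≡.refl) (l , ≡.refl) = k ℤ.+ l , solve 3 (λ k l y → (con (+ 2) :* k :+ con (+ 0)) :+ (con (+ 2) :* l :+ y) := con (+ 2) :* (k :+ l) :+ y) ≡.refl k l (bit y)
  parity-+ {x = true} {false} (k , ≡.refl) (l , ≡.refl) = k ℤ.+ l , solve 2 (λ k l → (con (+ 2) :* k :+ con (+ 1)) :+ (con (+ 2) :* l :+ con (+ 0)) := con (+ 2) :* (k :+ l) :+ con (+ 1)) ≡.refl k l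
  parity-+ {x = true} {true} (k , ≡.refl) (l , ≡.refl) = k ℤ.+ l ℤ.+ + 1 , solve 2 (λ k l → (con (+ 2) :* k :+ con (+ 1)) :+ (con (+ 2) :* l :+ con (+ 1)) := con (+ 2) :* (k :+ l :+ con (+ 1)) :+ con (+ 0)) ≡.refl k l

  parity-* : ∀ {a b x y} → HasParity a x → HasParity b y → HasParity (a ℤ.* b) (x ∧ y)
  parity-* {b = b} {x = false} (k , ≡.refl) _ = k ℤ.* b , solve 2 (λ k b → (con (+ 2) :* k :+ con (+ 0)) :* b := con (+ 2) :* (k :* b) :+ con (+ 0)) ≡.refl k b
  parity-* {x = true} {y} (k , ≡.refl) (l , ≡.refl) = k ℤ.* (+ 2 ℤ.* l ℤ.+ bit y) ℤ.+ l ,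
    solve 3 (λ k l y → (con (+ 2) :* k :+ con (+ 1)) :* (con (+ 2) :* l :+ y) := con (+ 2) :* (k :* (con (+ 2) :* l :+ y) :+ l) :+ y) ≡.refl k l (bit y)

  odd≢0 : ∀ {a} → HasParity a true → ¬ a ≡ + 0
  odd≢0 (k , ≡.refl) e = absurd (ℕₚ.m*n≡1⇒m≡1 2 ∣ ℤ.- k ∣ (≡.trans (≡.sym (ℤₚ.abs-* (+ 2) (ℤ.- k))) (≡.cong ∣_∣ minus)))
    where
    absurd : ¬ 2 ≡ 1
    absurd ()
    minus : + 2 ℤ.* (ℤ.- k) ≡ + 1
    minus = ≡.trans (solve 1 (λ k → con (+ 2) :* (:- k) := con (+ 1) :- (con (+ 2) :* k :+ con (+ 1))) ≡.refl k) (≡.cong (λ x → + 1 ℤ.- x) e)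

  HasParities : ∀ {n} → Vec ℤ n → Vec Bool n → Set
  HasParities = Pointwise HasParity

  parities-of : ∀ {n} (v : Vec ℤ n) → ∃ (HasParities v)
  parities-of []      = [] , []
  parities-of (a ∷ v) = let b , h = parity-of a ; bs , hs = parities-of v in b ∷ bs , h ∷ hs

  infixl 6 _⊕ᵛ_ _⊻_
  infixl 7 _⊛ᵛ_

  _⊕ᵛ_ : ∀ {n} → Vec ℤ n → Vec ℤ n → Vec ℤ n
  _⊕ᵛ_ = zipWith ℤ._+_

  _⊛ᵛ_ : ∀ {n} → ℤ → Vec ℤ n → Vec ℤ n
  c ⊛ᵛ v = map (λ a → c ℤ.* a) v

  _⊻_ : ∀ {n} → Vec Bool n → Vec Bool n → Vec Bool n
  _⊻_ = zipWith _xor_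

  parities-⊕ : ∀ {n} {v w : Vec ℤ n} {x y} → HasParities v x → HasParities w y → HasParities (v ⊕ᵛ w) (x ⊻ y)
  parities-⊕ []       []       = []
  parities-⊕ (h ∷ hs) (k ∷ ks) = parity-+ h k ∷ parities-⊕ hs ks

  parities-⊛ : ∀ {n a x} {v : Vec ℤ n} {y} → HasParity a x → HasParities v y → HasParities (a ⊛ᵛ v) (map (x ∧_) y)
  parities-⊛ h []       = []
  parities-⊛ h (k ∷ ks) = parity-* h k ∷ parities-⊛ h ks

  zeros : ∀ {n} → Vec Bool n
  zeros = replicate _ false

  -- The ℓ¹ norm. Halving a nonzero even vector decreases it, which makes it the measure of the
  -- descent in `independent`.
  size : ∀ {n} → Vec ℤ n → ℕ
  size []      = 0
  size (a ∷ v) = ∣ a ∣ ℕ.+ size v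

  size-zero : ∀ {n} (v : Vec ℤ n) → size v ≡ 0 → v ≡ replicate n (+ 0)
  size-zero []      e = ≡.refl
  size-zero (a ∷ v) e = ≡.cong₂ _∷_ (ℤₚ.∣i∣≡0⇒i≡0 (ℕₚ.m+n≡0⇒m≡0 ∣ a ∣ e)) (size-zero v (ℕₚ.m+n≡0⇒n≡0 ∣ a ∣ e))

  size-⊛ : ∀ {n} c (v : Vec ℤ n) → size (c ⊛ᵛ v) ≡ ∣ c ∣ ℕ.* size v
  size-⊛ c []      = ≡.sym (ℕₚ.*-zeroʳ ∣ c ∣)
  size-⊛ c (a ∷ v) = ≡.trans (≡.cong₂ ℕ._+_ (ℤₚ.abs-* c a) (size-⊛ c v)) (≡.sym (ℕₚ.*-distribˡ-+ ∣ c ∣ ∣ a ∣ (size v)))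

  halve : ∀ {n} {v : Vec ℤ n} → HasParities v zeros → ∃ λ w → v ≡ + 2 ⊛ᵛ w
  halve []                     = [] , ≡.refl
  halve ((k , e) ∷ hs) = let w , es = halve hs in k ∷ w , ≡.cong₂ _∷_ (≡.trans e (ℤₚ.+-identityʳ _)) es

  -- The value at 1 of the polynomial with these coefficients.
  total : ∀ {n} → Vec ℤ n → ℤ
  total []      = + 0
  total (a ∷ v) = a ℤ.+ total v

  total-⊕ : ∀ {n} (v w : Vec ℤ n) → total (v ⊕ᵛ w) ≡ total v ℤ.+ total w
  total-⊕ []      []      = ≡.refl
  total-⊕ (a ∷ v) (b ∷ w) = ≡.trans (≡.cong (λ x → a ℤ.+ b ℤ.+ x) (total-⊕ v w))
    (solve 4 (λ a b v w → a :+ b :+ (v :+ w) := a :+ v :+ (b :+ w)) ≡.refl a b (total v) (total w))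

  total-⊛ : ∀ {n} c (v : Vec ℤ n) → total (c ⊛ᵛ v) ≡ c ℤ.* total v
  total-⊛ c []      = ≡.sym (ℤₚ.*-zeroʳ c)
  total-⊛ c (a ∷ v) = ≡.trans (≡.cong (λ x → c ℤ.* a ℤ.+ x) (total-⊛ c v)) (≡.sym (ℤₚ.*-distribˡ-+ c a (total v)))

  -- Multiplication by x modulo x⁶ = c₀ + c₁ x + ⋯ + c₅ x⁵, over ℤ and over 𝔽₂.
  shift : Vec ℤ 6 → Vec ℤ 6 → Vec ℤ 6
  shift c (v₀ ∷ v₁ ∷ v₂ ∷ v₃ ∷ v₄ ∷ v₅ ∷ []) = (+ 0 ∷ v₀ ∷ v₁ ∷ v₂ ∷ v₃ ∷ v₄ ∷ []) ⊕ᵛ v₅ ⊛ᵛ c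

  shift₂ : Vec Bool 6 → Vec Bool 6 → Vec Bool 6
  shift₂ c (v₀ ∷ v₁ ∷ v₂ ∷ v₃ ∷ v₄ ∷ v₅ ∷ []) = (false ∷ v₀ ∷ v₁ ∷ v₂ ∷ v₃ ∷ v₄ ∷ []) ⊻ map (v₅ ∧_) c

  parities-shift : ∀ {c c₂ v x} → HasParities c c₂ → HasParities v x → HasParities (shift c v) (shift₂ c₂ x)
  parities-shift hc (h₀ ∷ h₁ ∷ h₂ ∷ h₃ ∷ h₄ ∷ h₅ ∷ []) =
    parities-⊕ ((+ 0 , ≡.refl) ∷ h₀ ∷ h₁ ∷ h₂ ∷ h₃ ∷ h₄ ∷ []) (parities-⊛ h₅ hc)

  -- Multiplication by x does not change the value at 1, and the reduction subtracts v₅ times the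
  -- sextic, whose value at 1 is -p.
  total-shift : ∀ {p} c v → total c ≡ + 1 ℤ.+ p → ∃ λ k → total (shift c v) ≡ total v ℤ.+ p ℤ.* k
  total-shift {p} c v@(v₀ ∷ v₁ ∷ v₂ ∷ v₃ ∷ v₄ ∷ v₅ ∷ []) e = v₅ ,
    ≡.trans (total-⊕ (+ 0 ∷ v₀ ∷ v₁ ∷ v₂ ∷ v₃ ∷ v₄ ∷ []) (v₅ ⊛ᵛ c))
    (≡.trans (≡.cong (λ x → total (+ 0 ∷ v₀ ∷ v₁ ∷ v₂ ∷ v₃ ∷ v₄ ∷ []) ℤ.+ x) (≡.trans (total-⊛ v₅ c) (≡.cong (λ x → v₅ ℤ.* x) e)))
    (solve 7 (λ a b c d e f p → (con (+ 0) :+ (a :+ (b :+ (c :+ (d :+ (e :+ con (+ 0))))))) :+ f :* (con (+ 1) :+ p) :=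
        (a :+ (b :+ (c :+ (d :+ (e :+ (f :+ con (+ 0))))))) :+ p :* f) ≡.refl v₀ v₁ v₂ v₃ v₄ v₅ p))

  record Residue (p : ℤ) (v : Vec ℤ 6) (r : ℤ) : Set where
    constructor _,_
    field
      multiple : ℤ
      equation : total v ≡ r ℤ.+ p ℤ.* multiple

  Residue-shift : ∀ {p r} c v → total c ≡ + 1 ℤ.+ p → Residue p v r → Residue p (shift c v) r
  Residue-shift {p} {r} c v tc (k , e) = let l , f = total-shift {p} c v tc in
    k ℤ.+ l , ≡.trans f (≡.trans (≡.cong (λ x → x ℤ.+ p ℤ.* l) e)
      (solve 4 (λ r p k l → r :+ p :* k :+ p :* l := r :+ p :* (k :+ l)) ≡.refl r p k l))

  Residue-⊕ : ∀ {p r s v w} → Residue p v r → Residue p w s → Residue p (v ⊕ᵛ w) (r ℤ.+ s)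
  Residue-⊕ {p} {r} {s} {v} {w} (k , e) (l , f) = k ℤ.+ l , ≡.trans (total-⊕ v w) (≡.trans (≡.cong₂ ℤ._+_ e f)
    (solve 5 (λ p r s k l → (r :+ p :* k) :+ (s :+ p :* l) := (r :+ s) :+ p :* (k :+ l)) ≡.refl p r s k l))

  Residue-⊛ : ∀ {p r v} a → Residue p v r → Residue p (a ⊛ᵛ v) (a ℤ.* r)
  Residue-⊛ {p} {r} {v} a (k , e) = a ℤ.* k , ≡.trans (total-⊛ a v) (≡.trans (≡.cong (λ x → a ℤ.* x) e)
    (solve 4 (λ p r a k → a :* (r :+ p :* k) := a :* r :+ p :* (a :* k)) ≡.refl p r a k))

  one-minus-residue : ∀ {p r t k} → t ≡ r ℤ.+ p ℤ.* k → t ℤ.+ -[1+ 0 ] ≡ + 0 → + 1 ℤ.- r ≡ p ℤ.* k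
  one-minus-residue {p} {r} {t} {k} e f = ≡.trans (solve 2 (λ t r → con (+ 1) :- r := t :- r :- (t :+ con -[1+ 0 ])) ≡.refl t r)
    (≡.trans (≡.cong₂ (λ x y → x ℤ.- r ℤ.- y) e f) (solve 2 (λ r x → r :+ x :- r :- con (+ 0) := x) ≡.refl r (p ℤ.* k)))

  -- α is read as a polynomial with coefficients 0 and 1.
  multiply : ∀ {n} → Vec ℤ 6 → Vec Bool n → Vec ℤ 6 → Vec ℤ 6
  multiply c []      v = replicate 6 (+ 0)
  multiply c (a ∷ α) v = bit a ⊛ᵛ v ⊕ᵛ multiply c α (shift c v)

  multiply₂ : ∀ {n} → Vec Bool 6 → Vec Bool n → Vec Bool 6 → Vec Bool 6
  multiply₂ c []      v = zeros
  multiply₂ c (a ∷ α) v = map (a ∧_) v ⊻ multiply₂ c α (shift₂ c v)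

  parities-multiply : ∀ {n c c₂ v x} (α : Vec Bool n) → HasParities c c₂ → HasParities v x → HasParities (multiply c α v) (multiply₂ c₂ α x)
  parities-multiply []      hc hv = z ∷ z ∷ z ∷ z ∷ z ∷ z ∷ []
    where z = + 0 , ≡.refl
  parities-multiply (a ∷ α) hc hv = parities-⊕ (parities-⊛ (+ 0 , ≡.sym (ℤₚ.+-identityˡ (bit a))) hv) (parities-multiply α hc (parities-shift hc hv))

  all₂ : ∀ n → (Vec Bool n → Bool) → Bool
  all₂ zero    f = f []
  all₂ (suc n) f = all₂ n (f ∘ (true ∷_)) ∧ all₂ n (f ∘ (false ∷_))

  all₂-sound : ∀ n f → T (all₂ n f) → ∀ v → T (f v)
  all₂-sound zero    f t []          = t
  all₂-sound (suc n) f t (true ∷ v)  = all₂-sound n _ (proj₁ (Equivalence.to T-∧ t)) v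
  all₂-sound (suc n) f t (false ∷ v) = all₂-sound n _ (proj₂ (Equivalence.to T-∧ t)) v

  same : ∀ {n} → Vec Bool n → Vec Bool n → Bool
  same []          []          = true
  same (true ∷ v)  (true ∷ w)  = same v w
  same (false ∷ v) (false ∷ w) = same v w
  same (_ ∷ _)     (_ ∷ _)     = false

  same-sound : ∀ {n} (v w : Vec Bool n) → T (same v w) → v ≡ w
  same-sound []          []          _ = ≡.refl
  same-sound (true ∷ v)  (true ∷ w)  t = ≡.cong (true ∷_) (same-sound v w t)
  same-sound (false ∷ v) (false ∷ w) t = ≡.cong (false ∷_) (same-sound v w t)

  one : Vec Bool 6
  one = true ∷ false ∷ false ∷ false ∷ false ∷ false ∷ []

  -- Whether s + α v = 1 for some α of degree less than n.
  reachesOne : Vec Bool 6 → ℕ → Vec Bool 6 → Vec Bool 6 → Bool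
  reachesOne c zero    s v = same s one
  reachesOne c (suc n) s v = reachesOne c n s (shift₂ c v) ∨ reachesOne c n (s ⊻ v) (shift₂ c v)

  reachesOne-sound : ∀ c n s v → T (reachesOne c n s v) → ∃ λ (α : Vec Bool n) → s ⊻ multiply₂ c α v ≡ one
  reachesOne-sound c zero    s v t = [] , ≡.trans (xor-zeros s) (same-sound s one t)
    where
    xor-zeros : ∀ {n} (s : Vec Bool n) → s ⊻ zeros ≡ s
    xor-zeros []      = ≡.refl
    xor-zeros (a ∷ s) = ≡.cong₂ _∷_ (xor-identityʳ a) (xor-zeros s)
  reachesOne-sound c (suc n) s v t with Equivalence.to (T-∨ {reachesOne c n s (shift₂ c v)}) t
  ... | inj₁ l = let α , h = reachesOne-sound c n s (shift₂ c v) l in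
        false ∷ α , ≡.trans (≡.cong (s ⊻_) (zeros-xor v (multiply₂ c α (shift₂ c v)))) h
    where
    zeros-xor : ∀ {n} (v w : Vec Bool n) → map (false ∧_) v ⊻ w ≡ w
    zeros-xor []      []      = ≡.refl
    zeros-xor (a ∷ v) (b ∷ w) = ≡.cong (b ∷_) (zeros-xor v w)
  ... | inj₂ r = let α , h = reachesOne-sound c n (s ⊻ v) (shift₂ c v) r in
        true ∷ α , ≡.trans (≡.trans (≡.cong (λ x → s ⊻ (x ⊻ multiply₂ c α (shift₂ c v))) (Vecₚ.map-id v)) (≡.sym (Vecₚ.zipWith-assoc xor-assoc s v _))) h

  -- Tested by inverting every nonzero residue modulo x⁶ - c over 𝔽₂.
  irreducible : Vec Bool 6 → Bool
  irreducible c = all₂ 6 λ v → same v zeros ∨ reachesOne c 6 zeros v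

  inverse : ∀ c → T (irreducible c) → ∀ v → v ≡ zeros ⊎ ∃ λ α → multiply₂ c α v ≡ one
  inverse c t v with Equivalence.to (T-∨ {same v zeros}) (all₂-sound 6 (λ v → same v zeros ∨ reachesOne c 6 zeros v) t v)
  ... | inj₁ l = inj₁ (same-sound v zeros l)
  ... | inj₂ r = let α , h = reachesOne-sound c 6 zeros v r in inj₂ (α , ≡.trans (≡.sym (zeros-identity (multiply₂ c α v))) h)
    where
    zeros-identity : ∀ {n} (v : Vec Bool n) → zeros ⊻ v ≡ v
    zeros-identity []      = ≡.refl
    zeros-identity (a ∷ v) = ≡.cong (a ∷_) (zeros-identity v)

  diagonal : ∀ {n} → Fin n → Fin n → Bool
  diagonal zero    zero    = true
  diagonal zero    (suc l) = false
  diagonal (suc k) zero    = false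
  diagonal (suc k) (suc l) = diagonal k l

  shifts₂ : Vec Bool 6 → ℕ → Vec Bool 6 → Vec Bool 6
  shifts₂ c zero    v = v
  shifts₂ c (suc n) v = shift₂ c (shifts₂ c n v)

  -- Below degree 6 nothing is reduced, so xᵏ is a unit vector whatever `c` is.
  shifts₂-one : ∀ c k → shifts₂ c (toℕ k) one ≡ Vec.tabulate (diagonal k)
  shifts₂-one (_ ∷ _ ∷ _ ∷ _ ∷ _ ∷ _ ∷ []) zero                                = ≡.refl
  shifts₂-one (_ ∷ _ ∷ _ ∷ _ ∷ _ ∷ _ ∷ []) (suc zero)                          = ≡.refl
  shifts₂-one (_ ∷ _ ∷ _ ∷ _ ∷ _ ∷ _ ∷ []) (suc (suc zero))                    = ≡.refl
  shifts₂-one (_ ∷ _ ∷ _ ∷ _ ∷ _ ∷ _ ∷ []) (suc (suc (suc zero)))              = ≡.refl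
  shifts₂-one (_ ∷ _ ∷ _ ∷ _ ∷ _ ∷ _ ∷ []) (suc (suc (suc (suc zero))))        = ≡.refl
  shifts₂-one (_ ∷ _ ∷ _ ∷ _ ∷ _ ∷ _ ∷ []) (suc (suc (suc (suc (suc zero))))) = ≡.refl

-- Integers in the field, and a ring solver with integer coefficients.

module Reals (ℝ : CompleteOrderedField) where
  open CompleteOrderedField ℝ hiding (zero)
  open Expansions ℝ
  open RingProperties ring using (-0#≈0#; -‿involutive; -‿distribˡ-*; -‿distribʳ-*; -‿+-comm)
  open SemiringMult semiring using (×-homo-+; ×1-homo-*)
  open import Relation.Binary.Reasoning.Setoid setoid

  -- Large literals must not unfold into iterated sums.
  opaque
    big : ℕ → Carrier
    big n = n · 1#

    big-· : ∀ n → big n ≈ n · 1#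
    big-· n = refl

  -- The cases 0 and 1 are separate so that the solver constants 0 and 1 reduce to `0#` and `1#`.
  ν : ℕ → Carrier
  ν 0             = 0#
  ν 1             = 1#
  ν (suc (suc n)) = big (suc (suc n))

  ν-· : ∀ n → ν n ≈ n · 1#
  ν-· 0             = refl
  ν-· 1             = sym (+-identityʳ 1#)
  ν-· (suc (suc n)) = big-· (suc (suc n))

  ν-+ : ∀ m n → ν (m ℕ.+ n) ≈ ν m + ν n
  ν-+ m n = begin
    ν (m ℕ.+ n)      ≈⟨ ν-· (m ℕ.+ n) ⟩
    (m ℕ.+ n) · 1#   ≈⟨ ×-homo-+ 1# m n ⟩
    m · 1# + n · 1#  ≈⟨ +-cong (ν-· m) (ν-· n) ⟨
    ν m + ν n        ∎

  ν-* : ∀ m n → ν (m ℕ.* n) ≈ ν m * ν n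
  ν-* m n = begin
    ν (m ℕ.* n)        ≈⟨ ν-· (m ℕ.* n) ⟩
    (m ℕ.* n) · 1#     ≈⟨ ×1-homo-* m n ⟩
    (m · 1#) * (n · 1#)  ≈⟨ *-cong (ν-· m) (ν-· n) ⟨
    ν m * ν n          ∎

  ν-suc : ∀ n → ν (suc n) ≈ 1# + ν n
  ν-suc = ν-+ 1

  ι : ℤ → Carrier
  ι (+ n)    = ν n
  ι -[1+ n ] = - ν (suc n)

  ι-⊖ : ∀ m n → ι (m ℤ.⊖ n) ≈ ν m - ν n
  ι-⊖ m zero = begin
    ι (m ℤ.⊖ 0)  ≡⟨ ≡.cong ι (ℤₚ.⊖-≥ {m} {0} ℕ.z≤n) ⟩
    ν m          ≈⟨ +-identityʳ (ν m) ⟨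
    ν m + 0#     ≈⟨ +-congˡ -0#≈0# ⟨
    ν m - 0#     ∎
  ι-⊖ zero (suc n) = begin
    - ν (suc n)      ≈⟨ +-identityˡ _ ⟨
    0# - ν (suc n)   ∎
  ι-⊖ (suc m) (suc n) = begin
    ι (suc m ℤ.⊖ suc n)          ≡⟨ ≡.cong ι (ℤₚ.[1+m]⊖[1+n]≡m⊖n m n) ⟩
    ι (m ℤ.⊖ n)                  ≈⟨ ι-⊖ m n ⟩
    ν m - ν n                    ≈⟨ +-congˡ (+-identityˡ _) ⟨
    ν m + (0# - ν n)             ≈⟨ +-congˡ (+-congʳ (-‿inverseʳ 1#)) ⟨
    ν m + (1# - 1# - ν n)        ≈⟨ +-congˡ (+-assoc _ _ _) ⟩
    ν m + (1# + (- 1# - ν n))    ≈⟨ +-assoc _ _ _ ⟨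
    (ν m + 1#) + (- 1# - ν n)    ≈⟨ +-cong (+-comm _ _) (-‿+-comm 1# (ν n)) ⟩
    (1# + ν m) - (1# + ν n)      ≈⟨ +-cong (ν-suc m) (-‿cong (ν-suc n)) ⟨
    ν (suc m) - ν (suc n)        ∎

  ι-+ : ∀ i j → ι (i ℤ.+ j) ≈ ι i + ι j
  ι-+ (+ m)    (+ n)    = ν-+ m n
  ι-+ (+ m)    -[1+ n ] = ι-⊖ m (suc n)
  ι-+ -[1+ m ] (+ n)    = trans (ι-⊖ n (suc m)) (+-comm _ _)
  ι-+ -[1+ m ] -[1+ n ] = begin
    - ν (suc (suc (m ℕ.+ n)))      ≡⟨ ≡.cong (λ k → - ν (suc k)) (≡.sym (ℕₚ.+-suc m n)) ⟩
    - ν (suc m ℕ.+ suc n)          ≈⟨ -‿cong (ν-+ (suc m) (suc n)) ⟩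
    - (ν (suc m) + ν (suc n))      ≈⟨ -‿+-comm _ _ ⟨
    - ν (suc m) - ν (suc n)        ∎

  ι-neg : ∀ i → ι (ℤ.- i) ≈ - ι i
  ι-neg (+ zero)  = sym -0#≈0#
  ι-neg (+ suc n) = refl
  ι-neg -[1+ n ]  = sym (-‿involutive _)

  ι-+◃ : ∀ n → ι (Sign.+ ℤ.◃ n) ≈ ν n
  ι-+◃ zero    = refl
  ι-+◃ (suc n) = refl

  ι--◃ : ∀ n → ι (Sign.- ℤ.◃ n) ≈ - ν n
  ι--◃ zero    = sym -0#≈0#
  ι--◃ (suc n) = refl

  ι-* : ∀ i j → ι (i ℤ.* j) ≈ ι i * ι j
  ι-* (+ m)    (+ n)    = trans (ι-+◃ (m ℕ.* n)) (ν-* m n)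
  ι-* (+ m)    -[1+ n ] = begin
    ι (Sign.- ℤ.◃ (m ℕ.* suc n))  ≈⟨ ι--◃ (m ℕ.* suc n) ⟩
    - ν (m ℕ.* suc n)             ≈⟨ -‿cong (ν-* m (suc n)) ⟩
    - (ν m * ν (suc n))           ≈⟨ -‿distribʳ-* _ _ ⟩
    ν m * - ν (suc n)             ∎
  ι-* -[1+ m ] (+ n)    = begin
    ι (Sign.- ℤ.◃ (suc m ℕ.* n))  ≈⟨ ι--◃ (suc m ℕ.* n) ⟩
    - ν (suc m ℕ.* n)             ≈⟨ -‿cong (ν-* (suc m) n) ⟩
    - (ν (suc m) * ν n)           ≈⟨ -‿distribˡ-* _ _ ⟩
    - ν (suc m) * ν n             ∎
  ι-* -[1+ m ] -[1+ n ] = begin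
    ι (Sign.+ ℤ.◃ (suc m ℕ.* suc n))  ≈⟨ ι-+◃ (suc m ℕ.* suc n) ⟩
    ν (suc m ℕ.* suc n)               ≈⟨ ν-* (suc m) (suc n) ⟩
    ν (suc m) * ν (suc n)             ≈⟨ -‿involutive _ ⟨
    - - (ν (suc m) * ν (suc n))       ≈⟨ -‿cong (-‿distribˡ-* _ _) ⟩
    - (- ν (suc m) * ν (suc n))       ≈⟨ -‿distribʳ-* _ _ ⟩
    - ν (suc m) * - ν (suc n)         ∎

  ι-morphism : CommutativeRing.rawRing ℤₚ.+-*-commutativeRing -Raw-AlmostCommutative⟶ fromCommutativeRing commutativeRing
  ι-morphism = record
    { ⟦_⟧    = ι
    ; +-homo = ι-+
    ; *-homo = ι-*
    ; -‿homo = ι-neg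
    ; 0-homo = refl
    ; 1-homo = refl
    }

  module Solver = RingSolver (CommutativeRing.rawRing ℤₚ.+-*-commutativeRing) (fromCommutativeRing commutativeRing) ι-morphism
    (λ i j → Maybe.map (λ i≡j → reflexive (≡.cong ι i≡j)) (dec⇒maybe (i ℤₚ.≟ j)))
  open Solver using (solve; _:=_; _:+_; _:*_; _:-_; :-_; _:^_; con)


  -- Inequalities, normalised to the positivity of a difference.

  open IsStrictTotalOrder isStrictTotalOrder
    using (compare; <-resp-≈) renaming (irrefl to <-irrefl; trans to <-trans)

  0<-resp : ∀ {x y} → x ≈ y → 0# < x → 0# < y
  0<-resp = proj₁ <-resp-≈

  0≤-resp : ∀ {x y} → x ≈ y → 0# ≤ x → 0# ≤ y
  0≤-resp e (inj₁ p) = inj₁ (0<-resp e p)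
  0≤-resp e (inj₂ p) = inj₂ (trans p e)

  <⇒0< : ∀ {x y} → x < y → 0# < y - x
  <⇒0< {x} {y} p = proj₂ <-resp-≈ (-‿inverseʳ x) (+-monoˡ-< (- x) p)

  0<⇒< : ∀ {x y} → 0# < y - x → x < y
  0<⇒< {x} {y} p = proj₂ <-resp-≈ (+-identityˡ x)
    (proj₁ <-resp-≈ (solve 2 (λ x y → (y :- x) :+ x := y) refl x y) (+-monoˡ-< x p))

  ≤⇒0≤ : ∀ {x y} → x ≤ y → 0# ≤ y - x
  ≤⇒0≤ (inj₁ p) = inj₁ (<⇒0< p)
  ≤⇒0≤ {x} (inj₂ p) = inj₂ (sym (trans (+-congʳ (sym p)) (-‿inverseʳ x)))

  0≤⇒≤ : ∀ {x y} → 0# ≤ y - x → x ≤ y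
  0≤⇒≤ (inj₁ p) = inj₁ (0<⇒< p)
  0≤⇒≤ {x} {y} (inj₂ p) = inj₂ (begin
    x            ≈⟨ +-identityˡ x ⟨
    0# + x       ≈⟨ +-congʳ p ⟩
    (y - x) + x  ≈⟨ solve 2 (λ x y → (y :- x) :+ x := y) refl x y ⟩
    y            ∎)

  ¬0<0 : ∀ {x} → x ≈ 0# → 0# < x → ⊥
  ¬0<0 e p = <-irrefl refl (0<-resp e p)

  <-or-≥ : ∀ x y → x < y ⊎ 0# ≤ x - y
  <-or-≥ x y with compare x y
  ... | tri< p _ _ = inj₁ p
  ... | tri≈ _ p _ = inj₂ (≤⇒0≤ (inj₂ (sym p)))
  ... | tri> _ _ p = inj₂ (≤⇒0≤ (inj₁ p))

  infixl 6 _+⁺_ _⁺+⁰_ _⁰+⁺_ _+⁰_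
  infixl 7 _*⁺_ _*⁰_

  -- The marks tell which operands are positive (⁺) and which are only nonnegative (⁰), so that a
  -- proof of positivity mirrors the expression.
  _⁺+⁰_ : ∀ {x y} → 0# < x → 0# ≤ y → 0# < x + y
  _⁺+⁰_ {x} {y} p (inj₂ q) = 0<-resp (trans (sym (+-identityʳ x)) (+-congˡ q)) p
  _⁺+⁰_ {x} {y} p (inj₁ q) = <-trans q (proj₂ <-resp-≈ (+-identityˡ y) (+-monoˡ-< y p))

  _⁰+⁺_ : ∀ {x y} → 0# ≤ x → 0# < y → 0# < x + y
  p ⁰+⁺ q = 0<-resp (+-comm _ _) (q ⁺+⁰ p)

  _+⁺_ : ∀ {x y} → 0# < x → 0# < y → 0# < x + y
  p +⁺ q = p ⁺+⁰ inj₁ q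

  _+⁰_ : ∀ {x y} → 0# ≤ x → 0# ≤ y → 0# ≤ x + y
  inj₁ p +⁰ q = inj₁ (p ⁺+⁰ q)
  _+⁰_ {x} {y} (inj₂ p) q = 0≤-resp (trans (sym (+-identityˡ y)) (+-congʳ p)) q

  _*⁺_ : ∀ {x y} → 0# < x → 0# < y → 0# < x * y
  _*⁺_ = *-pos

  _*⁰_ : ∀ {x y} → 0# ≤ x → 0# ≤ y → 0# ≤ x * y
  inj₁ p *⁰ inj₁ q = inj₁ (p *⁺ q)
  _*⁰_ {x} {y} (inj₂ p) _ = inj₂ (trans (sym (zeroˡ y)) (*-congʳ p))
  _*⁰_ {x} {y} (inj₁ _) (inj₂ q) = inj₂ (trans (sym (zeroʳ x)) (*-congˡ q))

  0<1 : 0# < 1#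
  0<1 with compare 0# 1#
  ... | tri< p _ _ = p
  ... | tri≈ _ p _ = ⊥-elim (0≉1 p)
  ... | tri> _ _ p = ⊥-elim (<-irrefl refl (<-trans
          (0<-resp (solve 0 ((con (+ 0) :- con (+ 1)) :* (con (+ 0) :- con (+ 1)) := con (+ 1)) refl) (<⇒0< p *⁺ <⇒0< p)) p))

  0<-factor : ∀ {x y} → 0# ≤ x → 0# < x * y → 0# < y
  0<-factor {x} {y} p q with <-or-≥ 0# y
  ... | inj₁ r = r
  ... | inj₂ r = ⊥-elim (¬0<0 (solve 2 (λ x y → x :* y :+ x :* (con (+ 0) :- y) := con (+ 0)) refl x y)
                              (q ⁺+⁰ (p *⁰ r)))

  *-zero-factor : ∀ {x y} → x * y ≈ 0# → ¬ x ≈ 0# → y ≈ 0#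
  *-zero-factor {x} {y} p x≉0 = begin
    y                ≈⟨ *-identityˡ y ⟨
    1# * y           ≈⟨ *-congʳ (⁻¹-inverse x≉0) ⟨
    x * x ⁻¹ * y     ≈⟨ solve 3 (λ x y z → x :* z :* y := x :* y :* z) refl x y (x ⁻¹) ⟩
    x * y * x ⁻¹     ≈⟨ *-congʳ p ⟩
    0# * x ⁻¹        ≈⟨ zeroˡ _ ⟩
    0#               ∎

  0≤ν : ∀ n → 0# ≤ ν n
  0≤ν zero    = inj₂ refl
  0≤ν (suc n) = 0≤-resp (sym (ν-suc n)) (inj₁ 0<1 +⁰ 0≤ν n)

  0<ν : ∀ n → 0# < ν (suc n)
  0<ν n = 0<-resp (sym (ν-suc n)) (0<1 ⁺+⁰ 0≤ν n)

  0≤ι-⊔0 : ∀ i → 0# ≤ ι (ℤ.- (i ℤ.⊓ + 0))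
  0≤ι-⊔0 (+ zero)  = inj₂ refl
  0≤ι-⊔0 (+ suc n) = inj₂ refl
  0≤ι-⊔0 -[1+ n ]  = 0≤ν (suc n)

  0≤ι-⊓ : ∀ i → 0# ≤ ι i - ι (i ℤ.⊓ + 0)
  0≤ι-⊓ (+ zero)  = inj₂ (sym (-‿inverseʳ _))
  0≤ι-⊓ (+ suc n) = 0≤-resp (sym (trans (+-congˡ -0#≈0#) (+-identityʳ _))) (0≤ν (suc n))
  0≤ι-⊓ -[1+ n ]  = inj₂ (sym (-‿inverseʳ _))

  -- Certified positivity of integer polynomials on rational intervals.

  Poly : Set
  Poly = List ℤ

  eval : Poly → Carrier → Carrier
  eval []      x = 0#
  eval (c ∷ p) x = ι c + x * eval p x

  infixl 6 _⊕_
  infixl 7 _⊗_ _⊛_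

  _⊕_ : Poly → Poly → Poly
  []      ⊕ q       = q
  (c ∷ p) ⊕ []      = c ∷ p
  (c ∷ p) ⊕ (d ∷ q) = c ℤ.+ d ∷ p ⊕ q

  _⊛_ : ℤ → Poly → Poly
  c ⊛ p = List.map (c ℤ.*_) p

  _⊗_ : Poly → Poly → Poly
  []      ⊗ q = []
  (c ∷ p) ⊗ q = c ⊛ q ⊕ (+ 0 ∷ p ⊗ q)

  eval-⊕ : ∀ p q x → eval (p ⊕ q) x ≈ eval p x + eval q x
  eval-⊕ []      q       x = sym (+-identityˡ _)
  eval-⊕ (c ∷ p) []      x = sym (+-identityʳ _)
  eval-⊕ (c ∷ p) (d ∷ q) x = begin
    ι (c ℤ.+ d) + x * eval (p ⊕ q) x            ≈⟨ +-cong (ι-+ c d) (*-congˡ (eval-⊕ p q x)) ⟩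
    ι c + ι d + x * (eval p x + eval q x)       ≈⟨ solve 5 (λ c d x p q → c :+ d :+ x :* (p :+ q) := c :+ x :* p :+ (d :+ x :* q)) refl _ _ _ _ _ ⟩
    ι c + x * eval p x + (ι d + x * eval q x)   ∎

  eval-⊛ : ∀ c p x → eval (c ⊛ p) x ≈ ι c * eval p x
  eval-⊛ c []      x = sym (zeroʳ _)
  eval-⊛ c (d ∷ p) x = begin
    ι (c ℤ.* d) + x * eval (c ⊛ p) x   ≈⟨ +-cong (ι-* c d) (*-congˡ (eval-⊛ c p x)) ⟩
    ι c * ι d + x * (ι c * eval p x)   ≈⟨ solve 4 (λ c d x p → c :* d :+ x :* (c :* p) := c :* (d :+ x :* p)) refl _ _ _ _ ⟩
    ι c * (ι d + x * eval p x)         ∎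

  eval-⊗ : ∀ p q x → eval (p ⊗ q) x ≈ eval p x * eval q x
  eval-⊗ []      q x = sym (zeroˡ _)
  eval-⊗ (c ∷ p) q x = begin
    eval (c ⊛ q ⊕ (+ 0 ∷ p ⊗ q)) x                   ≈⟨ eval-⊕ (c ⊛ q) _ x ⟩
    eval (c ⊛ q) x + (0# + x * eval (p ⊗ q) x)       ≈⟨ +-cong (eval-⊛ c q x) (+-congˡ (*-congˡ (eval-⊗ p q x))) ⟩
    ι c * eval q x + (0# + x * (eval p x * eval q x))  ≈⟨ solve 4 (λ c x p q → c :* q :+ (con (+ 0) :+ x :* (p :* q)) := (c :+ x :* p) :* q) refl _ _ _ _ ⟩
    (ι c + x * eval p x) * eval q x                  ∎

  open Solver using (Polynomial; op; var; ⟦_⟧; [+]; [*])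

  -- Reads the syntax of the solver, so that the same expression can occur in an identity and in a
  -- positivity test.
  coefficients : Polynomial 1 → Poly
  coefficients (op [+] p q) = coefficients p ⊕ coefficients q
  coefficients (op [*] p q) = coefficients p ⊗ coefficients q
  coefficients (con c)      = c ∷ []
  coefficients (var zero)   = + 0 ∷ + 1 ∷ []
  coefficients (p :^ n)     = power n
    where
    power : ℕ → Poly
    power zero    = + 1 ∷ []
    power (suc n) = coefficients p ⊗ power n
  coefficients (:- p)       = -[1+ 0 ] ⊛ coefficients p

  eval-constant : ∀ c x → eval (c ∷ []) x ≈ ι c
  eval-constant c x = trans (+-congˡ (zeroʳ x)) (+-identityʳ _)

  eval-coefficients : ∀ p x → eval (coefficients p) x ≈ ⟦ p ⟧ (x ∷ [])
  eval-coefficients (op [+] p q) x = trans (eval-⊕ (coefficients p) _ x) (+-cong (eval-coefficients p x) (eval-coefficients q x))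
  eval-coefficients (op [*] p q) x = trans (eval-⊗ (coefficients p) _ x) (*-cong (eval-coefficients p x) (eval-coefficients q x))
  eval-coefficients (con c)      x = eval-constant c x
  eval-coefficients (var zero)   x = solve 1 (λ x → con (+ 0) :+ x :* (con (+ 1) :+ x :* con (+ 0)) := x) refl x
  eval-coefficients (p :^ n)     x = go n
    where
    go : ∀ n → eval (coefficients (p :^ n)) x ≈ ⟦ p ⟧ (x ∷ []) ^ n
    go zero    = eval-constant (+ 1) x
    go (suc n) = trans (eval-⊗ (coefficients p) _ x) (*-cong (eval-coefficients p x) (go n))
  eval-coefficients (:- p)       x = trans (eval-⊛ -[1+ 0 ] (coefficients p) x)
    (trans (*-congˡ (eval-coefficients p x)) (solve 1 (λ y → :- con (+ 1) :* y := :- y) refl _))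

  -- With N x = a + h, taylor returns N ^ n and the coefficients in h of
  -- N ^ n times the given polynomial of degree n - 1.
  taylor : (N a : ℕ) → Poly → ℕ × Poly
  taylor N a []      = 1 , []
  taylor N a (c ∷ p) = let s , t = taylor N a p in
    N ℕ.* s , ((c ℤ.* + (N ℕ.* s)) ∷ t) ⊕ (+ a ⊛ t)

  eval-taylor : ∀ N a p {x h} → ν N * x ≈ ν a + h →
    let s , t = taylor N a p in eval t h ≈ ν s * eval p x
  eval-taylor N a []      e = sym (zeroʳ _)
  eval-taylor N a (c ∷ p) {x} {h} e with taylor N a p | eval-taylor N a p e
  ... | s , t | ih = begin
    eval (((c ℤ.* + (N ℕ.* s)) ∷ t) ⊕ (+ a ⊛ t)) h
      ≈⟨ eval-⊕ ((c ℤ.* + (N ℕ.* s)) ∷ t) (+ a ⊛ t) h ⟩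
    (ι (c ℤ.* + (N ℕ.* s)) + h * eval t h) + eval (+ a ⊛ t) h
      ≈⟨ +-cong (+-cong (trans (ι-* c _) (*-congˡ (ν-* N s))) (*-congˡ ih)) (trans (eval-⊛ (+ a) t h) (*-congˡ ih)) ⟩
    (ι c * (ν N * ν s) + h * (ν s * eval p x)) + ν a * (ν s * eval p x)
      ≈⟨ solve 6 (λ c N s h a p → (c :* (N :* s) :+ h :* (s :* p)) :+ a :* (s :* p) := c :* (N :* s) :+ (a :+ h) :* (s :* p)) refl _ _ _ _ _ _ ⟩
    ι c * (ν N * ν s) + (ν a + h) * (ν s * eval p x)
      ≈⟨ +-congˡ (*-congʳ e) ⟨
    ι c * (ν N * ν s) + (ν N * x) * (ν s * eval p x)
      ≈⟨ solve 5 (λ c N s x p → c :* (N :* s) :+ (N :* x) :* (s :* p) := (N :* s) :* (c :+ x :* p)) refl _ _ _ _ _ ⟩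
    (ν N * ν s) * (ι c + x * eval p x)
      ≈⟨ *-congʳ (ν-* N s) ⟨
    ν (N ℕ.* s) * (ι c + x * eval p x) ∎

  -- Horner's scheme for 0 <= h <= δ: if the inner value is at least l, then h times it is at least
  -- δ min(l, 0).
  lowerBound : ℕ → Poly → ℤ
  lowerBound δ []      = + 0
  lowerBound δ (c ∷ p) = c ℤ.+ + δ ℤ.* (lowerBound δ p ℤ.⊓ + 0)

  eval-lowerBound : ∀ δ p {h} → 0# ≤ h → 0# ≤ ν δ - h → 0# ≤ eval p h - ι (lowerBound δ p)
  eval-lowerBound δ []      _ _ = inj₂ (sym (-‿inverseʳ _))
  eval-lowerBound δ (c ∷ p) {h} 0≤h h≤δ = 0≤-resp (begin
      h * (eval p h - ι l) + h * (ι l - ι m) + (ν δ - h) * ι (ℤ.- m)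
        ≈⟨ +-congˡ (*-congˡ (ι-neg m)) ⟩
      h * (eval p h - ι l) + h * (ι l - ι m) + (ν δ - h) * - ι m
        ≈⟨ solve 6 (λ c h p l m d → h :* (p :- l) :+ h :* (l :- m) :+ (d :- h) :* :- m := c :+ h :* p :- (c :+ d :* m)) refl (ι c) _ _ _ _ _ ⟩
      ι c + h * eval p h - (ι c + ν δ * ι m)
        ≈⟨ +-congˡ (-‿cong (trans (ι-+ c _) (+-congˡ (ι-* (+ δ) m)))) ⟨
      ι c + h * eval p h - ι (c ℤ.+ + δ ℤ.* m) ∎)
    (0≤h *⁰ eval-lowerBound δ p 0≤h h≤δ +⁰ 0≤h *⁰ 0≤ι-⊓ l +⁰ h≤δ *⁰ 0≤ι-⊔0 l)
    where
    l = lowerBound δ p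
    m = l ℤ.⊓ + 0

  isPositive : ℤ → Bool
  isPositive (+ suc _) = true
  isPositive _         = false

  0<ι : ∀ i → T (isPositive i) → 0# < ι i
  0<ι (+ suc n) _ = 0<ν n

  -- Sufficient for p to be positive on [a/N, b/N], by bisection.
  positiveOn : (depth : ℕ) → Poly → (a b N : ℕ) → Bool
  positiveOn zero    p a b N = isPositive (lowerBound (b ℕ.∸ a) (proj₂ (taylor N a p)))
  positiveOn (suc k) p a b N = isPositive (lowerBound (b ℕ.∸ a) (proj₂ (taylor N a p))) ∨
    (positiveOn k p (a ℕ.+ a) (a ℕ.+ b) (N ℕ.+ N) ∧ positiveOn k p (a ℕ.+ b) (b ℕ.+ b) (N ℕ.+ N))

  -- The endpoints are a/N and b/N with the denominator cleared; bisection doubles N.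
  Between : (a b N : ℕ) → Carrier → Set
  Between a b N x = 0# ≤ ν N * x - ν a × 0# ≤ ν b - ν N * x

  -- Truncated subtraction gives 0 for b < a, so an inequality covers all endpoints without a side
  -- condition.
  ν-∸ : ∀ a b → 0# ≤ ν (b ℕ.∸ a) - (ν b - ν a)
  ν-∸ a b with ℕₚ.≤-total a b
  ... | inj₁ a≤b = inj₂ (sym (begin
        ν (b ℕ.∸ a) - (ν b - ν a)  ≈⟨ solve 3 (λ x b a → x :- (b :- a) := (x :+ a) :- b) refl _ _ _ ⟩
        ν (b ℕ.∸ a) + ν a - ν b    ≈⟨ +-congʳ (ν-+ (b ℕ.∸ a) a) ⟨
        ν (b ℕ.∸ a ℕ.+ a) - ν b    ≡⟨ ≡.cong (λ n → ν n - ν b) (ℕₚ.m∸n+n≡m a≤b) ⟩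
        ν b - ν b                  ≈⟨ -‿inverseʳ _ ⟩
        0#                         ∎))
  ... | inj₂ b≤a = 0≤-resp (begin
        ν (b ℕ.∸ a) + ν (a ℕ.∸ b)                    ≈⟨ solve 3 (λ x y b → x :+ y := x :- (b :- (y :+ b))) refl _ _ (ν b) ⟩
        ν (b ℕ.∸ a) - (ν b - (ν (a ℕ.∸ b) + ν b))    ≈⟨ +-congˡ (-‿cong (+-congˡ (-‿cong (ν-+ (a ℕ.∸ b) b)))) ⟨
        ν (b ℕ.∸ a) - (ν b - ν (a ℕ.∸ b ℕ.+ b))      ≡⟨ ≡.cong (λ n → ν (b ℕ.∸ a) - (ν b - ν n)) (ℕₚ.m∸n+n≡m b≤a) ⟩
        ν (b ℕ.∸ a) - (ν b - ν a)                    ∎) (0≤ν (b ℕ.∸ a) +⁰ 0≤ν (a ℕ.∸ b))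

  lowerBound-sound : ∀ p a b N {x} → Between a b N x →
    T (isPositive (lowerBound (b ℕ.∸ a) (proj₂ (taylor N a p)))) → 0# < eval p x
  lowerBound-sound p a b N {x} (lo , hi) ok = 0<-factor (0≤ν (proj₁ (taylor N a p)))
    (0<-resp (trans (solve 2 (λ l e → l :+ (e :- l) := e) refl _ _)
                    (eval-taylor N a p (solve 2 (λ y a → y := a :+ (y :- a)) refl _ _)))
      (0<ι _ ok ⁺+⁰ eval-lowerBound (b ℕ.∸ a) (proj₂ (taylor N a p)) lo
        (0≤-resp (solve 4 (λ d a b y → d :- (b :- a) :+ (b :- y) := d :- (y :- a)) refl _ _ _ _) (ν-∸ a b +⁰ hi))))

  positiveOn-sound : ∀ k p a b N {x} → Between a b N x → T (positiveOn k p a b N) → 0# < eval p x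
  positiveOn-sound zero    p a b N btw ok = lowerBound-sound p a b N btw ok
  positiveOn-sound (suc k) p a b N {x} (lo , hi) ok with Equivalence.to T-∨ ok
  ... | inj₁ ok₁ = lowerBound-sound p a b N (lo , hi) ok₁
  ... | inj₂ ok₂ with Equivalence.to T-∧ ok₂ | <-or-≥ (ν (N ℕ.+ N) * x) (ν (a ℕ.+ b))
  ...   | okˡ , _ | inj₁ left = positiveOn-sound k p (a ℕ.+ a) (a ℕ.+ b) (N ℕ.+ N)
            (0≤-resp (begin
               (ν N * x - ν a) + (ν N * x - ν a)   ≈⟨ solve 3 (λ N x a → (N :* x :- a) :+ (N :* x :- a) := (N :+ N) :* x :- (a :+ a)) refl _ _ _ ⟩
               (ν N + ν N) * x - (ν a + ν a)       ≈⟨ +-cong (*-congʳ (ν-+ N N)) (-‿cong (ν-+ a a)) ⟨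
               ν (N ℕ.+ N) * x - ν (a ℕ.+ a)       ∎) (lo +⁰ lo)
            , inj₁ (<⇒0< left)) okˡ
  ...   | _ , okʳ | inj₂ right = positiveOn-sound k p (a ℕ.+ b) (b ℕ.+ b) (N ℕ.+ N)
            (right , 0≤-resp (begin
               (ν b - ν N * x) + (ν b - ν N * x)   ≈⟨ solve 3 (λ N x b → (b :- N :* x) :+ (b :- N :* x) := (b :+ b) :- (N :+ N) :* x) refl _ _ _ ⟩
               (ν b + ν b) - (ν N + ν N) * x       ≈⟨ +-cong (ν-+ b b) (-‿cong (*-congʳ (ν-+ N N))) ⟨
               ν (b ℕ.+ b) - ν (N ℕ.+ N) * x       ∎) (hi +⁰ hi)) okʳ

  -- Proof by reflection: at concrete endpoints the test evaluates to `true`, and the last argument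
  -- is `tt`. Bisection goes at most 12 levels deep.
  positive : ∀ (e : Polynomial 1 → Polynomial 1) a b N {x} → Between a b N x →
    T (positiveOn 12 (coefficients (e (var zero))) a b N) → 0# < ⟦ e (var zero) ⟧ (x ∷ [])
  positive e a b N btw ok = 0<-resp (eval-coefficients (e (var zero)) _)
    (positiveOn-sound 12 (coefficients (e (var zero))) a b N btw ok)

  -- Linear independence over ℤ of the powers of a root of a sextic irreducible modulo 2.

  module Independence where
    open Parity

    ι≉0 : ∀ i → ¬ i ≡ + 0 → ¬ ι i ≈ 0#
    ι≉0 (+ zero)  n e = n ≡.refl
    ι≉0 (+ suc k) n e = ¬0<0 e (0<ν k)
    ι≉0 -[1+ k ]  n e = ¬0<0 (trans (solve 1 (λ x → x := con (+ 0) :- (:- x)) refl _) (trans (+-congˡ (-‿cong e)) (-‿inverseʳ 0#))) (0<ν k)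

    combination : ∀ {n} → (Fin n → ℤ) → (Fin n → Carrier) → Carrier
    combination {n} a x = sum {n} (λ l → ι (a l) * x l)

    combination-linear : ∀ {n} a c (f g : Fin n → ℤ) x →
      combination (λ l → a ℤ.* f l ℤ.- c ℤ.* g l) x ≈ ι a * combination f x - ι c * combination g x
    combination-linear {zero}  a c f g x = solve 2 (λ a c → con (+ 0) := a :* con (+ 0) :- c :* con (+ 0)) refl (ι a) (ι c)
    combination-linear {suc n} a c f g x = begin
      ι (a ℤ.* f zero ℤ.- c ℤ.* g zero) * x zero + combination (λ l → a ℤ.* f (suc l) ℤ.- c ℤ.* g (suc l)) (x ∘ suc)
        ≈⟨ +-cong (*-congʳ (trans (ι-+ (a ℤ.* f zero) _) (+-cong (ι-* a (f zero)) (trans (ι-neg (c ℤ.* g zero)) (-‿cong (ι-* c (g zero)))))))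
                  (combination-linear a c (f ∘ suc) (g ∘ suc) (x ∘ suc)) ⟩
      (ι a * ι (f zero) - ι c * ι (g zero)) * x zero + (ι a * combination (f ∘ suc) (x ∘ suc) - ι c * combination (g ∘ suc) (x ∘ suc))
        ≈⟨ solve 7 (λ a c f g x s t → (a :* f :- c :* g) :* x :+ (a :* s :- c :* t) := a :* (f :* x :+ s) :- c :* (g :* x :+ t)) refl _ _ _ _ _ _ _ ⟩
      ι a * combination f x - ι c * combination g x ∎

    -- An integer matrix that is the identity modulo 2 is nonsingular: eliminate with the odd pivot.
    identity-mod-2 : ∀ {n} (A : Fin n → Fin n → ℤ) (x : Fin n → Carrier) → (∀ k l → HasParity (A k l) (diagonal k l)) →
      (∀ k → combination (A k) x ≈ 0#) → ∀ l → x l ≈ 0#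
    identity-mod-2 {suc n} A x odd kernel = λ { zero → x₀ ; (suc l) → rest l }
      where
      a = A zero zero

      B : Fin n → Fin n → ℤ
      B k l = a ℤ.* A (suc k) (suc l) ℤ.- A (suc k) zero ℤ.* A zero (suc l)

      B-odd : ∀ k l → HasParity (B k l) (diagonal k l)
      B-odd k l = ≡.subst (HasParity (B k l)) (xor-false (diagonal k l))
        (parity-+ (parity-* (odd zero zero) (odd (suc k) (suc l))) (parity-neg (parity-* (odd (suc k) zero) (odd zero (suc l)))))
        where
        xor-false : ∀ b → b xor false ≡ b
        xor-false true  = ≡.refl
        xor-false false = ≡.refl

      B-kernel : ∀ k → combination (B k) (x ∘ suc) ≈ 0#
      B-kernel k = begin
        combination (B k) (x ∘ suc)
          ≈⟨ combination-linear a (A (suc k) zero) (A (suc k) ∘ suc) (A zero ∘ suc) (x ∘ suc) ⟩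
        ι a * s - ι (A (suc k) zero) * t
          ≈⟨ solve 5 (λ a c s t x → a :* s :- c :* t := a :* (c :* x :+ s) :- c :* (a :* x :+ t)) refl (ι a) _ s t (x zero) ⟩
        ι a * combination (A (suc k)) x - ι (A (suc k) zero) * combination (A zero) x
          ≈⟨ +-cong (*-congˡ (kernel (suc k))) (-‿cong (*-congˡ (kernel zero))) ⟩
        ι a * 0# - ι (A (suc k) zero) * 0#
          ≈⟨ solve 2 (λ a c → a :* con (+ 0) :- c :* con (+ 0) := con (+ 0)) refl (ι a) _ ⟩
        0# ∎
        where
        s = combination (A (suc k) ∘ suc) (x ∘ suc)
        t = combination (A zero ∘ suc) (x ∘ suc)

      rest : ∀ l → x (suc l) ≈ 0#
      rest = identity-mod-2 B (x ∘ suc) B-odd B-kernel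

      vanish : ∀ {m} (f : Fin m → ℤ) (y : Fin m → Carrier) → (∀ l → y l ≈ 0#) → combination f y ≈ 0#
      vanish {zero}  f y h = refl
      vanish {suc m} f y h = trans (+-cong (trans (*-congˡ (h zero)) (zeroʳ _)) (vanish (f ∘ suc) (y ∘ suc) (h ∘ suc))) (+-identityʳ 0#)

      x₀ : x zero ≈ 0#
      x₀ = *-zero-factor (trans (sym (+-identityʳ _)) (trans (+-congˡ (sym (vanish (A zero ∘ suc) (x ∘ suc) rest))) (kernel zero))) (ι≉0 a (odd≢0 (odd zero zero)))

    value : ∀ {n} → Vec ℤ n → Carrier → Carrier
    value []      x = 0#
    value (a ∷ v) x = ι a + x * value v x

    value-⊕ : ∀ {n} (v w : Vec ℤ n) x → value (v ⊕ᵛ w) x ≈ value v x + value w x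
    value-⊕ []      []      x = sym (+-identityʳ 0#)
    value-⊕ (a ∷ v) (b ∷ w) x = begin
      ι (a ℤ.+ b) + x * value (v ⊕ᵛ w) x               ≈⟨ +-cong (ι-+ a b) (*-congˡ (value-⊕ v w x)) ⟩
      ι a + ι b + x * (value v x + value w x)          ≈⟨ solve 5 (λ c d x p q → c :+ d :+ x :* (p :+ q) := c :+ x :* p :+ (d :+ x :* q)) refl _ _ _ _ _ ⟩
      ι a + x * value v x + (ι b + x * value w x)      ∎

    value-⊛ : ∀ {n} c (v : Vec ℤ n) x → value (c ⊛ᵛ v) x ≈ ι c * value v x
    value-⊛ c []      x = sym (zeroʳ _)
    value-⊛ c (d ∷ v) x = begin
      ι (c ℤ.* d) + x * value (c ⊛ᵛ v) x    ≈⟨ +-cong (ι-* c d) (*-congˡ (value-⊛ c v x)) ⟩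
      ι c * ι d + x * (ι c * value v x)     ≈⟨ solve 4 (λ c d x p → c :* d :+ x :* (c :* p) := c :* (d :+ x :* p)) refl _ _ _ _ ⟩
      ι c * (ι d + x * value v x)           ∎

    -- The factor `y` takes up one power of `x` in each step of the induction.
    value-combination : ∀ {n} (v : Vec ℤ n) x y → combination (lookup v) (λ l → y * x ^ toℕ l) ≈ y * value v x
    value-combination []      x y = sym (zeroʳ y)
    value-combination (a ∷ v) x y = begin
      ι a * (y * 1#) + combination (lookup v) (λ l → y * (x * x ^ toℕ l))
        ≈⟨ +-congˡ (reassociate (lookup v)) ⟩
      ι a * (y * 1#) + combination (lookup v) (λ l → y * x * x ^ toℕ l)
        ≈⟨ +-congˡ (value-combination v x (y * x)) ⟩
      ι a * (y * 1#) + y * x * value v x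
        ≈⟨ solve 4 (λ a y x v → a :* (y :* con (+ 1)) :+ y :* x :* v := y :* (a :+ x :* v)) refl _ _ _ _ ⟩
      y * (ι a + x * value v x) ∎
      where
      reassociate : ∀ {n} (f : Fin n → ℤ) → combination f (λ l → y * (x * x ^ toℕ l)) ≈ combination f (λ l → y * x * x ^ toℕ l)
      reassociate f = go f (λ l → sym (*-assoc y x (x ^ toℕ l)))
        where
        go : ∀ {n} (f : Fin n → ℤ) {g h : Fin n → Carrier} → (∀ l → g l ≈ h l) → combination f g ≈ combination f h
        go {zero}  f e = refl
        go {suc n} f e = +-cong (*-congˡ (e zero)) (go (f ∘ suc) (e ∘ suc))

    module Root (q : Carrier) (c : Vec ℤ 6) (c₂ : Vec Bool 6) (c-parities : HasParities c c₂)
      (root : q ^ 6 ≈ value c q) (irr : T (irreducible c₂)) where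

      value-shift : ∀ v → value (shift c v) q ≈ q * value v q
      value-shift (v₀ ∷ v₁ ∷ v₂ ∷ v₃ ∷ v₄ ∷ v₅ ∷ []) = begin
        value ((+ 0 ∷ v₀ ∷ v₁ ∷ v₂ ∷ v₃ ∷ v₄ ∷ []) ⊕ᵛ v₅ ⊛ᵛ c) q
          ≈⟨ value-⊕ (+ 0 ∷ v₀ ∷ v₁ ∷ v₂ ∷ v₃ ∷ v₄ ∷ []) (v₅ ⊛ᵛ c) q ⟩
        value (+ 0 ∷ v₀ ∷ v₁ ∷ v₂ ∷ v₃ ∷ v₄ ∷ []) q + value (v₅ ⊛ᵛ c) q
          ≈⟨ +-congˡ (trans (value-⊛ v₅ c q) (*-congˡ (sym root))) ⟩
        value (+ 0 ∷ v₀ ∷ v₁ ∷ v₂ ∷ v₃ ∷ v₄ ∷ []) q + ι v₅ * q ^ 6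
          ≈⟨ solve 7 (λ q a b c d e f → let z = con (+ 0) in
               (z :+ q :* (a :+ q :* (b :+ q :* (c :+ q :* (d :+ q :* (e :+ q :* z)))))) :+ f :* q :^ 6 :=
               q :* (a :+ q :* (b :+ q :* (c :+ q :* (d :+ q :* (e :+ q :* (f :+ q :* z))))))) refl q _ _ _ _ _ _ ⟩
        q * value (v₀ ∷ v₁ ∷ v₂ ∷ v₃ ∷ v₄ ∷ v₅ ∷ []) q ∎

      value-zero : ∀ n → value (replicate n (+ 0)) q ≈ 0#
      value-zero zero    = refl
      value-zero (suc n) = trans (+-congˡ (trans (*-congˡ (value-zero n)) (zeroʳ q))) (+-identityʳ 0#)

      value-multiply : ∀ {n} (α : Vec Bool n) {v} → value v q ≈ 0# → value (multiply c α v) q ≈ 0#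
      value-multiply []      e = value-zero 6
      value-multiply (a ∷ α) {v} e = begin
        value (bit a ⊛ᵛ v ⊕ᵛ multiply c α (shift c v)) q                ≈⟨ value-⊕ (bit a ⊛ᵛ v) (multiply c α (shift c v)) q ⟩
        value (bit a ⊛ᵛ v) q + value (multiply c α (shift c v)) q       ≈⟨ +-cong (value-⊛ (bit a) v q) (value-multiply α (trans (value-shift v) (trans (*-congˡ e) (zeroʳ q)))) ⟩
        ι (bit a) * value v q + 0#                                      ≈⟨ +-congʳ (trans (*-congˡ e) (zeroʳ _)) ⟩
        0# + 0#                                                         ≈⟨ +-identityʳ 0# ⟩
        0#                                                              ∎

      shifts : ℕ → Vec ℤ 6 → Vec ℤ 6
      shifts zero    v = v
      shifts (suc n) v = shift c (shifts n v)

      value-shifts : ∀ n v → value (shifts n v) q ≈ q ^ n * value v q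
      value-shifts zero    v = sym (*-identityˡ _)
      value-shifts (suc n) v = trans (value-shift (shifts n v)) (trans (*-congˡ (value-shifts n v)) (sym (*-assoc q _ _)))

      parities-shifts : ∀ n {v x} → HasParities v x → HasParities (shifts n v) (shifts₂ c₂ n x)
      parities-shifts zero    h = h
      parities-shifts (suc n) h = parities-shift c-parities (parities-shifts n h)

      -- The coefficient rows of v, x v, ..., x⁵ v form a matrix that is the identity modulo 2. If v
      -- vanished at q, this matrix would kill the vector (1, q, ..., q⁵), whose first entry is 1.
      unit-nonzero : ∀ {v} → HasParities v one → ¬ value v q ≈ 0#
      unit-nonzero {v} h e = 0≉1 (sym (trans (sym (*-identityˡ 1#)) (identity-mod-2 {6} (λ k → lookup (shifts (toℕ k) v)) (λ l → 1# * q ^ toℕ l)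
        (λ k l → ≡.subst (HasParity (lookup (shifts (toℕ k) v) l))
          (≡.trans (≡.cong (λ x → lookup x l) (shifts₂-one c₂ k)) (Vecₚ.lookup∘tabulate (diagonal k) l))
          (Pointwise.lookup (parities-shifts (toℕ k) h) l))
        (λ k → begin
          combination (lookup (shifts (toℕ k) v)) (λ l → 1# * q ^ toℕ l)   ≈⟨ value-combination (shifts (toℕ k) v) q 1# ⟩
          1# * value (shifts (toℕ k) v) q                                  ≈⟨ *-congˡ (trans (value-shifts (toℕ k) v) (*-congˡ e)) ⟩
          1# * (q ^ toℕ k * 0#)                                            ≈⟨ solve 1 (λ p → con (+ 1) :* (p :* con (+ 0)) := con (+ 0)) refl _ ⟩
          0#                                                               ∎) zero)))

      -- Infinite descent. A relation that is nonzero modulo 2 could be multiplied by its inverse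
      -- modulo 2 into one excluded by `unit-nonzero`. So every relation is even, and half of it is
      -- a smaller relation.
      independent : ∀ n v → size v ℕ.≤ n → value v q ≈ 0# → v ≡ replicate 6 (+ 0)
      independent zero    v le e = size-zero v (ℕₚ.n≤0⇒n≡0 le)
      independent (suc n) v le e = go (parities-of v)
        where
        half : ∀ s → s ℕ.+ (s ℕ.+ 0) ℕ.≤ suc n → s ℕ.≤ n
        half zero    _            = ℕ.z≤n
        half (suc s) (ℕ.s≤s le′) = ℕₚ.≤-trans (ℕₚ.≤-trans (ℕₚ.m≤m+n (suc s) 0) (ℕₚ.m≤n+m (suc s ℕ.+ 0) s)) le′

        go : ∃ (HasParities v) → v ≡ replicate 6 (+ 0)
        go (b , h) with inverse c₂ irr b
        ... | inj₂ (α , eq) = ⊥-elim (unit-nonzero (≡.subst (HasParities (multiply c α v)) eq (parities-multiply α c-parities h)) (value-multiply α e))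
        ... | inj₁ ≡.refl = ≡.trans v≡ (≡.cong (λ x → + 2 ⊛ᵛ x) (independent n w
                (half (size w) (≡.subst (ℕ._≤ suc n) (≡.trans (≡.cong size v≡) (size-⊛ (+ 2) w)) le))
                (*-zero-factor (trans (sym (value-⊛ (+ 2) w q)) (trans (reflexive (≡.cong (λ x → value x q) (≡.sym v≡))) e)) (ι≉0 (+ 2) λ ()))))
          where
          w = proj₁ (halve h)
          v≡ = proj₂ (halve h)

      -- Sending q to 1 defines a homomorphism ℤ[q] → ℤ/p, which maps the
      -- powers of q to 1.
      module Homomorphism (p : ℤ) (total-c : total c ≡ + 1 ℤ.+ p) (p≢±1 : ¬ ∣ p ∣ ≡ 1) where

        Residue-shifts : ∀ n {v r} → Residue p v r → Residue p (shifts n v) r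
        Residue-shifts zero    h = h
        Residue-shifts (suc n) {v} {r} h = Residue-shift {p} {r} c (shifts n v) total-c (Residue-shifts n {v} {r} h)

        -- The polynomial xⁿ v - 1, once reduced, vanishes at q and is therefore the zero vector.
        -- Its value at 1 is thus 0, and it is also r - 1 modulo p.
        residue-of-power : ∀ n v {r} → Residue p v r → q ^ n * value v q ≈ 1# → ∃ λ k → + 1 ℤ.- r ≡ p ℤ.* k
        residue-of-power n v {r} h e = let k , total-s = Residue-shifts n {v} {r} h in
          k , one-minus-residue {p} {r} {total s} {k} total-s (≡.trans (≡.sym (total-⊕ s minus-one)) (≡.cong total zero-vector))
          where
          s minus-one : Vec ℤ 6
          s         = shifts n v
          minus-one = -[1+ 0 ] ∷ replicate 5 (+ 0)

          zero-vector : s ⊕ᵛ minus-one ≡ replicate 6 (+ 0)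
          zero-vector = independent (size (s ⊕ᵛ minus-one)) (s ⊕ᵛ minus-one) ℕₚ.≤-refl (begin
            value (s ⊕ᵛ minus-one) q                                     ≈⟨ value-⊕ s minus-one q ⟩
            value s q + (- 1# + q * value (replicate 5 (+ 0)) q)         ≈⟨ +-cong (trans (value-shifts n v) e) (+-congˡ (trans (*-congˡ (value-zero 5)) (zeroʳ q))) ⟩
            1# + (- 1# + 0#)                                             ≈⟨ trans (+-congˡ (+-identityʳ _)) (-‿inverseʳ 1#) ⟩
            0#                                                           ∎)

        -- Here 1 - r is 1 or -1, which p divides only if it is itself a unit.
        not-power : ∀ n v → Residue p v (+ 0) ⊎ Residue p v (+ 2) → ¬ q ^ n * value v q ≈ 1#
        not-power n v (inj₁ h) e = let k , f = residue-of-power n v {+ 0} h e in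
          p≢±1 (ℕₚ.m*n≡1⇒m≡1 ∣ p ∣ ∣ k ∣ (≡.trans (≡.sym (ℤₚ.abs-* p k)) (≡.cong ∣_∣ (≡.sym f))))
        not-power n v (inj₂ h) e = let k , f = residue-of-power n v {+ 2} h e in
          p≢±1 (ℕₚ.m*n≡1⇒m≡1 ∣ p ∣ ∣ k ∣ (≡.trans (≡.sym (ℤₚ.abs-* p k)) (≡.cong ∣_∣ (≡.sym f))))

  -- Numerical location of q between the golden ratio and q₃.

  module Bounds where
    quintic : Carrier → Carrier
    quintic x = x ^ 5 - x ^ 4 - x ^ 3 - x + 1#

    :quintic : ∀ {n} → Polynomial n → Polynomial n
    :quintic x = x :^ 5 :- x :^ 4 :- x :^ 3 :- x :+ con (+ 1)

    above-1 : ∀ {x} → 1# < x → 0# ≤ ν 10000 * x - ν 10000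
    above-1 {x} p = inj₁ (0<-resp (solve 1 (λ x → con (+ 10000) :* (x :- con (+ 1)) := con (+ 10000) :* x :- con (+ 10000)) refl x) (0<ν 9999 *⁺ <⇒0< p))

    -- Completing the square, 4 (q² - q - 1) = (2q - 1 + √5) (2q - 1 - √5), where the first factor
    -- is positive.
    golden : ∀ {q √5} → 1# < q → IsSqrt (fromℕ 5) √5 → q * q - q - 1# ≈ 0# → q ≈ (1# + √5) / fromℕ 2
    golden {q} {√5} 1<q (0≤√5 , square) e = begin
      q                                    ≈⟨ *-identityʳ q ⟨
      q * 1#                               ≈⟨ *-congˡ (⁻¹-inverse (λ z → ¬0<0 (trans (ν-· 2) z) (0<ν 1))) ⟨
      q * (fromℕ 2 * fromℕ 2 ⁻¹)           ≈⟨ *-assoc _ _ _ ⟨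
      q * fromℕ 2 * fromℕ 2 ⁻¹             ≈⟨ *-congʳ 2q ⟩
      (1# + √5) / fromℕ 2                  ∎
      where
      difference : q * ν 2 - (1# + √5) ≈ 0#
      difference = *-zero-factor {x = ν 2 * q - 1# + √5} (begin
          (ν 2 * q - 1# + √5) * (q * ν 2 - (1# + √5))   ≈⟨ solve 2 (λ q s → (con (+ 2) :* q :- con (+ 1) :+ s) :* (q :* con (+ 2) :- (con (+ 1) :+ s)) :=
                                                              con (+ 4) :* (q :* q :- q :- con (+ 1)) :+ con (+ 5) :- s :* s) refl q √5 ⟩
          ν 4 * (q * q - q - 1#) + ν 5 - √5 * √5        ≈⟨ +-cong (+-cong (*-congˡ e) (ν-· 5)) (-‿cong square) ⟩
          ν 4 * 0# + fromℕ 5 - fromℕ 5                  ≈⟨ solve 2 (λ a b → a :* con (+ 0) :+ b :- b := con (+ 0)) refl _ _ ⟩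
          0#                                            ∎)
        λ z → ¬0<0 z ((0<-resp (solve 1 (λ q → q :- con (+ 1) :+ (q :- con (+ 1)) :+ con (+ 1) := con (+ 2) :* q :- con (+ 1)) refl q)
                        (<⇒0< 1<q +⁺ <⇒0< 1<q +⁺ 0<1)) ⁺+⁰ 0≤√5)

      2q : q * fromℕ 2 ≈ 1# + √5
      2q = begin
        q * fromℕ 2                              ≈⟨ *-congˡ (ν-· 2) ⟨
        q * ν 2                                  ≈⟨ solve 2 (λ x y → x := x :- y :+ y) refl _ (1# + √5) ⟩
        q * ν 2 - (1# + √5) + (1# + √5)          ≈⟨ +-congʳ difference ⟩
        0# + (1# + √5)                           ≈⟨ +-identityˡ _ ⟩
        1# + √5                                  ∎

    -- The quintic is positive from 1.6805, just above its root, up to 2.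
    q₃-bound : ∀ {q₃} → IsQ₃ q₃ → 0# ≤ ν 16805 - ν 10000 * q₃
    q₃-bound {q₃} (1<q₃ , q₃<2 , root) with <-or-≥ (ν 10000 * q₃) (ν 16805)
    ... | inj₁ l = inj₁ (<⇒0< l)
    ... | inj₂ r = ⊥-elim (¬0<0 root (positive :quintic 16805 20000 10000 (r , inj₁ below-2) tt))
      where
      below-2 : 0# < ν 20000 - ν 10000 * q₃
      below-2 = 0<-resp (trans (*-congˡ (+-congʳ (sym (ν-· 2)))) (solve 1 (λ x → con (+ 10000) :* (con (+ 2) :- x) := con (+ 20000) :- con (+ 10000) :* x) refl q₃))
        (0<ν 9999 *⁺ <⇒0< q₃<2)

    below-q₃ : ∀ {q q₃} → q < q₃ → IsQ₃ q₃ → 0# ≤ ν 16805 - ν 10000 * q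
    below-q₃ {q} {q₃} l h = 0≤-resp (solve 3 (λ a q r → a :- con (+ 10000) :* r :+ con (+ 10000) :* (r :- q) := a :- con (+ 10000) :* q) refl (ν 16805) q q₃)
      (q₃-bound h +⁰ inj₁ (0<ν 9999 *⁺ <⇒0< l))

    -- Beyond 1.68 all Taylor coefficients of the quintic are positive.
    quintic-negative : ∀ {q q₃} → 1# < q → q < q₃ → IsQ₃ q₃ → 0# < 0# - quintic q
    quintic-negative {q} {q₃} 1<q q<q₃ h@(_ , _ , root) with <-or-≥ (quintic q) 0# | <-or-≥ (ν 10000 * q) (ν 16800)
    ... | inj₁ n | _      = <⇒0< n
    ... | inj₂ _ | inj₁ l = positive (λ x → con (+ 0) :- :quintic x) 10000 16800 10000 (above-1 1<q , inj₁ (<⇒0< l)) tt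
    ... | inj₂ n | inj₂ l = ⊥-elim (¬0<0
          (trans (solve 2 (λ q r → let d = r :- q in
              (:quintic q :- con (+ 0)) :+ (d :* (con (+ 5) :* q :^ 4 :- con (+ 4) :* q :^ 3 :- con (+ 3) :* q :^ 2 :- con (+ 1))
                :+ d :* d :* (con (+ 10) :* q :^ 3 :- con (+ 6) :* q :^ 2 :- con (+ 3) :* q)
                :+ d :* d :* d :* (con (+ 10) :* q :^ 2 :- con (+ 4) :* q :- con (+ 1))
                :+ d :* d :* d :* d :* (con (+ 5) :* q :- con (+ 1))
                :+ d :* d :* d :* d :* d) := :quintic r) refl q q₃) root)
          (n ⁰+⁺ (0<d *⁺ positive (λ q → con (+ 5) :* q :^ 4 :- con (+ 4) :* q :^ 3 :- con (+ 3) :* q :^ 2 :- con (+ 1)) 16800 16805 10000 btw tt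
            +⁺ 0<d *⁺ 0<d *⁺ positive (λ q → con (+ 10) :* q :^ 3 :- con (+ 6) :* q :^ 2 :- con (+ 3) :* q) 16800 16805 10000 btw tt
            +⁺ 0<d *⁺ 0<d *⁺ 0<d *⁺ positive (λ q → con (+ 10) :* q :^ 2 :- con (+ 4) :* q :- con (+ 1)) 16800 16805 10000 btw tt
            +⁺ 0<d *⁺ 0<d *⁺ 0<d *⁺ 0<d *⁺ positive (λ q → con (+ 5) :* q :- con (+ 1)) 16800 16805 10000 btw tt
            +⁺ 0<d *⁺ 0<d *⁺ 0<d *⁺ 0<d *⁺ 0<d)))
      where
      0<d : 0# < q₃ - q
      0<d = <⇒0< q<q₃
      btw : Between 16800 16805 10000 q
      btw = l , below-q₃ q<q₃ h

    golden-below : ∀ {q} → 1# < q → 0# < q * q - q - 1# → 0# ≤ ν 10000 * q - ν 16180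
    golden-below {q} 1<q 0<u with <-or-≥ (ν 10000 * q) (ν 16180)
    ... | inj₂ r = r
    ... | inj₁ l = ⊥-elim (¬0<0 (solve 1 (λ u → u :+ (con (+ 0) :- u) := con (+ 0)) refl _)
          (0<u +⁺ positive (λ q → con (+ 0) :- (q :* q :- q :- con (+ 1))) 10000 16180 10000 (above-1 1<q , inj₁ (<⇒0< l)) tt))

  -- The scaled digit dynamics: orbits, trees of orbits and expansions.

  module Base (em : ExcludedMiddle 0ℓ) (q : Carrier) (1<q : 1# < q) where

    0<q : 0# < q
    0<q = <-trans 0<1 1<q

    0<q-1 : 0# < q - 1#
    0<q-1 = <⇒0< 1<q

    q≉0 : ¬ q ≈ 0#
    q≉0 e = ¬0<0 e 0<q

    0<q^ : ∀ n → 0# < q ^ n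
    0<q^ zero    = 0<1
    0<q^ (suc n) = 0<q *⁺ 0<q^ n

    q^n≉0 : ∀ n → ¬ q ^ n ≈ 0#
    q^n≉0 n e = ¬0<0 e (0<q^ n)

    q^-mono : ∀ {m n} → m ℕ.≤ n → 0# ≤ q ^ n - q ^ m
    q^-mono {n = zero}  ℕ.z≤n = inj₂ (sym (-‿inverseʳ _))
    q^-mono {n = suc n} ℕ.z≤n = 0≤-resp (solve 2 (λ q p → (q :- con (+ 1)) :* p :+ (p :- con (+ 1)) := q :* p :- con (+ 1)) refl _ _)
      (inj₁ (0<q-1 *⁺ 0<q^ n) +⁰ q^-mono {n = n} ℕ.z≤n)
    q^-mono (ℕ.s≤s le) = 0≤-resp (solve 3 (λ q x y → q :* (x :- y) := q :* x :- q :* y) refl _ _ _) (inj₁ 0<q *⁰ q^-mono le)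

    -- If the powers were bounded with supremum s, then s / q would be a smaller bound.
    powers-unbounded : ∀ {a} → 0# < a → ∀ M → ∃ λ n → M < q ^ n * a
    powers-unbounded {a} 0<a M with em {∃ λ n → M < q ^ n * a}
    ... | yes p = p
    ... | no ¬p = ⊥-elim (¬0<0 eq (s<s ⁺+⁰ s≤s/q))
      where
      Powers : Carrier → Set
      Powers x = ∃ λ n → x ≈ q ^ n * a

      bounded : UpperBound Powers M
      bounded x (n , e) with <-or-≥ M (q ^ n * a)
      ... | inj₁ p = ⊥-elim (¬p (n , p))
      ... | inj₂ p = 0≤⇒≤ (0≤-resp (+-congˡ (-‿cong (sym e))) p)

      lub = complete Powers (a , 0 , sym (*-identityˡ a)) (M , bounded)
      s = proj₁ lub

      s/q-bound : UpperBound Powers (s * q ⁻¹)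
      s/q-bound x (n , e) = 0≤⇒≤ (0≤-resp
        (begin
          q ⁻¹ * (s - q ^ suc n * a)            ≈⟨ solve 5 (λ i s q p a → i :* (s :- q :* p :* a) := s :* i :- q :* i :* (p :* a)) refl _ _ _ _ _ ⟩
          s * q ⁻¹ - q * q ⁻¹ * (q ^ n * a)     ≈⟨ +-congˡ (-‿cong (*-cong (⁻¹-inverse q≉0) (sym e))) ⟩
          s * q ⁻¹ - 1# * x                     ≈⟨ +-congˡ (-‿cong (*-identityˡ x)) ⟩
          s * q ⁻¹ - x                          ∎)
        (inj₁ (0<-factor (inj₁ 0<q) (0<-resp (sym (⁻¹-inverse q≉0)) 0<1)) *⁰ ≤⇒0≤ (proj₁ (proj₂ lub) _ (suc n , refl))))

      s≤s/q : 0# ≤ q * (s * q ⁻¹ - s)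
      s≤s/q = inj₁ 0<q *⁰ ≤⇒0≤ (proj₂ (proj₂ lub) _ s/q-bound)

      0<s : 0# < s
      0<s = 0<-resp (solve 2 (λ s x → con (+ 1) :* x :+ (s :- con (+ 1) :* x) := s) refl s a)
        (0<1 *⁺ 0<a ⁺+⁰ ≤⇒0≤ (proj₁ (proj₂ lub) _ (0 , refl)))

      s<s : 0# < (q - 1#) * s
      s<s = 0<q-1 *⁺ 0<s

      eq : (q - 1#) * s + q * (s * q ⁻¹ - s) ≈ 0#
      eq = begin
        (q - 1#) * s + q * (s * q ⁻¹ - s)   ≈⟨ solve 3 (λ q s i → (q :- con (+ 1)) :* s :+ q :* (s :* i :- s) := (q :* i :- con (+ 1)) :* s) refl _ _ _ ⟩
        (q * q ⁻¹ - 1#) * s                 ≈⟨ *-congʳ (+-congʳ (⁻¹-inverse q≉0)) ⟩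
        (1# - 1#) * s                       ≈⟨ solve 1 (λ s → (con (+ 1) :- con (+ 1)) :* s := con (+ 0)) refl s ⟩
        0#                                  ∎

    -- Scaling by K makes the interval [0, q + 1] and the points with a unique
    -- expansion powers of q⁻¹.
    K : Carrier
    K = q * q - 1#

    InInterval : Carrier → Set
    InInterval x = 0# ≤ x × 0# ≤ q + 1# - x

    weight : Fin 2 → Carrier
    weight zero       = 0#
    weight (suc zero) = K

    child : Fin 2 → Carrier → Carrier
    child d x = q * x - weight d

    child-cong : ∀ d {x y} → x ≈ y → child d x ≈ child d y
    child-cong d e = +-congʳ (*-congˡ e)

    InInterval-resp : ∀ {x y} → x ≈ y → InInterval x → InInterval y
    InInterval-resp e (l , r) = 0≤-resp e l , 0≤-resp (+-congˡ (-‿cong e)) r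

    infix 4 _⇝_
    data _⇝_ (x y : Carrier) : Set where
      here : x ≈ y → x ⇝ y
      step : ∀ d → InInterval (child d x) → child d x ⇝ y → x ⇝ y

    ⇝-resp : ∀ {x x′ y} → x ≈ x′ → x ⇝ y → x′ ⇝ y
    ⇝-resp e (here p)     = here (trans (sym e) p)
    ⇝-resp e (step d i p) = step d (InInterval-resp (child-cong d e) i) (⇝-resp (child-cong d e) p)

    record Branch (Q : Carrier → Set) (x : Carrier) : Set where
      constructor branch
      field
        {node} : Carrier
        path   : x ⇝ node
        kids   : ∀ d → Q (child d node)

    record Orbit (x : Carrier) (δ : ℕ → Fin 2) : Set where
      field
        point    : ℕ → Carrier
        initial  : point 0 ≈ x
        next     : ∀ n → point (suc n) ≈ child (δ n) (point n)
        interval : ∀ n → InInterval (point n)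

    module Tree (Q : Carrier → Set) (Q-interval : ∀ {x} → Q x → InInterval x) (Q-branch : ∀ {x} → Q x → Branch Q x) where

      -- Each bit of σ selects the child at one branching node; the paths dictate the digits in
      -- between.
      digits : ∀ {x} → Branch Q x → (ℕ → Fin 2) → ℕ → Fin 2
      digits (branch (here e) k)     σ zero    = σ 0
      digits (branch (here e) k)     σ (suc n) = digits (Q-branch (k (σ 0))) (σ ∘ suc) n
      digits (branch (step d i p) k) σ zero    = d
      digits (branch (step d i p) k) σ (suc n) = digits (branch p k) σ n

      points : ∀ {x} → Branch Q x → (ℕ → Fin 2) → ℕ → Carrier
      points {x} b                     σ zero    = x
      points (branch (here e) k)     σ (suc n) = points (Q-branch (k (σ 0))) (σ ∘ suc) n
      points (branch (step d i p) k) σ (suc n) = points (branch p k) σ n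

      points-next : ∀ {x} (b : Branch Q x) σ n → points b σ (suc n) ≈ child (digits b σ n) (points b σ n)
      points-next (branch (here e) k)     σ zero    = child-cong (σ 0) (sym e)
      points-next (branch (here e) k)     σ (suc n) = points-next (Q-branch (k (σ 0))) (σ ∘ suc) n
      points-next (branch (step d i p) k) σ zero    = refl
      points-next (branch (step d i p) k) σ (suc n) = points-next (branch p k) σ n

      points-interval : ∀ {x} (b : Branch Q x) → InInterval x → ∀ σ n → InInterval (points b σ n)
      points-interval b i σ zero = i
      points-interval (branch (here e) k)     _ σ (suc n) = points-interval (Q-branch (k (σ 0))) (Q-interval (k (σ 0))) (σ ∘ suc) n
      points-interval (branch (step d i p) k) _ σ (suc n) = points-interval (branch p k) i σ n

      orbit : ∀ {x} (b : Branch Q x) → InInterval x → ∀ σ → Orbit x (digits b σ)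
      orbit b i σ = record
        { point = points b σ ; initial = refl ; next = points-next b σ ; interval = points-interval b i σ }

      digits-cong : ∀ {x} (b : Branch Q x) {σ τ} → σ ≗ τ → digits b σ ≗ digits b τ
      digits-cong (branch (here e) k)     eq zero    = eq 0
      digits-cong (branch (here e) k) {σ} {τ} eq (suc n) rewrite eq 0 = digits-cong (Q-branch (k (τ 0))) (eq ∘ suc) n
      digits-cong (branch (step d i p) k) eq zero    = ≡.refl
      digits-cong (branch (step d i p) k) eq (suc n) = digits-cong (branch p k) eq n

      -- The bits of σ occur unchanged among the digits, and as long as they agree, both sequences
      -- pass through the same nodes. A path step consumes no bit, so the induction is on n and then
      -- on the path.
      digits-injective : ∀ {x} (b : Branch Q x) {σ τ} → digits b σ ≗ digits b τ → σ ≗ τ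
      digits-injective (branch p k) eq n = go n p k eq
        where
        go : ∀ n {x y} (p : x ⇝ y) (k : ∀ d → Q (child d y)) {σ τ} → digits (branch p k) σ ≗ digits (branch p k) τ → σ n ≡ τ n
        go n       (step d i p) k eq = go n p k (eq ∘ suc)
        go zero    (here e)     k eq = eq 0
        go (suc n) (here e)     k {σ} {τ} eq = tail (eq 0) (eq ∘ suc)
          where
          -- The two subtrees depend on `σ 0` and `τ 0`; with both in the type, rewriting identifies
          -- them.
          tail : σ 0 ≡ τ 0 →
            (∀ m → digits (Q-branch (k (σ 0))) (σ ∘ suc) m ≡ digits (Q-branch (k (τ 0))) (τ ∘ suc) m) → σ (suc n) ≡ τ (suc n)
          tail e₀ es rewrite e₀ = go n (Branch.path (Q-branch (k (τ 0)))) (Branch.kids (Q-branch (k (τ 0)))) es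

    0<K : 0# < K
    0<K = 0<-resp (solve 1 (λ q → (q :- con (+ 1)) :* (q :- con (+ 1)) :+ con (+ 2) :* (q :- con (+ 1)) := q :* q :- con (+ 1)) refl q)
      (0<q-1 *⁺ 0<q-1 +⁺ 0<ν 1 *⁺ 0<q-1)

    ⁻¹-distrib : ∀ n → (q ^ suc n) ⁻¹ ≈ q ⁻¹ * (q ^ n) ⁻¹
    ⁻¹-distrib n = begin
      (q ^ suc n) ⁻¹                                                ≈⟨ *-identityˡ _ ⟨
      1# * (q ^ suc n) ⁻¹                                           ≈⟨ *-congʳ (trans (sym (*-identityˡ 1#)) (*-cong (sym (⁻¹-inverse q≉0)) (sym (⁻¹-inverse (q^n≉0 n))))) ⟩
      q * q ⁻¹ * (q ^ n * (q ^ n) ⁻¹) * (q ^ suc n) ⁻¹              ≈⟨ solve 5 (λ q i p j k → q :* i :* (p :* j) :* k := q :* p :* k :* (i :* j)) refl _ _ _ _ _ ⟩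
      q * q ^ n * (q ^ suc n) ⁻¹ * (q ⁻¹ * (q ^ n) ⁻¹)              ≈⟨ *-congʳ (⁻¹-inverse (q^n≉0 (suc n))) ⟩
      1# * (q ⁻¹ * (q ^ n) ⁻¹)                                      ≈⟨ *-identityˡ _ ⟩
      q ⁻¹ * (q ^ n) ⁻¹                                             ∎

    -- The offset `k` is there for the induction: removing the first summand raises the exponents of
    -- the others.
    shifted-sum : ∀ n (a : ℕ → Carrier) k →
      sum {n} (λ i → a (toℕ i) / q ^ suc (k ℕ.+ toℕ i)) ≈ q ⁻¹ * sum {n} (λ i → a (toℕ i) / q ^ (k ℕ.+ toℕ i))
    shifted-sum zero    a k = sym (zeroʳ _)
    shifted-sum (suc n) a k = begin
      a 0 * (q ^ suc (k ℕ.+ 0)) ⁻¹ + sum {n} (λ i → a (suc (toℕ i)) / q ^ suc (k ℕ.+ suc (toℕ i)))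
        ≈⟨ +-cong (*-congˡ (⁻¹-distrib (k ℕ.+ 0))) tail ⟩
      a 0 * (q ⁻¹ * (q ^ (k ℕ.+ 0)) ⁻¹) + q ⁻¹ * sum {n} (λ i → a (suc (toℕ i)) / q ^ (k ℕ.+ suc (toℕ i)))
        ≈⟨ solve 4 (λ a i j s → a :* (i :* j) :+ i :* s := i :* (a :* j :+ s)) refl _ _ _ _ ⟩
      q ⁻¹ * (a 0 * (q ^ (k ℕ.+ 0)) ⁻¹ + sum {n} (λ i → a (suc (toℕ i)) / q ^ (k ℕ.+ suc (toℕ i)))) ∎
      where
      sum-reindex : ∀ n (b c : ℕ → Carrier) → (∀ i → b i ≈ c i) → sum {n} (λ i → b (toℕ i)) ≈ sum {n} (λ i → c (toℕ i))
      sum-reindex zero    b c e = refl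
      sum-reindex (suc n) b c e = +-cong (e 0) (sum-reindex n (b ∘ suc) (c ∘ suc) (e ∘ suc))

      k+ : ∀ i → k ℕ.+ suc i ≡ suc k ℕ.+ i
      k+ = ℕₚ.+-suc k

      tail : sum {n} (λ i → a (suc (toℕ i)) / q ^ suc (k ℕ.+ suc (toℕ i))) ≈ q ⁻¹ * sum {n} (λ i → a (suc (toℕ i)) / q ^ (k ℕ.+ suc (toℕ i)))
      tail = begin
        sum {n} (λ i → a (suc (toℕ i)) / q ^ suc (k ℕ.+ suc (toℕ i)))
          ≈⟨ sum-reindex n _ _ (λ i → reflexive (≡.cong (λ m → a (suc i) / q ^ suc m) (k+ i))) ⟩
        sum {n} (λ i → a (suc (toℕ i)) / q ^ suc (suc k ℕ.+ toℕ i))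
          ≈⟨ shifted-sum n (a ∘ suc) (suc k) ⟩
        q ⁻¹ * sum {n} (λ i → a (suc (toℕ i)) / q ^ (suc k ℕ.+ toℕ i))
          ≈⟨ *-congˡ (sum-reindex n _ _ (λ i → reflexive (≡.cong (λ m → a (suc i) / q ^ m) (≡.sym (k+ i))))) ⟩
        q ⁻¹ * sum {n} (λ i → a (suc (toℕ i)) / q ^ (k ℕ.+ suc (toℕ i))) ∎

    partialSum-suc : ∀ δ n → q * partialSum q δ (suc n) ≈ fromℕ (toℕ (δ 0)) + partialSum q (δ ∘ suc) n
    partialSum-suc δ n = begin
      q * (d * (q ^ 1) ⁻¹ + sum {n} (λ i → fromℕ (toℕ (δ (suc (toℕ i)))) / q ^ suc (suc (toℕ i))))
        ≈⟨ *-congˡ (+-cong (*-congˡ (⁻¹-cong (*-identityʳ q))) (shifted-sum n (λ i → fromℕ (toℕ (δ (suc i)))) 1)) ⟩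
      q * (d * q ⁻¹ + q ⁻¹ * s)   ≈⟨ solve 4 (λ q d i s → q :* (d :* i :+ i :* s) := q :* i :* (d :+ s)) refl _ _ _ _ ⟩
      q * q ⁻¹ * (d + s)          ≈⟨ *-congʳ (⁻¹-inverse q≉0) ⟩
      1# * (d + s)                ≈⟨ *-identityˡ _ ⟩
      d + s                       ∎
      where
      d = fromℕ (toℕ (δ 0))
      s = partialSum q (δ ∘ suc) n

    weight-fromℕ : ∀ d → weight d ≈ K * fromℕ (toℕ d)
    weight-fromℕ zero       = sym (zeroʳ K)
    weight-fromℕ (suc zero) = sym (trans (*-congˡ (+-identityʳ 1#)) (*-identityʳ K))

    -- Dropping the first digit d replaces v by q v - d, so the induction runs over all v. This
    -- turns boundedness of the orbit into convergence of the partial sums.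
    remainder : ∀ n {v δ} (o : Orbit (K * v) δ) → q ^ n * (K * (v - partialSum q δ n)) ≈ Orbit.point o n
    remainder zero    {v} o = trans (solve 2 (λ k v → con (+ 1) :* (k :* (v :- con (+ 0))) := k :* v) refl K v) (sym (Orbit.initial o))
    remainder (suc n) {v} {δ} o = begin
      q * q ^ n * (K * (v - partialSum q δ (suc n)))
        ≈⟨ solve 5 (λ q p k v s → q :* p :* (k :* (v :- s)) := p :* (k :* (q :* v :- q :* s))) refl _ _ _ _ _ ⟩
      q ^ n * (K * (q * v - q * partialSum q δ (suc n)))
        ≈⟨ *-congˡ (*-congˡ (+-congˡ (-‿cong (partialSum-suc δ n)))) ⟩
      q ^ n * (K * (q * v - (d + partialSum q (δ ∘ suc) n)))
        ≈⟨ solve 5 (λ p k x d s → p :* (k :* (x :- (d :+ s))) := p :* (k :* (x :- d :- s))) refl _ _ _ _ _ ⟩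
      q ^ n * (K * (q * v - d - partialSum q (δ ∘ suc) n))
        ≈⟨ remainder n tail ⟩
      Orbit.point o (suc n) ∎
      where
      d = fromℕ (toℕ (δ 0))
      tail : Orbit (K * (q * v - d)) (δ ∘ suc)
      tail = record
        { point    = Orbit.point o ∘ suc
        ; initial  = begin
            Orbit.point o 1                       ≈⟨ Orbit.next o 0 ⟩
            q * Orbit.point o 0 - weight (δ 0)    ≈⟨ +-cong (*-congˡ (Orbit.initial o)) (-‿cong (weight-fromℕ (δ 0))) ⟩
            q * (K * v) - K * d                   ≈⟨ solve 4 (λ q k v d → q :* (k :* v) :- k :* d := k :* (q :* v :- d)) refl _ _ _ _ ⟩
            K * (q * v - d)                       ∎
        ; next     = Orbit.next o ∘ suc
        ; interval = Orbit.interval o ∘ suc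
        }

    -- The remainder after n digits lies between 0 and (q + 1) / (K qⁿ), and this is below ε as soon
    -- as qⁿ K ε exceeds q + 1.
    orbit⇒expansion : ∀ {v δ} → Orbit (K * v) δ → IsExpansion q v δ
    orbit⇒expansion {v} {δ} o ε 0<ε = N , λ n N≤n →
      let p = partialSum q δ n
          0≤r = 0≤-resp (sym (remainder n o)) (proj₁ (Orbit.interval o n))
          r≤ = 0≤-resp (+-congˡ (-‿cong (sym (remainder n o)))) (proj₂ (Orbit.interval o n))
          large = 0<-resp (solve 5 (λ a M b k e → a :* (k :* e) :- M :+ (b :- a) :* (k :* e) := b :* (k :* e) :- M) refl (q ^ N) (q + 1#) (q ^ n) K ε)
            (<⇒0< (proj₂ unbounded) ⁺+⁰ q^-mono N≤n *⁰ inj₁ (0<K *⁺ 0<ε))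
      in 0<⇒< (0<-factor (inj₁ 0<K) (0<-factor (inj₁ (0<q^ n))
             (0<-resp (solve 6 (λ x k e M v p → x :* (k :* e) :- M :+ (M :- x :* (k :* (v :- p))) := x :* (k :* (p :- (v :- e)))) refl _ _ _ _ _ _) (large ⁺+⁰ r≤)))) ,
         0<⇒< (0<-resp (solve 3 (λ v p e → e :+ (v :- p) := v :+ e :- p) refl v p ε) (0<ε ⁺+⁰ 0≤-factor (0<q^ n *⁺ 0<K) (0≤-resp (sym (*-assoc _ _ _)) 0≤r)))
      where
      unbounded = powers-unbounded (0<K *⁺ 0<ε) (q + 1#)
      N = proj₁ unbounded

      0≤-factor : ∀ {x y} → 0# < x → 0# ≤ x * y → 0# ≤ y
      0≤-factor {x} {y} p r with <-or-≥ y 0#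
      ... | inj₂ s = 0≤-resp (solve 1 (λ y → y :- con (+ 0) := y) refl y) s
      ... | inj₁ s = ⊥-elim (¬0<0 (solve 2 (λ x y → x :* (con (+ 0) :- y) :+ x :* y := con (+ 0)) refl x y) (p *⁺ <⇒0< s ⁺+⁰ r))

    module _ (Q : Carrier → Set) (Q-interval : ∀ {x} → Q x → InInterval x) (Q-branch : ∀ {x} → Q x → Branch Q x) where
      open Tree Q Q-interval Q-branch

      -- The tree of orbits below K embeds the binary sequences into the expansions, and forgetting
      -- convergence embeds the expansions into the binary sequences.
      continuum : InInterval K → Branch Q K → HasCardinalityContinuum (expansions q 1#)
      continuum i b = cantorSchröderBernstein em (expansions q 1#) (ℕ →-setoid Fin 2)
        (λ σ → digits b′ σ , orbit⇒expansion (orbit b′ (InInterval-resp K1 i) σ))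
        (digits-cong b′) (digits-injective b′)
        proj₁ (λ e → e) (λ e → e)
        where
        K1 : K ≈ K * 1#
        K1 = sym (*-identityʳ K)

        b′ : Branch Q (K * 1#)
        b′ = branch (⇝-resp K1 (Branch.path b)) (Branch.kids b)

    -- The reflection, and paths up to reflection.

    flip : Carrier → Carrier
    flip x = q + 1# - x

    flip-cong : ∀ {x y} → x ≈ y → flip x ≈ flip y
    flip-cong e = +-congˡ (-‿cong e)

    flip-involutive : ∀ x → flip (flip x) ≈ x
    flip-involutive x = solve 2 (λ q x → q :+ con (+ 1) :- (q :+ con (+ 1) :- x) := x) refl q x

    InInterval-flip : ∀ {x} → InInterval x → InInterval (flip x)
    InInterval-flip (l , r) = r , 0≤-resp (sym (flip-involutive _)) l

    opposite : Fin 2 → Fin 2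
    opposite zero       = suc zero
    opposite (suc zero) = zero

    child-flip : ∀ d x → child (opposite d) (flip x) ≈ flip (child d x)
    child-flip zero       x = solve 2 (λ q x → q :* (q :+ con (+ 1) :- x) :- (q :* q :- con (+ 1)) := q :+ con (+ 1) :- (q :* x :- con (+ 0))) refl q x
    child-flip (suc zero) x = solve 2 (λ q x → q :* (q :+ con (+ 1) :- x) :- con (+ 0) := q :+ con (+ 1) :- (q :* x :- (q :* q :- con (+ 1)))) refl q x

    ⇝-flip : ∀ {x y} → x ⇝ y → flip x ⇝ flip y
    ⇝-flip     (here p)     = here (flip-cong p)
    ⇝-flip {x} (step d i p) = step (opposite d) (InInterval-resp (sym (child-flip d x)) (InInterval-flip i))
      (⇝-resp (sym (child-flip d x)) (⇝-flip p))

    infix 4 _↝_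
    -- Paths that may reflect on the way. As the reflection exchanges the two digits, `Branch-↝` can
    -- pull branches back along them.
    data _↝_ (x y : Carrier) : Set where
      arrive : x ≈ y → x ↝ y
      zoom : ∀ d → InInterval (child d x) → child d x ↝ y → x ↝ y
      turn : flip x ↝ y → x ↝ y

    ↝-resp : ∀ {x x′ y} → x ≈ x′ → x ↝ y → x′ ↝ y
    ↝-resp e (arrive p)     = arrive (trans (sym e) p)
    ↝-resp e (zoom d i p) = zoom d (InInterval-resp (child-cong d e) i) (↝-resp (child-cong d e) p)
    ↝-resp e (turn p)     = turn (↝-resp (flip-cong e) p)

    ↝-trans : ∀ {x y z} → x ↝ y → y ↝ z → x ↝ z
    ↝-trans (arrive e)     r = ↝-resp (sym e) r
    ↝-trans (zoom d i p) r = zoom d i (↝-trans p r)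
    ↝-trans (turn p)     r = turn (↝-trans p r)

    zoom₀ : ∀ {x y} → 0# ≤ x → 0# ≤ q + 1# - q * x → q * x ↝ y → x ↝ y
    zoom₀ {x} l r p = zoom zero (InInterval-resp e (inj₁ 0<q *⁰ l , r)) (↝-resp e p)
      where
      e : q * x ≈ q * x - 0#
      e = solve 1 (λ y → y := y :- con (+ 0)) refl (q * x)

    module Invariant (Q : Carrier → Set) (Q-resp : ∀ {x y} → x ≈ y → Q x → Q y) (Q-flip : ∀ {x} → Q x → Q (flip x)) where

      Branch-resp : ∀ {x y} → x ≈ y → Branch Q x → Branch Q y
      Branch-resp e (branch p k) = branch (⇝-resp e p) k

      Branch-flip : ∀ {x} → Branch Q x → Branch Q (flip x)
      Branch-flip (branch {y} p k) = branch (⇝-flip p) λ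
        { zero       → Q-resp (sym (child-flip (suc zero) y)) (Q-flip (k (suc zero)))
        ; (suc zero) → Q-resp (sym (child-flip zero y)) (Q-flip (k zero))
        }

      Branch-unflip : ∀ {x} → Branch Q (flip x) → Branch Q x
      Branch-unflip b = Branch-resp (flip-involutive _) (Branch-flip b)

      Branch-↝ : ∀ {x y} → x ↝ y → Branch Q y → Branch Q x
      Branch-↝ (arrive e)     b = Branch-resp (sym e) b
      Branch-↝ (zoom d i p) b with Branch-↝ p b
      ... | branch p′ k = branch (step d i p′) k
      Branch-↝ (turn p)     b = Branch-unflip (Branch-↝ p b)

    u : Carrier
    u = q * q - q - 1#

    -- Below the golden ratio.

    module Small (u<0 : 0# < 0# - u) where

      Q : Carrier → Set
      Q x = 0# < x × 0# < flip x

      Q-resp : ∀ {x y} → x ≈ y → Q x → Q y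
      Q-resp e (l , r) = 0<-resp e l , 0<-resp (flip-cong e) r

      Q-flip : ∀ {x} → Q x → Q (flip x)
      Q-flip (l , r) = r , 0<-resp (sym (flip-involutive _)) l

      open Invariant Q Q-resp Q-flip

      children : ∀ {x} → 0# < x → 0# < q * x - K → 0# < q + 1# - q * x → ∀ d → Q (child d x)
      children {x} p l r zero       = Q-resp (solve 1 (λ y → y := y :- con (+ 0)) refl (q * x)) (0<q *⁺ p , r)
      children {x} p l r (suc zero) = l , 0<-resp (solve 2 (λ q x → (q :+ con (+ 1) :- q :* x) :+ (q :* q :- con (+ 1)) := q :+ con (+ 1) :- (q :* x :- (q :* q :- con (+ 1)))) refl q x) (r +⁺ 0<K)

      -- Multiplication by q eventually leaves the region q x <= K. It cannot jump over the points
      -- with two interior children, which satisfy K < q x < q + 1, because q + 1 - q K = -(q + 1) u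
      -- > 0. The bound on qⁿ x limits the number of steps.
      near-zero : ∀ n {x} → 0# < x → 0# ≤ K - q * x → 0# < q ^ n * x - K → Branch Q x
      near-zero zero {x} p s big = ⊥-elim (¬0<0
        (solve 2 (λ q x → con (+ 1) :* x :- (q :* q :- con (+ 1)) :+ ((q :* q :- con (+ 1)) :- q :* x) :+ (q :- con (+ 1)) :* x := con (+ 0)) refl q x)
        (big ⁺+⁰ s +⁺ 0<q-1 *⁺ p))
      near-zero (suc n) {x} p s big = Branch-↝ (zoom₀ (inj₁ p) (inj₁ (0<-resp
          (solve 2 (λ q x → (con (+ 1) :+ (q :- (q :* q :- con (+ 1)))) :+ ((q :* q :- con (+ 1)) :- q :* x) := q :+ con (+ 1) :- q :* x) refl q x)
          (0<1 +⁺ 0<q-K ⁺+⁰ s))) (arrive refl)) grown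
        where
        0<q-K : 0# < q - K
        0<q-K = 0<-resp (solve 1 (λ q → con (+ 0) :- (q :* q :- q :- con (+ 1)) := q :- (q :* q :- con (+ 1))) refl q) u<0

        grown : Branch Q (q * x)
        grown with <-or-≥ K (q * (q * x))
        ... | inj₁ l = branch (here refl) (children (0<q *⁺ p) (<⇒0< l)
                (0<-resp (solve 2 (λ q x → (q :+ con (+ 1)) :* (con (+ 0) :- (q :* q :- q :- con (+ 1))) :+ q :* ((q :* q :- con (+ 1)) :- q :* x) := q :+ con (+ 1) :- q :* (q :* x)) refl q x)
                  ((0<q +⁺ 0<1) *⁺ u<0 ⁺+⁰ inj₁ 0<q *⁰ s)))
        ... | inj₂ s′ = near-zero n (0<q *⁺ p) s′ (0<-resp (solve 4 (λ q p x k → q :* p :* x :- k := p :* (q :* x) :- k) refl _ _ _ _) big)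

      near-zero′ : ∀ {x} → 0# < x → 0# ≤ K - q * x → Branch Q x
      near-zero′ p s with powers-unbounded p K
      ... | n , big = near-zero n p s (<⇒0< big)

      Q-branch : ∀ {x} → Q x → Branch Q x
      Q-branch {x} (l , r) with <-or-≥ K (q * x) | <-or-≥ (q * x) (q + 1#)
      ... | inj₂ s | _      = near-zero′ l s
      ... | inj₁ a | inj₁ b = branch (here refl) (children l (<⇒0< a) (<⇒0< b))
      ... | inj₁ _ | inj₂ b = Branch-unflip (near-zero′ r (0≤-resp
              (solve 2 (λ q x → q :* x :- (q :+ con (+ 1)) := (q :* q :- con (+ 1)) :- q :* (q :+ con (+ 1) :- x)) refl q x) b))

      continuum-below-golden : HasCardinalityContinuum (expansions q 1#)
      continuum-below-golden = continuum Q (λ (l , r) → inj₁ l , inj₁ r) Q-branch (inj₁ (proj₁ QK) , inj₁ (proj₂ QK)) (Q-branch QK)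
        where
        QK : Q K
        QK = 0<K , 0<-resp (solve 1 (λ q → con (+ 1) :+ (con (+ 0) :- (q :* q :- q :- con (+ 1))) := q :+ con (+ 1) :- (q :* q :- con (+ 1))) refl q) (0<1 +⁺ u<0)

    -- Above the golden ratio: univoque points and the switch region.

    -- `D` = q + 1 - K is the reflection of K. A node y has both children in the interval when q y
    -- lies in [K, q + 1]; with r = q y - K they are, up to reflection, r and `D` - r. `V` = q² `D`
    -- - K is such a child r below `D`.
    D V : Carrier
    D = 1# - u
    V = 1# - q * q * u

    -- The powers of q⁻¹ are led to 1, whose orbit is the 2-cycle 1, q. For u > 0 this cycle is
    -- forced, since q - K = -u < 0 and q² - (q + 1) = u > 0.
    Univoque : Carrier → Set
    Univoque x = ∃ λ n → q ^ n * x ≈ 1#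

    module Reach (0<u : 0# < u) (0<V : 0# < V) where

      record Switch (x : Carrier) : Set where
        field
          {node} : Carrier
          path   : x ↝ node
          lower  : 0# ≤ q * node - K
          upper  : 0# ≤ D - (q * node - K)

      Switch-↝ : ∀ {x y} → x ↝ y → Switch y → Switch x
      Switch-↝ p s = record { path = ↝-trans p (Switch.path s) ; lower = Switch.lower s ; upper = Switch.upper s }

      0<D : 0# < D
      0<D = 0<-resp (solve 2 (λ q u → (con (+ 1) :- q :* q :* u) :+ (q :* q :- con (+ 1)) :* u := con (+ 1) :- u) refl q u) (0<V +⁺ 0<K *⁺ 0<u)

      zoom-below-1 : ∀ {x} → 0# ≤ x → 0# ≤ 1# - x → x ↝ q * x
      zoom-below-1 {x} l r = zoom₀ l (0≤-resp (solve 2 (λ q x → q :* (con (+ 1) :- x) :+ con (+ 1) := q :+ con (+ 1) :- q :* x) refl q x) (inj₁ 0<q *⁰ r +⁰ inj₁ 0<1)) (arrive refl)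

      -- Two steps stretch the distance to the endpoint 1 of the 2-cycle by q².
      two-steps : ∀ {x} → 0# ≤ x → 0# ≤ 1# - x → 0# ≤ q * (q * x) - K → x ↝ q * (q * x) - K
      two-steps {x} l r s = ↝-trans (zoom-below-1 l r) (zoom (suc zero) (s , 0≤-resp
        (solve 2 (λ q x → q :* q :* (con (+ 1) :- x) :+ q := q :+ con (+ 1) :- (q :* (q :* x) :- (q :* q :- con (+ 1)))) refl q x)
        (inj₁ (0<q *⁺ 0<q) *⁰ r +⁰ inj₁ 0<q)) (arrive refl))

      -- Every two steps multiply the distance 1 - x by q². Once this product is at least u, the
      -- point q x lies in the switch region; before that, positivity of `V` ensures q² x >= K.
      gap : ∀ n {x} → 0# ≤ x → 0# < 1# - x → 0# ≤ u - (1# - x) → 0# < q ^ n * (1# - x) - u → Switch x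
      gap n {x} l e e≤u big = go (<-or-≥ (q * q * (1# - x)) u)
        where
        0≤r : 0# ≤ q * (q * x) - K
        0≤r = 0≤-resp (solve 3 (λ q u x → (con (+ 1) :- q :* q :* u) :+ q :* q :* (u :- (con (+ 1) :- x)) := q :* (q :* x) :- (q :* q :- con (+ 1))) refl q u x)
          (inj₁ 0<V +⁰ inj₁ (0<q *⁺ 0<q) *⁰ e≤u)

        1-r : q * q * (1# - x) ≈ 1# - (q * (q * x) - K)
        1-r = solve 2 (λ q x → q :* q :* (con (+ 1) :- x) := con (+ 1) :- (q :* (q :* x) :- (q :* q :- con (+ 1)))) refl q x

        go : q * q * (1# - x) < u ⊎ 0# ≤ q * q * (1# - x) - u → Switch x
        go (inj₂ s) = record
          { path  = zoom-below-1 l (inj₁ e)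
          ; lower = 0≤r
          ; upper = 0≤-resp (trans (+-congʳ 1-r) (solve 2 (λ u r → con (+ 1) :- r :- u := con (+ 1) :- u :- r) refl u _)) s
          }
        go (inj₁ s) = next n big
          where
          next : ∀ n → 0# < q ^ n * (1# - x) - u → Switch x
          next zero    big = ⊥-elim (¬0<0
            (solve 3 (λ q e u → con (+ 1) :* e :- u :+ (u :- q :* q :* e) :+ (q :* q :- con (+ 1)) :* e := con (+ 0)) refl q (1# - x) u)
            (big +⁺ <⇒0< s +⁺ 0<K *⁺ e))
          next (suc n) big = Switch-↝ (two-steps l (inj₁ e) 0≤r) (gap n 0≤r
            (0<-resp 1-r ((0<q *⁺ 0<q) *⁺ e))
            (inj₁ (0<-resp (+-congˡ (-‿cong 1-r)) (<⇒0< s)))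
            (0<-resp (+-congʳ (*-congˡ 1-r)) (0<-resp
              (solve 4 (λ q p e u → q :* p :* e :- u :+ q :* (q :- con (+ 1)) :* (p :* e) := p :* (q :* q :* e) :- u) refl q (q ^ n) (1# - x) u)
              (big +⁺ 0<q *⁺ 0<q-1 *⁺ (0<q^ n *⁺ e)))))

      gap′ : ∀ {x} → 0# ≤ x → 0# < 1# - x → 0# ≤ u - (1# - x) → Switch x
      gap′ l e s with powers-unbounded e u
      ... | n , big = gap n l e s (<⇒0< big)

      -- For 1/q < x < 1 the point q x either lies in the switch region or has a child that is, up
      -- to reflection, below 1 by less than u, where `gap′` takes over.
      core : ∀ {x} → 0# < x → 0# < 1# - x → 0# < q * x - 1# → Switch x
      core {x} l e g with <-or-≥ (q * (q * x)) K
      ... | inj₁ s = Switch-↝ (↝-trans (zoom-below-1 (inj₁ l) (inj₁ e)) (zoom₀ (inj₁ (0<q *⁺ l)) (inj₁ 0<x′) (turn (arrive refl))))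
          (gap′ (inj₁ 0<x′)
            (0<-resp (solve 2 (λ q x → q :* (q :* x :- con (+ 1)) := con (+ 1) :- (q :+ con (+ 1) :- q :* (q :* x))) refl q x) (0<q *⁺ g))
            (inj₁ (0<-resp (solve 2 (λ q x → (q :* q :- con (+ 1)) :- q :* (q :* x) := (q :* q :- q :- con (+ 1)) :- (con (+ 1) :- (q :+ con (+ 1) :- q :* (q :* x)))) refl q x) (<⇒0< s))))
          where
          0<x′ : 0# < q + 1# - q * (q * x)
          0<x′ = 0<-resp (solve 2 (λ q x → (con (+ 1) :- (q :* q :- q :- con (+ 1))) :+ ((q :* q :- con (+ 1)) :- q :* (q :* x)) := q :+ con (+ 1) :- q :* (q :* x)) refl q x) (0<D +⁺ <⇒0< s)
      ... | inj₂ s with <-or-≥ D (q * (q * x) - K)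
      ...   | inj₂ t = record { path = zoom-below-1 (inj₁ l) (inj₁ e) ; lower = s ; upper = t }
      ...   | inj₁ t = Switch-↝ (two-steps (inj₁ l) (inj₁ e) s) (gap′ s
              (0<-resp (solve 2 (λ q x → q :* q :* (con (+ 1) :- x) := con (+ 1) :- (q :* (q :* x) :- (q :* q :- con (+ 1)))) refl q x) ((0<q *⁺ 0<q) *⁺ e))
              (inj₁ (0<-resp (solve 2 (λ u r → r :- (con (+ 1) :- u) := u :- (con (+ 1) :- r)) refl u _) (<⇒0< t))))

      -- Multiplication by q brings x between 1/q and 1; it could land on 1 only if x were univoque.
      -- The last hypothesis bounds the number of steps.
      reach : ∀ n {x} → 0# < x → 0# < 1# - x → ¬ Univoque x → 0# < q ^ n * x - 1# → Switch x
      reach zero    {x} l e ¬u big = ⊥-elim (¬0<0 (solve 1 (λ x → con (+ 1) :* x :- con (+ 1) :+ (con (+ 1) :- x) := con (+ 0)) refl x) (big +⁺ e))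
      reach (suc n) {x} l e ¬u big with compare (q * x) 1#
      ... | tri< s _ _ = Switch-↝ (zoom-below-1 (inj₁ l) (inj₁ e)) (reach n (0<q *⁺ l) (<⇒0< s)
              (λ (m , p) → ¬u (suc m , trans (solve 3 (λ q p x → q :* p :* x := p :* (q :* x)) refl _ _ _) p))
              (0<-resp (solve 3 (λ q p x → q :* p :* x :- con (+ 1) := p :* (q :* x) :- con (+ 1)) refl _ _ _) big))
      ... | tri≈ _ p _ = ⊥-elim (¬u (1 , trans (*-congʳ (*-identityʳ q)) p))
      ... | tri> _ _ s = core l e (<⇒0< s)

      reach′ : ∀ {x} → 0# < x → 0# < 1# - x → ¬ Univoque x → Switch x
      reach′ l e ¬u with powers-unbounded l 1#
      ... | n , big = reach n l e ¬u (<⇒0< big)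

    module Terms {n} (q : Polynomial n) where
      :1 :u :D :V :K :w :ρ₁ :ρ₂ :s₁ :s₂ :e : Polynomial n
      :1  = con (+ 1)
      :u  = q :* q :- q :- :1
      :K  = q :* q :- :1
      :D  = :1 :- :u
      :V  = :1 :- q :* q :* :u
      :w  = :u :* :K
      :e  = q :* :V :- :1
      :ρ₁ = q :^ 4 :* :D :- q :^ 3 :- :K
      :ρ₂ = q :^ 3 :* :D :- q :- :K
      :s₁ = :D :- :ρ₁
      :s₂ = :D :- :ρ₂
    open Terms

    -- Up to reflection, the children reached from D - q⁻ᵐ are V - q²⁻ᵐ and
    -- w + q²⁻ᵐ if m ≥ 3, ρ₂ and s₂ if m = 2, and ρ₁ and s₁ if m = 1.
    w e ρ₁ ρ₂ s₁ s₂ : Carrier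
    w  = u * K
    e  = q * V - 1#
    ρ₁ = q ^ 4 * D - q ^ 3 - K
    ρ₂ = q ^ 3 * D - q - K
    s₁ = D - ρ₁
    s₂ = D - ρ₂

    -- Reduction of branching to the points `D` and `D` - q⁻ᵐ.

    -- `P` is an invariant of descendants and reflections: trivial in `Generic`, a residue condition
    -- in `NeverUnivoque`.
    module Core (0<u : 0# < u) (0<V : 0# < V)
      (P : Carrier → Set) (P-resp : ∀ {x y} → x ≈ y → P x → P y)
      (P-child : ∀ d {x} → P x → P (child d x)) (P-flip : ∀ {x} → P x → P (flip x)) where
      open Reach 0<u 0<V

      -- The bound `D` comes from the switch region, whose nodes have their children in [0, `D`] up
      -- to reflection. It also keeps r below 1.
      Inner : Carrier → Set
      Inner r = P r × 0# < r × 0# ≤ D - r × ¬ Univoque r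

      Univoque-resp : ∀ {x y} → x ≈ y → Univoque x → Univoque y
      Univoque-resp p (n , h) = n , trans (*-congˡ (sym p)) h

      Inner-resp : ∀ {x y} → x ≈ y → Inner x → Inner y
      Inner-resp p (a , b , c , d) = P-resp p a , 0<-resp p b , 0≤-resp (+-congˡ (-‿cong p)) c , d ∘ Univoque-resp (sym p)

      Q : Carrier → Set
      Q x = Inner x ⊎ Inner (flip x)

      Q-resp : ∀ {x y} → x ≈ y → Q x → Q y
      Q-resp p (inj₁ i) = inj₁ (Inner-resp p i)
      Q-resp p (inj₂ i) = inj₂ (Inner-resp (flip-cong p) i)

      Q-flip : ∀ {x} → Q x → Q (flip x)
      Q-flip (inj₁ i) = inj₂ (Inner-resp (sym (flip-involutive _)) i)
      Q-flip (inj₂ i) = inj₁ i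

      Inner-interval : ∀ {x} → Inner x → InInterval x
      Inner-interval {x} (_ , b , c , _) = inj₁ b , 0≤-resp
        (solve 2 (λ q x → (:D q :- x) :+ (q :+ :u q) := q :+ :1 q :- x) refl q x) (c +⁰ inj₁ (0<q +⁺ 0<u))

      Q-interval : ∀ {x} → Q x → InInterval x
      Q-interval (inj₁ i) = Inner-interval i
      Q-interval (inj₂ i) = InInterval-resp (flip-involutive _) (InInterval-flip (Inner-interval i))

      open Invariant Q Q-resp Q-flip public

      P-↝ : ∀ {x y} → x ↝ y → P x → P y
      P-↝ (arrive p)   h = P-resp p h
      P-↝ (zoom d _ p) h = P-↝ p (P-child d h)
      P-↝ (turn p)     h = P-↝ p (P-flip h)

      Boundary : Carrier → Set
      Boundary r = r ≈ 0# ⊎ Univoque r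

      other-child : ∀ y → flip (q * y) ≈ D - (q * y - K)
      other-child y = solve 2 (λ q y → q :+ :1 q :- q :* y := :D q :- (q :* y :- :K q)) refl q y

      -- If neither child is 0 or univoque, the node itself branches; otherwise a branch is sought
      -- below the other child.
      at-switch : ∀ {y} → P y → 0# ≤ q * y - K → 0# ≤ D - (q * y - K) →
        (Boundary (q * y - K) → Branch Q (D - (q * y - K))) →
        (Boundary (D - (q * y - K)) → Branch Q (q * y - K)) → Branch Q y
      at-switch {y} h l r left right with em {Boundary (q * y - K)} | em {Boundary (D - (q * y - K))}
      ... | yes b | _ = Branch-↝ (zoom zero (InInterval-resp e₀ (0≤-resp (solve 2 (λ y k → (y :- k) :+ k := y) refl (q * y) K) (l +⁰ inj₁ 0<K) , 0≤-resp (sym (other-child y)) r))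
            (turn (arrive (trans (flip-cong (sym e₀)) (other-child y))))) (left b)
        where
        e₀ : q * y ≈ q * y - 0#
        e₀ = solve 1 (λ x → x := x :- con (+ 0)) refl (q * y)
      ... | no _  | yes b = Branch-↝ (zoom (suc zero) (l , 0≤-resp
            (solve 2 (λ q x → (:D q :- x) :+ (q :+ :u q) := q :+ :1 q :- x) refl q _) (r +⁰ inj₁ (0<q +⁺ 0<u))) (arrive refl)) (right b)
      ... | no ¬a | no ¬b = branch (here refl) λ
            { zero       → inj₂ (Inner-resp (sym other) (P-resp other (P-flip (P-child zero h)) ,
                              positive-part r (¬b ∘ inj₁) , 0≤-resp (solve 2 (λ d r → r := d :- (d :- r)) refl D _) l , ¬b ∘ inj₂))
            ; (suc zero) → inj₁ (P-child (suc zero) h , positive-part l (¬a ∘ inj₁) , r , ¬a ∘ inj₂)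
            }
        where
        other : flip (child zero y) ≈ D - (q * y - K)
        other = trans (flip-cong (solve 1 (λ x → x :- con (+ 0) := x) refl (q * y))) (other-child y)

        positive-part : ∀ {x} → 0# ≤ x → ¬ x ≈ 0# → 0# < x
        positive-part (inj₁ p) _ = p
        positive-part (inj₂ p) n = ⊥-elim (n (sym p))

      Inner⇒below-1 : ∀ {x} → 0# ≤ D - x → 0# < 1# - x
      Inner⇒below-1 {x} r = 0<-resp (solve 2 (λ u x → u :+ (con (+ 1) :- u :- x) := con (+ 1) :- x) refl u x) (0<u ⁺+⁰ r)

      module _ (at-D : Branch Q D) (at-univoque : ∀ {t} → P t → 0# ≤ D - t → Univoque t → Branch Q (D - t)) where

        at-boundary : ∀ {r} → P r → 0# ≤ D - r → Boundary r → Branch Q (D - r)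
        at-boundary h l (inj₁ p) = Branch-resp (trans (solve 1 (λ d → d := d :- con (+ 0)) refl D) (+-congˡ (-‿cong (sym p)))) at-D
        at-boundary h l (inj₂ u) = at-univoque h l u

        Inner-branch : ∀ {x} → Inner x → Branch Q x
        Inner-branch {x} (h , l , r , ¬u) = Branch-↝ path (at-switch Py lower upper
            (at-boundary (P-child (suc zero) Py) upper)
            (λ b → Branch-resp (sym twice) (at-boundary (P-resp other (P-flip (P-child zero Py))) (0≤-resp twice lower) b)))
          where
          open Switch (reach′ l (Inner⇒below-1 r) ¬u)
          Py : P node
          Py = P-↝ path h
          twice : q * node - K ≈ D - (D - (q * node - K))
          twice = solve 2 (λ d r → r := d :- (d :- r)) refl D _
          other : flip (child zero node) ≈ D - (q * node - K)
          other = trans (flip-cong (solve 1 (λ x → x :- con (+ 0) := x) refl (q * node))) (other-child node)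

        Q-branch : ∀ {x} → Q x → Branch Q x
        Q-branch (inj₁ i) = Inner-branch i
        Q-branch (inj₂ i) = Branch-unflip (Inner-branch i)

        continuum-if-branching : HasCardinalityContinuum (expansions q 1#)
        continuum-if-branching = continuum Q Q-interval Q-branch
          (inj₁ 0<K , 0≤-resp (solve 1 (λ q → :D q := q :+ :1 q :- :K q) refl q) (inj₁ 0<D))
          (Branch-unflip (Branch-resp (solve 1 (λ q → :D q := q :+ :1 q :- :K q) refl q) at-D))

      -- A point x with q x in the switch region, r and s being its children
      -- up to reflection.
      two-children : ∀ {x r s} → P x → 0# ≤ x → 0# ≤ 1# - x → q * (q * x) - K ≈ r → D - r ≈ s → 0# < r → 0# < s →
        (Univoque r → Branch Q s) → (Univoque s → Branch Q r) → Branch Q x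
      two-children {x} {r} {s} h l b p p′ 0<r 0<s f g = Branch-↝ path (at-switch (P-↝ path h)
          (0≤-resp (sym p) (inj₁ 0<r)) (0≤-resp (sym s≈) (inj₁ 0<s))
          (λ { (inj₁ z) → ⊥-elim (¬0<0 (trans (sym p) z) 0<r) ; (inj₂ u) → Branch-resp (sym s≈) (f (Univoque-resp p u)) })
          (λ { (inj₁ z) → ⊥-elim (¬0<0 (trans (sym s≈) z) 0<s) ; (inj₂ u) → Branch-resp (sym p) (g (Univoque-resp s≈ u)) }))
        where
        path : x ↝ q * x
        path = zoom-below-1 l b
        s≈ : D - (q * (q * x) - K) ≈ s
        s≈ = trans (+-congˡ (-‿cong p)) p′

    -- This and the next three lemmas locate the exponent of a univoque point x = q⁻ᵐ by comparing x
    -- with other powers of q⁻¹.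
    above : ∀ k m {x} → q ^ m * x ≈ 1# → 0# < q ^ k * x - 1# → m ℕ.< k
    above k m {x} p h with ℕₚ.<-≤-connex m k
    ... | inj₁ m<k = m<k
    ... | inj₂ k≤m = ⊥-elim (¬0<0 (trans (solve 3 (λ a b x → a :* x :- con (+ 1) :+ (b :- a) :* x := b :* x :- con (+ 1)) refl _ _ _) (trans (+-congʳ p) (-‿inverseʳ 1#)))
            (h ⁺+⁰ q^-mono k≤m *⁰ inj₁ (0<-factor (inj₁ (0<q^ m)) (0<-resp (sym p) 0<1))))

    below : ∀ k m {x} → q ^ m * x ≈ 1# → 0# < 1# - q ^ k * x → k ℕ.< m
    below k m {x} p h with ℕₚ.<-≤-connex k m
    ... | inj₁ k<m = k<m
    ... | inj₂ m≤k = ⊥-elim (¬0<0 (trans (solve 3 (λ a b x → con (+ 1) :- b :* x :+ (b :- a) :* x := con (+ 1) :- a :* x) refl _ _ _) (trans (+-congˡ (-‿cong p)) (-‿inverseʳ 1#)))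
            (h ⁺+⁰ q^-mono m≤k *⁰ inj₁ (0<-factor (inj₁ (0<q^ m)) (0<-resp (sym p) 0<1))))

    pinned : ∀ k m {x} → q ^ m * x ≈ 1# → 0# < 1# - q ^ k * x → 0# < q ^ (2 ℕ.+ k) * x - 1# → m ≡ suc k
    pinned k m p lo hi = ℕₚ.≤-antisym (ℕₚ.≤-pred (above (2 ℕ.+ k) m p hi)) (below k m p lo)

    excluded : ∀ k m {x} → q ^ m * x ≈ 1# → 0# < 1# - q ^ k * x → 0# < q ^ suc k * x - 1# → ⊥
    excluded k m p lo hi = ℕₚ.<⇒≱ (below k m p lo) (ℕₚ.≤-pred (above (suc k) m p hi))

    -- Coincidences between powers of q⁻¹ and the children of `D` - q⁻ᵐ.

    module Generic (0<u : 0# < u) (0<e : 0# < e) (range : Between 16180 16805 10000 q) where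

      0<V : 0# < V
      0<V = 0<-factor (inj₁ 0<q) (0<-resp (solve 1 (λ q → :e q :+ :1 q := q :* :V q) refl q) (0<e +⁺ 0<1))

      open Core 0<u 0<V (λ _ → ⊤) (λ _ _ → tt) (λ _ _ → tt) (λ _ → tt)
      open Reach 0<u 0<V

      Good : ℕ → Set
      Good m = ∀ {t} → q ^ m * t ≈ 1# → Branch Q (D - t)

      -- The exponents start at 1 because the children r to which this is applied lie below `D` < 1.
      GoodValue : Carrier → Set
      GoodValue r = ∀ m → q ^ suc m * r ≈ 1# → Branch Q (D - r)

      0<w : 0# < w
      0<w = 0<u *⁺ 0<K

      good-children : ∀ {x r s} → 0# ≤ x → 0# ≤ 1# - x → q * (q * x) - K ≈ r → D - r ≈ s → 0# < r → 0# < s →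
        GoodValue r → GoodValue s → Branch Q x
      good-children {x} {r} {s} l b p p′ 0<r 0<s f g = two-children tt l b p p′ 0<r 0<s
        (λ { (zero , h)  → ⊥-elim (not-one 0<s (trans (solve 2 (λ d r → con (+ 1) :* r := d :- (d :- r)) refl D r) (+-congˡ (-‿cong p′))) h)
           ; (suc m , h) → Branch-resp p′ (f m h) })
        (λ { (zero , h)  → ⊥-elim (not-one 0<r (trans (*-identityˡ s) (sym p′)) h)
           ; (suc m , h) → Branch-resp (trans (+-congˡ (-‿cong (sym p′))) (solve 2 (λ d r → d :- (d :- r) := r) refl D r)) (g m h) })
        where
        not-one : ∀ {a b} → 0# < b → 1# * a ≈ D - b → 1# * a ≈ 1# → ⊥
        not-one {a} {b} 0<b i j = ¬0<0 (begin
            u + b                      ≈⟨ solve 2 (λ q b → :u q :+ b := :1 q :- (:D q :- b)) refl q b ⟩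
            1# - (D - b)               ≈⟨ +-cong (trans (sym j) i) refl ⟩
            D - b - (D - b)            ≈⟨ -‿inverseʳ _ ⟩
            0#                         ∎) (0<u +⁺ 0<b)

      0<t : ∀ m {t} → q ^ m * t ≈ 1# → 0# < t
      0<t m p = 0<-factor (inj₁ (0<q^ m)) (0<-resp (sym p) 0<1)

      1-[D-t] : ∀ {t} → 0# ≤ t → 0# ≤ 1# - (D - t)
      1-[D-t] {t} p = 0≤-resp (solve 2 (λ q t → :u q :+ t := :1 q :- (:D q :- t)) refl q t) (inj₁ 0<u +⁰ p)

      0<s₂ : 0# < s₂
      0<s₂ = 0<-resp (solve 1 (λ q → :u q :* (q :+ :u q :+ q :* :u q) := :s₂ q) refl q) (0<u *⁺ (0<q +⁺ 0<u +⁺ 0<q *⁺ 0<u))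

      0<s₁ : 0# < s₁
      0<s₁ = 0<-resp (solve 1 (λ q → :u q :* (con (+ 2) :* q :+ :u q :* (:1 q :+ q :+ q :* q)) := :s₁ q) refl q)
        (0<u *⁺ (0<ν 1 *⁺ 0<q +⁺ 0<u *⁺ (0<1 +⁺ 0<q +⁺ 0<q *⁺ 0<q)))

      -- From q² (`D` - q⁻¹) = 1 - `w` it follows that the point stays below 1 for two steps, so the
      -- switch node is q³ (`D` - q⁻¹).
      good₁ : GoodValue ρ₁ → GoodValue s₁ → Good 1
      good₁ f g {t} p = Branch-↝ (↝-trans (zoom-below-1 (inj₁ 0<x) (1-[D-t] (inj₁ (0<t 1 p)))) (zoom-below-1 (inj₁ (0<q *⁺ 0<x)) (inj₁ qx<1)))
        (good-children (inj₁ (0<q *⁺ (0<q *⁺ 0<x)))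
          (inj₁ (0<-resp (begin
             w                                  ≈⟨ solve 1 (λ q → :w q := :1 q :- q :* (q :* :D q :- :1 q)) refl q ⟩
             1# - q * (q * D - 1#)              ≈⟨ +-congˡ (-‿cong (*-congˡ qx)) ⟨
             1# - q * (q * (D - t))             ∎) 0<w))
          (begin
             q * (q * (q * (q * (D - t)))) - K  ≈⟨ +-congʳ (*-congˡ (*-congˡ (*-congˡ qx))) ⟩
             q * (q * (q * (q * D - 1#))) - K   ≈⟨ solve 1 (λ q → q :* (q :* (q :* (q :* :D q :- :1 q))) :- :K q := :ρ₁ q) refl q ⟩
             ρ₁                                 ∎)
          refl (positive :ρ₁ 16180 16805 10000 range tt) 0<s₁ f g)
        where
        qx : q * (D - t) ≈ q * D - 1#
        qx = trans (solve 3 (λ q d t → q :* (d :- t) := q :* d :- q :^ 1 :* t) refl q D t) (+-congˡ (-‿cong p))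
        0<x : 0# < D - t
        0<x = 0<-factor (inj₁ 0<q) (0<-resp (trans (solve 1 (λ q → :e q :+ q :* :w q := q :* :D q :- :1 q) refl q) (sym qx)) (0<e +⁺ 0<q *⁺ 0<w))
        qx<1 : 0# < 1# - q * (D - t)
        qx<1 = 0<-resp (+-congˡ (-‿cong (sym qx))) (positive (λ q → :1 q :- (q :* :D q :- :1 q)) 16180 16805 10000 range tt)

      good₂ : GoodValue ρ₂ → GoodValue s₂ → Good 2
      good₂ f g {t} p = Branch-↝ (zoom-below-1 (inj₁ 0<x) (1-[D-t] (inj₁ (0<t 2 p))))
        (good-children (inj₁ (0<q *⁺ 0<x))
          (inj₁ (0<-factor (inj₁ 0<q) (0<-resp (begin
             w                                  ≈⟨ solve 1 (λ q → :w q := q :- (q :* (q :* :D q) :- :1 q)) refl q ⟩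
             q - (q * (q * D) - 1#)             ≈⟨ +-congˡ (-‿cong qqx) ⟨
             q - q * (q * (D - t))              ≈⟨ solve 2 (λ q x → q :- q :* x := q :* (con (+ 1) :- x)) refl q _ ⟩
             q * (1# - q * (D - t))             ∎) 0<w)))
          (begin
             q * (q * (q * (D - t))) - K        ≈⟨ +-congʳ (*-congˡ qqx) ⟩
             q * (q * (q * D) - 1#) - K         ≈⟨ solve 1 (λ q → q :* (q :* (q :* :D q) :- :1 q) :- :K q := :ρ₂ q) refl q ⟩
             ρ₂                                 ∎)
          refl (positive :ρ₂ 16180 16805 10000 range tt) 0<s₂ f g)
        where
        qqx : q * (q * (D - t)) ≈ q * (q * D) - 1#
        qqx = trans (solve 3 (λ q d t → q :* (q :* (d :- t)) := q :* (q :* d) :- q :^ 2 :* t) refl q D t) (+-congˡ (-‿cong p))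
        0<x : 0# < D - t
        0<x = 0<-factor (inj₁ 0<q) (0<-factor (inj₁ 0<q) (0<-resp (trans (solve 1 (λ q → q :* (:e q :+ q :* :w q) :+ (q :- :1 q) := q :* (q :* :D q) :- :1 q) refl q) (sym qqx))
                (0<q *⁺ (0<e +⁺ 0<q *⁺ 0<w) +⁺ 0<q-1)))

      good-direct : ∀ {t} → 0# ≤ t → 0# < V - q ^ 2 * t → GoodValue (V - q ^ 2 * t) → GoodValue (w + q ^ 2 * t) → Branch Q (D - t)
      good-direct {t} l r f g = good-children
        (inj₁ (0<-factor (inj₁ (0<q *⁺ 0<q)) (0<-resp (solve 2 (λ q t → (:V q :- q :^ 2 :* t) :+ :K q := q :* q :* (:D q :- t)) refl q t) (r +⁺ 0<K))))
        (1-[D-t] l)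
        (solve 2 (λ q t → q :* (q :* (:D q :- t)) :- :K q := :V q :- q :^ 2 :* t) refl q t)
        (solve 2 (λ q t → :D q :- (:V q :- q :^ 2 :* t) := :w q :+ q :^ 2 :* t) refl q t)
        r (0<w ⁺+⁰ inj₁ (0<q^ 2) *⁰ l) f g

      0<1-qe : 0# < 1# - q ^ 1 * e
      0<1-qe = 0<-resp (solve 1 (λ q → :w q :* (q :* q :+ :1 q) := :1 q :- q :^ 1 :* :e q) refl q) (0<w *⁺ (0<q *⁺ 0<q +⁺ 0<1))

      -- The child `V` - q⁻¹ is `e` / q. The other child `w` + q⁻¹ exceeds q⁻¹, hence is no power of
      -- q⁻¹ with positive exponent.
      good₃ : (∀ m → q ^ m * e ≈ 1# → Good (suc m)) → Good 3
      good₃ f {t} p = good-direct (inj₁ (0<t 3 p))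
        (0<-factor (inj₁ 0<q) (0<-resp (sym qr) 0<e))
        (λ m h → f m (trans (*-congˡ (sym qr)) (trans (solve 3 (λ q p r → p :* (q :* r) := q :* p :* r) refl _ _ _) h)) h)
        (λ m h → ⊥-elim (ℕₚ.m+n≮m 1 m (above 1 (suc m) h (0<-resp (begin
            q * w                                ≈⟨ solve 2 (λ q w → q :* w := q :* w :+ con (+ 1) :- con (+ 1)) refl q w ⟩
            q * w + 1# - 1#                      ≈⟨ +-congʳ (+-congˡ p) ⟨
            q * w + q ^ 3 * t - 1#               ≈⟨ solve 3 (λ q w t → q :* w :+ q :^ 3 :* t :- con (+ 1) := q :^ 1 :* (w :+ q :^ 2 :* t) :- con (+ 1)) refl q w t ⟩
            q ^ 1 * (w + q ^ 2 * t) - 1#         ∎) (0<q *⁺ 0<w)))))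
        where
        qr : q * (V - q ^ 2 * t) ≈ e
        qr = trans (solve 3 (λ q v t → q :* (v :- q :^ 2 :* t) := q :* v :- q :^ 3 :* t) refl q V t) (+-congˡ (-‿cong p))

      -- The child `V` - q⁻² lies between q⁻³ and q⁻¹, so it can only be q⁻²; the child `w` + q⁻²
      -- can only be q⁻¹. Each hypothesis either rules the coincidence out by size or resolves it.
      good₄ : 0# < q * (q * V) - ν 2 ⊎ Good 2 → 0# < q - 1# - q * q * w ⊎ Good 1 → Good 4
      good₄ f g {t} p = good-direct (inj₁ (0<t 4 p))
        (0<-factor (inj₁ (0<q *⁺ 0<q)) (0<-resp (sym qqr) (0<-resp (solve 1 (λ q → q :* :e q :+ (q :- :1 q) := q :* (q :* :V q) :- :1 q) refl q) (0<q *⁺ 0<e +⁺ 0<q-1))))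
        left right
        where
        r = V - q ^ 2 * t
        s = w + q ^ 2 * t
        qqr : q * q * r ≈ q * (q * V) - 1#
        qqr = trans (solve 3 (λ q v t → q :* q :* (v :- q :^ 2 :* t) := q :* (q :* v) :- q :^ 4 :* t) refl q V t) (+-congˡ (-‿cong p))
        qqs : q * q * s ≈ q * q * w + 1#
        qqs = trans (solve 3 (λ q v t → q :* q :* (v :+ q :^ 2 :* t) := q :* q :* v :+ q :^ 4 :* t) refl q w t) (+-congˡ p)

        qr<1 : 0# < 1# - q ^ 1 * r
        qr<1 = 0<-factor (inj₁ 0<q) (0<-resp (begin
          1# - q ^ 1 * e + 0#                    ≈⟨ solve 1 (λ q → :1 q :- q :^ 1 :* :e q :+ con (+ 0) := q :- (q :* (q :* :V q) :- :1 q)) refl q ⟩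
          q - (q * (q * V) - 1#)                 ≈⟨ +-congˡ (-‿cong qqr) ⟨
          q - q * q * r                          ≈⟨ solve 2 (λ q r → q :- q :* q :* r := q :* (con (+ 1) :- q :^ 1 :* r)) refl q r ⟩
          q * (1# - q ^ 1 * r)                   ∎) (0<1-qe ⁺+⁰ inj₂ refl))

        q³r>1 : 0# < q ^ 3 * r - 1#
        q³r>1 = 0<-resp (begin
          q * (q * e) + u                        ≈⟨ solve 1 (λ q → q :* (q :* :e q) :+ :u q := q :* (q :* (q :* :V q) :- :1 q) :- :1 q) refl q ⟩
          q * (q * (q * V) - 1#) - 1#            ≈⟨ +-congʳ (*-congˡ qqr) ⟨
          q * (q * q * r) - 1#                   ≈⟨ solve 2 (λ q r → q :* (q :* q :* r) :- con (+ 1) := q :^ 3 :* r :- con (+ 1)) refl q r ⟩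
          q ^ 3 * r - 1#                         ∎) (0<q *⁺ (0<q *⁺ 0<e) +⁺ 0<u)

        left : GoodValue r
        left m h = at-2 f m (pinned 1 (suc m) h qr<1 q³r>1) h
          where
          at-2 : 0# < q * (q * V) - ν 2 ⊎ Good 2 → ∀ m → suc m ≡ 2 → q ^ suc m * r ≈ 1# → Branch Q (D - r)
          at-2 (inj₂ good) _ ≡.refl h = good h
          at-2 (inj₁ k)    _ ≡.refl h = ⊥-elim (ℕₚ.<-irrefl ≡.refl (above 2 2 h (0<-resp (begin
            q * (q * V) - ν 2        ≈⟨ solve 1 (λ v → v :- con (+ 2) := v :- con (+ 1) :- con (+ 1)) refl _ ⟩
            q * (q * V) - 1# - 1#    ≈⟨ +-congʳ qqr ⟨
            q * q * r - 1#           ≈⟨ solve 2 (λ q r → q :* q :* r :- con (+ 1) := q :^ 2 :* r :- con (+ 1)) refl q r ⟩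
            q ^ 2 * r - 1#           ∎) k)))

        right : GoodValue s
        right m h = at-1 g m (ℕₚ.≤-pred (ℕₚ.≤-pred (above 2 (suc m) h (0<-resp (begin
            q * q * w                ≈⟨ solve 1 (λ v → v := v :+ con (+ 1) :- con (+ 1)) refl _ ⟩
            q * q * w + 1# - 1#      ≈⟨ +-congʳ qqs ⟨
            q * q * s - 1#           ≈⟨ solve 2 (λ q r → q :* q :* r :- con (+ 1) := q :^ 2 :* r :- con (+ 1)) refl q s ⟩
            q ^ 2 * s - 1#           ∎) (0<q *⁺ 0<q *⁺ 0<w))))) h
          where
          at-1 : 0# < q - 1# - q * q * w ⊎ Good 1 → ∀ m → m ℕ.≤ 0 → q ^ suc m * s ≈ 1# → Branch Q (D - s)
          at-1 (inj₂ good) _ ℕ.z≤n h = good h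
          at-1 (inj₁ k)    _ ℕ.z≤n h = ⊥-elim (ℕₚ.<-irrefl ≡.refl (below 1 1 h (0<-factor (inj₁ 0<q) (0<-resp (begin
            q - 1# - q * q * w       ≈⟨ solve 2 (λ q v → q :- con (+ 1) :- v := q :- (v :+ con (+ 1))) refl q _ ⟩
            q - (q * q * w + 1#)     ≈⟨ +-congˡ (-‿cong qqs) ⟨
            q - q * q * s            ≈⟨ solve 2 (λ q r → q :- q :* q :* r := q :* (con (+ 1) :- q :^ 1 :* r)) refl q s ⟩
            q * (1# - q ^ 1 * s)     ∎) k))))

      -- For q² t <= q⁻³ the only possible coincidence of `V` - q² t is with q⁻¹. Either `V` > q⁻¹ +
      -- q⁻³ excludes it, or `Good 1` resolves it.
      Tail : Set
      Tail = 0# < q ^ 3 * V - q ^ 2 - 1# ⊎ Good 1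

      good-small : Tail → ∀ {t} → 0# ≤ t → 0# ≤ 1# - q ^ 5 * t → GoodValue (w + q ^ 2 * t) → Branch Q (D - t)
      good-small tail {t} l b = good-direct l
        (0<-factor (inj₁ (0<q *⁺ 0<q)) (0<-resp (solve 2 (λ q y → y :- con (+ 1) :+ con (+ 1) := y) refl q _) (q²r>1 +⁺ 0<1))) left
        where
        r = V - q ^ 2 * t

        q²r>1 : 0# < q * q * r - 1#
        q²r>1 = 0<-factor (inj₁ 0<q) (0<-resp
          (solve 2 (λ q t → q :* (q :* :e q) :+ :u q :+ (:1 q :- q :^ 5 :* t) := q :* (q :* q :* (:V q :- q :^ 2 :* t) :- :1 q)) refl q t)
          (0<q *⁺ (0<q *⁺ 0<e) +⁺ 0<u ⁺+⁰ b))

        left : GoodValue r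
        left m h = at-1 tail m (ℕₚ.≤-pred (ℕₚ.≤-pred (above 2 (suc m) h (0<-resp (+-congʳ (*-congʳ (*-congˡ (sym (*-identityʳ q))))) q²r>1)))) h
          where
          at-1 : Tail → ∀ m → m ℕ.≤ 0 → q ^ suc m * r ≈ 1# → Branch Q (D - r)
          at-1 (inj₂ good) _ ℕ.z≤n h = good h
          at-1 (inj₁ k)    _ ℕ.z≤n h = ⊥-elim (ℕₚ.<-irrefl ≡.refl (above 1 1 h (0<-factor (inj₁ (0<q *⁺ 0<q)) (0<-resp
            (solve 2 (λ q t → (q :^ 3 :* :V q :- q :^ 2 :- :1 q) :+ (:1 q :- q :^ 5 :* t) := q :* q :* (q :^ 1 :* (:V q :- q :^ 2 :* t) :- :1 q)) refl q t)
            (k ⁺+⁰ b)))))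

      q⁵t≤1 : ∀ n {t} → q ^ (5 ℕ.+ n) * t ≈ 1# → 0# ≤ 1# - q ^ 5 * t
      q⁵t≤1 n {t} p = 0≤-resp (trans (solve 3 (λ a b t → (b :- a) :* t := b :* t :- a :* t) refl _ _ _) (+-congʳ p))
        (q^-mono {5} {5 ℕ.+ n} (ℕₚ.m≤m+n 5 n) *⁰ inj₁ (0<t (5 ℕ.+ n) p))

      -- Here w + q² t lies strictly between q² t and q³ t.
      good-large : Tail → ∀ n {t} → q ^ (5 ℕ.+ n) * t ≈ 1# → 0# ≤ t - w → Branch Q (D - t)
      good-large tail n {t} p w≤t = good-small tail (inj₁ (0<t (5 ℕ.+ n) p)) (q⁵t≤1 n p) λ m h →
        ⊥-elim (ℕₚ.<⇒≱ (below (2 ℕ.+ n) (suc m) h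
            (0<-resp (begin
              q ^ (2 ℕ.+ n) * (t * (q * (1# + u) - 1#)) + q ^ (2 ℕ.+ n) * (t - w)
                ≈⟨ solve 4 (λ q t w p → p :* (t :* (q :* (:1 q :+ :u q) :- :1 q)) :+ p :* (t :- w) := q :* (q :* (q :* p)) :* t :- p :* (w :+ q :^ 2 :* t)) refl q t w (q ^ (2 ℕ.+ n)) ⟩
              q ^ (5 ℕ.+ n) * t - q ^ (2 ℕ.+ n) * (w + q ^ 2 * t)   ≈⟨ +-congʳ p ⟩
              1# - q ^ (2 ℕ.+ n) * (w + q ^ 2 * t) ∎)
            (0<q^ (2 ℕ.+ n) *⁺ (0<t (5 ℕ.+ n) p *⁺ 0<-resp (solve 1 (λ q → (q :- :1 q) :+ q :* :u q := q :* (:1 q :+ :u q) :- :1 q) refl q) (0<q-1 +⁺ 0<q *⁺ 0<u))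
              ⁺+⁰ inj₁ (0<q^ (2 ℕ.+ n)) *⁰ w≤t)))
          (ℕₚ.≤-pred (above (3 ℕ.+ n) (suc m) h (0<-resp (begin
              q ^ (3 ℕ.+ n) * w                                     ≈⟨ solve 1 (λ v → v := v :+ con (+ 1) :- con (+ 1)) refl _ ⟩
              q ^ (3 ℕ.+ n) * w + 1# - 1#                           ≈⟨ +-congʳ (+-congˡ p) ⟨
              q ^ (3 ℕ.+ n) * w + q ^ (5 ℕ.+ n) * t - 1#            ≈⟨ solve 4 (λ q t w p → p :* w :+ q :* (q :* p) :* t :- con (+ 1) := p :* (w :+ q :^ 2 :* t) :- con (+ 1)) refl q t w (q ^ (3 ℕ.+ n)) ⟩
              q ^ (3 ℕ.+ n) * (w + q ^ 2 * t) - 1# ∎) (0<q^ (3 ℕ.+ n) *⁺ 0<w)))))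

      Goods : Set
      Goods = Good 1 × Good 2 × Good 3 × Good 4

      module FromGoods (g₁ : Good 1) (g₂ : Good 2) (g₃ : Good 3) (g₄ : Good 4) where

        -- A power of q⁻¹ of this form is at least `w`, so from exponent 5 on `good-large` ends the
        -- chain.
        next : ∀ {t} → 0# ≤ t → GoodValue (w + q ^ 2 * t)
        next l 0 h = g₁ h
        next l 1 h = g₂ h
        next l 2 h = g₃ h
        next l 3 h = g₄ h
        next {t} l (suc (suc (suc (suc n)))) h = good-large (inj₂ g₁) n h
          (0≤-resp (solve 2 (λ w x → x := w :+ x :- w) refl w _) (inj₁ (0<q^ 2) *⁰ l))

        good-suc : ∀ m → Good (suc m)
        good-suc 0 = g₁
        good-suc 1 = g₂
        good-suc 2 = g₃
        good-suc 3 = g₄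
        good-suc (suc (suc (suc (suc n)))) p = good-small (inj₂ g₁) (inj₁ (0<t (5 ℕ.+ n) p)) (q⁵t≤1 n p) (next (inj₁ (0<t (5 ℕ.+ n) p)))

        continuum-from-goods : HasCardinalityContinuum (expansions q 1#)
        continuum-from-goods = continuum-if-branching
          -- `D` is the case t = 0 of `D` - t.
          (Branch-resp (solve 1 (λ d → d :- con (+ 0) := d) refl D)
            (good-small (inj₂ g₁) (inj₂ refl) (0≤-resp (solve 1 (λ p → con (+ 1) := con (+ 1) :- p :* con (+ 0)) refl (q ^ 5)) (inj₁ 0<1)) (next (inj₂ refl))))
          λ { {t} _ l (zero , p)  → ⊥-elim (¬0<0 (trans (solve 2 (λ u t → u :+ (con (+ 1) :- u :- t) := con (+ 1) :- con (+ 1) :* t) refl u t) (trans (+-congˡ (-‿cong p)) (-‿inverseʳ 1#))) (0<u ⁺+⁰ l))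
            ; _ _ (suc m , p) → good-suc m p }

      goodAt : ∀ {m k} → m ≡ k → Good k → Good m
      goodAt ≡.refl g = g

      ρ₁<1 : 0# < 1# - q ^ 0 * ρ₁
      ρ₁<1 = 0<-resp (solve 1 (λ q → :u q :+ :s₁ q := :1 q :- q :^ 0 :* :ρ₁ q) refl q) (0<u +⁺ 0<s₁)

      ρ₂<1 : 0# < 1# - q ^ 0 * ρ₂
      ρ₂<1 = 0<-resp (solve 1 (λ q → :u q :+ :s₂ q := :1 q :- q :^ 0 :* :ρ₂ q) refl q) (0<u +⁺ 0<s₂)

      w≤s₁ : 0# ≤ s₁ - w
      w≤s₁ = inj₁ (0<-resp (solve 1 (λ q → :u q :* q :+ :u q :* :u q :* (q :+ q :* q) := :s₁ q :- :w q) refl q) (0<u *⁺ 0<q +⁺ 0<u *⁺ 0<u *⁺ (0<q +⁺ 0<q *⁺ 0<q)))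

      w≤s₂ : 0# ≤ s₂ - w
      w≤s₂ = inj₁ (0<-resp (solve 1 (λ q → q :* :u q :* :u q := :s₂ q :- :w q) refl q) (0<q *⁺ 0<u *⁺ 0<u))

      -- The bound s < q⁻² leaves the exponents from 3 on, and `w` <= s lets `good-large` handle
      -- those from 5 on.
      good-value-small : Tail → Good 3 → Good 4 → ∀ {s} → 0# ≤ s - w → 0# < 1# - q ^ 2 * s → GoodValue s
      good-value-small tail g₃ g₄ {s} w≤s lo m h = go m h (ℕₚ.≤-pred (below 2 (suc m) h lo))
        where
        go : ∀ m → q ^ suc m * s ≈ 1# → 2 ℕ.≤ m → Branch Q (D - s)
        go 0 _ ()
        go 1 _ (ℕ.s≤s ())
        go 2 h _ = g₃ h
        go 3 h _ = g₄ h
        go (suc (suc (suc (suc n)))) h _ = good-large tail n h w≤s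

      -- The interval of q is cut between values at which one of these children
      -- is a power of q⁻¹, so that on each piece no chain of such coincidences
      -- is cyclic.
      goods-A : Between 16180 16460 10000 q → 0# < q ^ 3 * V - q ^ 2 - 1# → Goods
      goods-A btw k = g₁ , g₂ , g₃ , g₄
        where
        g₃ : Good 3
        g₃ = good₃ λ m h → ⊥-elim (excluded 1 m h 0<1-qe (0<-resp (solve 1 (λ q → q :^ 3 :* :V q :- q :^ 2 :- :1 q := q :^ 2 :* :e q :- :1 q) refl q) k))
        g₄ : Good 4
        g₄ = good₄ (inj₁ (positive (λ q → q :* (q :* :V q) :- con (+ 2)) 16180 16460 10000 btw tt))
                   (inj₁ (positive (λ q → q :- :1 q :- q :* q :* :w q) 16180 16460 10000 btw tt))
        g₂ : Good 2
        g₂ = good₂ (λ m h → ⊥-elim (excluded 0 (suc m) h ρ₂<1 (positive (λ q → q :^ 1 :* :ρ₂ q :- :1 q) 16180 16460 10000 btw tt)))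
                   (good-value-small (inj₁ k) g₃ g₄ w≤s₂ (positive (λ q → :1 q :- q :^ 2 :* :s₂ q) 16180 16460 10000 btw tt))
        g₁ : Good 1
        g₁ = good₁ (λ m h → ⊥-elim (excluded 0 (suc m) h ρ₁<1 (positive (λ q → q :^ 1 :* :ρ₁ q :- :1 q) 16180 16460 10000 btw tt)))
                   (good-value-small (inj₁ k) g₃ g₄ w≤s₁ (positive (λ q → :1 q :- q :^ 2 :* :s₁ q) 16180 16460 10000 btw tt))

      goods-B : Between 16450 16600 10000 q → 0# < 0# - (q ^ 3 * V - q ^ 2 - 1#) → ¬ q ^ 1 * ρ₁ ≈ 1# → Goods
      goods-B btw k ¬loop = g₁ , g₂ , g₃ , g₄
        where
        g₃ : Good 3
        g₃ = good₃ λ m h → ⊥-elim (excluded 2 m h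
          (0<-resp (solve 1 (λ q → con (+ 0) :- (q :^ 3 :* :V q :- q :^ 2 :- :1 q) := :1 q :- q :^ 2 :* :e q) refl q) k)
          (positive (λ q → q :^ 3 :* :e q :- :1 q) 16450 16600 10000 btw tt))
        g₄ : Good 4
        g₄ = good₄ (inj₁ (positive (λ q → q :* (q :* :V q) :- con (+ 2)) 16450 16600 10000 btw tt))
                   (inj₁ (positive (λ q → q :- :1 q :- q :* q :* :w q) 16450 16600 10000 btw tt))
        g₂ : Good 2
        g₂ = good₂ (λ m h → ⊥-elim (excluded 0 (suc m) h ρ₂<1 (positive (λ q → q :^ 1 :* :ρ₂ q :- :1 q) 16450 16600 10000 btw tt)))
                   (λ m h → goodAt (pinned 3 (suc m) h (positive (λ q → :1 q :- q :^ 3 :* :s₂ q) 16450 16600 10000 btw tt)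
                                                   (positive (λ q → q :^ 5 :* :s₂ q :- :1 q) 16450 16600 10000 btw tt)) g₄ h)
        g₁ : Good 1
        g₁ = good₁ (λ m h → ⊥-elim (¬loop (≡.subst (λ m → q ^ m * ρ₁ ≈ 1#)
                      (pinned 0 (suc m) h ρ₁<1 (positive (λ q → q :^ 2 :* :ρ₁ q :- :1 q) 16450 16600 10000 btw tt)) h)))
                   (λ m h → goodAt (pinned 1 (suc m) h (positive (λ q → :1 q :- q :^ 1 :* :s₁ q) 16450 16600 10000 btw tt)
                      -- The sign that places q beyond the first exceptional value also gives `s₁` >
                      -- q⁻³.
                      (0<-resp (solve 1 (λ q → :K q :* (con (+ 0) :- (q :^ 3 :* :V q :- q :^ 2 :- :1 q)) := q :^ 3 :* :s₁ q :- :1 q) refl q) (0<K *⁺ k))) g₂ h)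

      goods-C : Between 16600 16612 10000 q → Goods
      goods-C btw = g₁ , g₂ , g₃ , g₄
        where
        g₄ : Good 4
        g₄ = good₄ (inj₁ (positive (λ q → q :* (q :* :V q) :- con (+ 2)) 16600 16612 10000 btw tt))
                   (inj₁ (positive (λ q → q :- :1 q :- q :* q :* :w q) 16600 16612 10000 btw tt))
        g₃ : Good 3
        g₃ = good₃ λ m h → goodAt (≡.cong suc (pinned 2 m h (positive (λ q → :1 q :- q :^ 2 :* :e q) 16600 16612 10000 btw tt)
                                              (positive (λ q → q :^ 4 :* :e q :- :1 q) 16600 16612 10000 btw tt))) g₄
        g₂ : Good 2
        g₂ = good₂ (λ m h → ⊥-elim (excluded 0 (suc m) h ρ₂<1 (positive (λ q → q :^ 1 :* :ρ₂ q :- :1 q) 16600 16612 10000 btw tt)))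
                   (λ m h → ⊥-elim (excluded 3 (suc m) h (positive (λ q → :1 q :- q :^ 3 :* :s₂ q) 16600 16612 10000 btw tt)
                                                     (positive (λ q → q :^ 4 :* :s₂ q :- :1 q) 16600 16612 10000 btw tt)))
        g₁ : Good 1
        g₁ = good₁ (λ m h → ⊥-elim (excluded 1 (suc m) h (positive (λ q → :1 q :- q :^ 1 :* :ρ₁ q) 16600 16612 10000 btw tt)
                                                     (positive (λ q → q :^ 2 :* :ρ₁ q :- :1 q) 16600 16612 10000 btw tt)))
                   (λ m h → ⊥-elim (excluded 1 (suc m) h (positive (λ q → :1 q :- q :^ 1 :* :s₁ q) 16600 16612 10000 btw tt)
                                                     (positive (λ q → q :^ 2 :* :s₁ q :- :1 q) 16600 16612 10000 btw tt)))

      goods-D : Between 16612 16685 10000 q → Goods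
      goods-D btw = g₁ , g₂ , g₃ , good₄ (inj₂ g₂) (inj₂ g₁)
        where
        g₃ : Good 3
        g₃ = good₃ λ m h → ⊥-elim (excluded 3 m h (positive (λ q → :1 q :- q :^ 3 :* :e q) 16612 16685 10000 btw tt)
                                              (positive (λ q → q :^ 4 :* :e q :- :1 q) 16612 16685 10000 btw tt))
        g₂ : Good 2
        g₂ = good₂ (λ m h → ⊥-elim (excluded 0 (suc m) h ρ₂<1 (positive (λ q → q :^ 1 :* :ρ₂ q :- :1 q) 16612 16685 10000 btw tt)))
                   (λ m h → goodAt (pinned 2 (suc m) h (positive (λ q → :1 q :- q :^ 2 :* :s₂ q) 16612 16685 10000 btw tt)
                                                   (positive (λ q → q :^ 4 :* :s₂ q :- :1 q) 16612 16685 10000 btw tt)) g₃ h)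
        g₁ : Good 1
        g₁ = good₁ (λ m h → ⊥-elim (excluded 1 (suc m) h (positive (λ q → :1 q :- q :^ 1 :* :ρ₁ q) 16612 16685 10000 btw tt)
                                                     (positive (λ q → q :^ 2 :* :ρ₁ q :- :1 q) 16612 16685 10000 btw tt)))
                   (λ m h → ⊥-elim (excluded 1 (suc m) h (positive (λ q → :1 q :- q :^ 1 :* :s₁ q) 16612 16685 10000 btw tt)
                                                     (positive (λ q → q :^ 2 :* :s₁ q :- :1 q) 16612 16685 10000 btw tt)))

      -- If `w` + q² t exceeds q⁻³, only the exponents 1 and 2 remain for it.
      good-from-5 : Good 1 → Good 2 → ∀ n {t} → q ^ (5 ℕ.+ n) * t ≈ 1# → 0# < q ^ 3 * (w + q ^ 2 * t) - 1# → Branch Q (D - t)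
      good-from-5 g₁ g₂ n {t} p hi = good-small (inj₂ g₁) (inj₁ (0<t (5 ℕ.+ n) p)) (q⁵t≤1 n p)
        λ m h → go m h (ℕₚ.≤-pred (above 3 (suc m) h hi))
        where
        go : ∀ m → q ^ suc m * (w + q ^ 2 * t) ≈ 1# → suc m ℕ.≤ 2 → Branch Q (D - (w + q ^ 2 * t))
        go 0 h _ = g₁ h
        go 1 h _ = g₂ h
        go (suc (suc m)) h (ℕ.s≤s (ℕ.s≤s ()))

      -- Since `e` < q⁻³, the child `e` / q of `D` - q⁻³ can only be a power of q⁻¹ with exponent at
      -- least 5.
      good₃-from-5 : 0# < 1# - q ^ 3 * e → (∀ n {t} → q ^ (4 ℕ.+ n) * e ≈ 1# → q ^ (5 ℕ.+ n) * t ≈ 1# → Branch Q (D - t)) → Good 3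
      good₃-from-5 lo f = good₃ λ m h → go m h (below 3 m h lo)
        where
        go : ∀ m → q ^ m * e ≈ 1# → 3 ℕ.< m → Good (suc m)
        go (suc (suc (suc (suc n)))) h _ p = f n h p
        go 0 _ ()
        go 1 _ (ℕ.s≤s ())
        go 2 _ (ℕ.s≤s (ℕ.s≤s ()))
        go 3 _ (ℕ.s≤s (ℕ.s≤s (ℕ.s≤s ())))

      beyond-w : 0# < q ^ 3 * w - 1# → ∀ n {t} → q ^ n * t ≈ 1# → 0# < q ^ 3 * (w + q ^ 2 * t) - 1#
      beyond-w k n {t} p = 0<-resp (solve 3 (λ q w t → (q :^ 3 :* w :- con (+ 1)) :+ q :^ 5 :* t := q :^ 3 :* (w :+ q :^ 2 :* t) :- con (+ 1)) refl q w t)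
        (k +⁺ 0<q^ 5 *⁺ 0<t n p)

      goods-E : Between 16685 16745 10000 q → Goods
      goods-E btw = g₁ , g₂ , g₃ , good₄ (inj₂ g₂) (inj₂ g₁)
        where
        g₂ : Good 2
        g₂ = good₂ (λ m h → ⊥-elim (excluded 0 (suc m) h ρ₂<1 (positive (λ q → q :^ 1 :* :ρ₂ q :- :1 q) 16685 16745 10000 btw tt)))
                   (λ m h → ⊥-elim (excluded 2 (suc m) h (positive (λ q → :1 q :- q :^ 2 :* :s₂ q) 16685 16745 10000 btw tt)
                                                     (positive (λ q → q :^ 3 :* :s₂ q :- :1 q) 16685 16745 10000 btw tt)))
        g₁ : Good 1
        g₁ = good₁ (λ m h → goodAt (pinned 1 (suc m) h (positive (λ q → :1 q :- q :^ 1 :* :ρ₁ q) 16685 16745 10000 btw tt)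
                                                   (positive (λ q → q :^ 3 :* :ρ₁ q :- :1 q) 16685 16745 10000 btw tt)) g₂ h)
                   (λ m h → ⊥-elim (excluded 1 (suc m) h (positive (λ q → :1 q :- q :^ 1 :* :s₁ q) 16685 16745 10000 btw tt)
                                                     (positive (λ q → q :^ 2 :* :s₁ q :- :1 q) 16685 16745 10000 btw tt)))
        -- From 1.672 on, q³ `w` > 1 suffices. Below it, q⁵ `e` > 1 forces n = 0, and then the term
        -- q⁵ t equals 1.
        beyond : ∀ n {t} → q ^ (4 ℕ.+ n) * e ≈ 1# → q ^ (5 ℕ.+ n) * t ≈ 1# → 0# < q ^ 3 * (w + q ^ 2 * t) - 1#
        beyond n {t} h p with <-or-≥ (ν 10000 * q) (ν 16720)
        ... | inj₂ l = beyond-w (positive (λ q → q :^ 3 :* :w q :- :1 q) 16720 16745 10000 (l , proj₂ btw) tt) (5 ℕ.+ n) p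
        ... | inj₁ l = at-5 n (ℕₚ.+-cancelˡ-≤ 5 n 0 (above 5 (4 ℕ.+ n) h (positive (λ q → q :^ 5 :* :e q :- :1 q) 16685 16720 10000 (proj₁ btw , inj₁ (<⇒0< l)) tt))) p
          where
          at-5 : ∀ n → n ℕ.≤ 0 → q ^ (5 ℕ.+ n) * t ≈ 1# → 0# < q ^ 3 * (w + q ^ 2 * t) - 1#
          at-5 _ ℕ.z≤n p = 0<-resp (trans (solve 2 (λ w p → p :* w := p :* w :+ con (+ 1) :- con (+ 1)) refl w (q ^ 3)) (trans (+-congʳ (+-congˡ (sym p)))
            (solve 3 (λ q w t → q :^ 3 :* w :+ q :^ 5 :* t :- con (+ 1) := q :^ 3 :* (w :+ q :^ 2 :* t) :- con (+ 1)) refl q w t))) (0<q^ 3 *⁺ 0<w)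
        g₃ : Good 3
        g₃ = good₃-from-5 (positive (λ q → :1 q :- q :^ 3 :* :e q) 16685 16745 10000 btw tt)
          λ n h p → good-from-5 g₁ g₂ n p (beyond n h p)

      goods-F : Between 16745 16805 10000 q → 0# < 0# - (q ^ 5 - q ^ 4 - q ^ 3 - q + 1#) → Goods
      goods-F btw k = g₁ , g₂ , g₃ , good₄ (inj₂ g₂) (inj₂ g₁)
        where
        g₁ : Good 1
        g₁ = good₁ (λ m h → ⊥-elim (excluded 2 (suc m) h (positive (λ q → :1 q :- q :^ 2 :* :ρ₁ q) 16745 16805 10000 btw tt)
                                                     (positive (λ q → q :^ 3 :* :ρ₁ q :- :1 q) 16745 16805 10000 btw tt)))
                   (λ m h → ⊥-elim (excluded 1 (suc m) h
                      -- Here q < q₃ is decisive: it gives `s₁` < q⁻¹. Equality, which holds at q₃,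
                      -- would make `D` - q⁻¹ its own descendant up to reflection.
                      (0<-resp (solve 1 (λ q → :K q :* (con (+ 0) :- (q :^ 5 :- q :^ 4 :- q :^ 3 :- q :+ :1 q)) := :1 q :- q :^ 1 :* :s₁ q) refl q) (0<K *⁺ k))
                      (positive (λ q → q :^ 2 :* :s₁ q :- :1 q) 16745 16805 10000 btw tt)))
        g₂ : Good 2
        g₂ = good₂ (λ m h → goodAt (pinned 0 (suc m) h ρ₂<1 (positive (λ q → q :^ 2 :* :ρ₂ q :- :1 q) 16745 16805 10000 btw tt)) g₁ h)
                   (λ m h → ⊥-elim (excluded 2 (suc m) h (positive (λ q → :1 q :- q :^ 2 :* :s₂ q) 16745 16805 10000 btw tt)
                                                     (positive (λ q → q :^ 3 :* :s₂ q :- :1 q) 16745 16805 10000 btw tt)))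
        g₃ : Good 3
        g₃ = good₃-from-5 (positive (λ q → :1 q :- q :^ 3 :* :e q) 16745 16805 10000 btw tt)
          λ n h p → good-from-5 g₁ g₂ n p (beyond-w (positive (λ q → q :^ 3 :* :w q :- :1 q) 16745 16805 10000 btw tt) (5 ℕ.+ n) p)

      -- The polynomial q³ V - q² - 1 changes sign between 1.645 and 1.646. Its sign, not a rational
      -- cut point, decides between the first two pieces, which therefore overlap.
      goods : 0# < 0# - (q ^ 5 - q ^ 4 - q ^ 3 - q + 1#) → ¬ q ^ 3 * V - q ^ 2 - 1# ≈ 0# → ¬ q ^ 1 * ρ₁ ≈ 1# → Goods
      goods k ¬loop₃ ¬loop₁ with compare 0# (q ^ 3 * V - q ^ 2 - 1#)
      ... | tri≈ _ p _ = ⊥-elim (¬loop₃ (sym p))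
      goods k ¬loop₃ ¬loop₁ | tri< p _ _ with <-or-≥ (ν 10000 * q) (ν 16460)
      ... | inj₁ l = goods-A (proj₁ range , inj₁ (<⇒0< l)) p
      ... | inj₂ l = ⊥-elim (¬0<0 (solve 1 (λ q → (q :^ 3 :* :V q :- q :^ 2 :- :1 q) :+ (:1 q :+ q :^ 2 :- q :^ 3 :* :V q) := con (+ 0)) refl q)
                       (p +⁺ positive (λ q → :1 q :+ q :^ 2 :- q :^ 3 :* :V q) 16460 16805 10000 (l , proj₂ range) tt))
      goods k ¬loop₃ ¬loop₁ | tri> _ _ p = go (<-or-≥ (ν 10000 * q) (ν 16450)) (<-or-≥ (ν 10000 * q) (ν 16600)) (<-or-≥ (ν 10000 * q) (ν 16612))
                                              (<-or-≥ (ν 10000 * q) (ν 16685)) (<-or-≥ (ν 10000 * q) (ν 16745))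
        where
        Cut : ℕ → Set
        Cut n = ν 10000 * q < ν n ⊎ 0# ≤ ν 10000 * q - ν n

        go : Cut 16450 → Cut 16600 → Cut 16612 → Cut 16685 → Cut 16745 → Goods
        go (inj₁ l) _ _ _ _ = ⊥-elim (¬0<0 (solve 1 (λ q → (con (+ 0) :- (q :^ 3 :* :V q :- q :^ 2 :- :1 q)) :+ (q :^ 3 :* :V q :- q :^ 2 :- :1 q) := con (+ 0)) refl q)
          (<⇒0< p +⁺ positive (λ q → q :^ 3 :* :V q :- q :^ 2 :- :1 q) 16180 16450 10000 (proj₁ range , inj₁ (<⇒0< l)) tt))
        go (inj₂ l) (inj₁ r) _ _ _ = goods-B (l , inj₁ (<⇒0< r)) (<⇒0< p) ¬loop₁
        go _ (inj₂ l) (inj₁ r) _ _ = goods-C (l , inj₁ (<⇒0< r))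
        go _ _ (inj₂ l) (inj₁ r) _ = goods-D (l , inj₁ (<⇒0< r))
        go _ _ _ (inj₂ l) (inj₁ r) = goods-E (l , inj₁ (<⇒0< r))
        go _ _ _ _ (inj₂ l)        = goods-F (l , proj₂ range) k

      continuum-unless-loop : 0# < 0# - (q ^ 5 - q ^ 4 - q ^ 3 - q + 1#) → ¬ q ^ 3 * V - q ^ 2 - 1# ≈ 0# → ¬ q ^ 1 * ρ₁ ≈ 1# →
        HasCardinalityContinuum (expansions q 1#)
      continuum-unless-loop k ¬loop₃ ¬loop₁ = finish (goods k ¬loop₃ ¬loop₁)
        where
        finish : Goods → HasCardinalityContinuum (expansions q 1#)
        finish (g₁ , g₂ , g₃ , g₄) = FromGoods.continuum-from-goods g₁ g₂ g₃ g₄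

    open Parity
    open Independence

    -- The two exceptional values of q.

    module NeverUnivoque (0<u : 0# < u) (0<V : 0# < V)
      (c : Vec ℤ 6) (c₂ : Vec Bool 6) (c-parities : HasParities c c₂) (root : q ^ 6 ≈ value c q) (irr : T (irreducible c₂))
      (p : ℤ) (total-c : total c ≡ + 1 ℤ.+ p) (p≢±1 : ¬ ∣ p ∣ ≡ 1) where
      open Root q c c₂ c-parities root irr
      open Homomorphism p total-c p≢±1

      -- At q = 1 the number K becomes 0, so both child maps preserve the residue, while x ↦ q + 1 -
      -- x becomes x ↦ 2 - x and exchanges 0 and 2.
      Class : Vec ℤ 6 → Set
      Class v = Residue p v (+ 0) ⊎ Residue p v (+ 2)

      P : Carrier → Set
      P x = ∃ λ v → x ≈ value v q × Class v

      P-resp : ∀ {x y} → x ≈ y → P x → P y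
      P-resp e (v , h , k) = v , trans (sym e) h , k

      P-zoom : ∀ {x} → P x → P (q * x)
      P-zoom (v , h , k) = shift c v , trans (*-congˡ h) (sym (value-shift v)) , class k
        where
        class : Class v → Class (shift c v)
        class (inj₁ r) = inj₁ (Residue-shift {p} c v total-c r)
        class (inj₂ r) = inj₂ (Residue-shift {p} c v total-c r)

      minus-K one-plus-q : Vec ℤ 6
      minus-K    = + 1 ∷ + 0 ∷ -[1+ 0 ] ∷ + 0 ∷ + 0 ∷ + 0 ∷ []
      one-plus-q = + 1 ∷ + 1 ∷ + 0 ∷ + 0 ∷ + 0 ∷ + 0 ∷ []

      P-minus-K : ∀ {x} → P x → P (x - K)
      P-minus-K {x} (v , h , k) = v ⊕ᵛ minus-K , (begin
          x - K                          ≈⟨ +-cong h (solve 1 (λ q → let z = con (+ 0) in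
                                              :- (q :* q :- con (+ 1)) := con (+ 1) :+ q :* (z :+ q :* (con -[1+ 0 ] :+ q :* (z :+ q :* (z :+ q :* (z :+ q :* z)))))) refl q) ⟩
          value v q + value minus-K q    ≈⟨ value-⊕ v minus-K q ⟨
          value (v ⊕ᵛ minus-K) q         ∎) , class k
        where
        trivial : Residue p minus-K (+ 0)
        trivial = + 0 , ≡.sym (≡.trans (ℤₚ.+-identityˡ _) (ℤₚ.*-zeroʳ p))
        class : Class v → Class (v ⊕ᵛ minus-K)
        class (inj₁ r) = inj₁ (Residue-⊕ {p} {v = v} {minus-K} r trivial)
        class (inj₂ r) = inj₂ (Residue-⊕ {p} {v = v} {minus-K} r trivial)

      P-child : ∀ d {x} → P x → P (child d x)
      P-child zero       h = P-resp (solve 1 (λ y → y := y :- con (+ 0)) refl _) (P-zoom h)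
      P-child (suc zero) h = P-minus-K (P-zoom h)

      P-flip : ∀ {x} → P x → P (flip x)
      P-flip {x} (v , h , k) = one-plus-q ⊕ᵛ -[1+ 0 ] ⊛ᵛ v , (begin
          q + 1# - x                                             ≈⟨ +-cong (solve 1 (λ q → let z = con (+ 0) in
                                                                      q :+ con (+ 1) := con (+ 1) :+ q :* (con (+ 1) :+ q :* (z :+ q :* (z :+ q :* (z :+ q :* (z :+ q :* z)))))) refl q)
                                                                    (trans (-‿cong h) (trans (solve 1 (λ y → :- y := con -[1+ 0 ] :* y) refl (value v q)) (sym (value-⊛ -[1+ 0 ] v q)))) ⟩
          value one-plus-q q + value (-[1+ 0 ] ⊛ᵛ v) q           ≈⟨ value-⊕ one-plus-q (-[1+ 0 ] ⊛ᵛ v) q ⟨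
          value (one-plus-q ⊕ᵛ -[1+ 0 ] ⊛ᵛ v) q                  ∎) , class k
        where
        two : Residue p one-plus-q (+ 2)
        two = + 0 , ≡.sym (≡.cong (λ x → + 2 ℤ.+ x) (ℤₚ.*-zeroʳ p))
        class : Class v → Class (one-plus-q ⊕ᵛ -[1+ 0 ] ⊛ᵛ v)
        class (inj₁ r) = inj₂ (Residue-⊕ {p} {v = one-plus-q} {w = -[1+ 0 ] ⊛ᵛ v} two (Residue-⊛ {p} {v = v} -[1+ 0 ] r))
        class (inj₂ r) = inj₁ (Residue-⊕ {p} {v = one-plus-q} {w = -[1+ 0 ] ⊛ᵛ v} two (Residue-⊛ {p} {v = v} -[1+ 0 ] r))

      not-univoque : ∀ {x} → P x → ¬ Univoque x
      not-univoque (v , h , k) (n , e) = not-power n v k (trans (*-congˡ (sym h)) e)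

      open Core 0<u 0<V P P-resp P-child P-flip
      open Reach 0<u 0<V using (0<D)

      P-D : P D
      P-D = (+ 2 ∷ + 1 ∷ -[1+ 0 ] ∷ + 0 ∷ + 0 ∷ + 0 ∷ []) ,
        solve 1 (λ q → let z = con (+ 0) in :D q := con (+ 2) :+ q :* (con (+ 1) :+ q :* (con -[1+ 0 ] :+ q :* (z :+ q :* (z :+ q :* (z :+ q :* z)))))) refl q ,
        inj₂ (+ 0 , ≡.sym (≡.cong (λ x → + 2 ℤ.+ x) (ℤₚ.*-zeroʳ p)))

      P-V : P V
      P-V = P-resp (solve 1 (λ q → q :* (q :* :D q) :- :K q := :V q) refl q) (P-minus-K (P-zoom (P-zoom P-D)))

      -- The children `V` and `w` are positive and satisfy `P`, so neither is 0 or univoque and the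
      -- node q `D` branches.
      branch-D : Branch Q D
      branch-D = two-children P-D (inj₁ 0<D) (0≤-resp (solve 1 (λ q → :u q := :1 q :- :D q) refl q) (inj₁ 0<u))
        (solve 1 (λ q → q :* (q :* :D q) :- :K q := :V q) refl q)
        (solve 1 (λ q → :D q :- :V q := :w q) refl q) 0<V (0<u *⁺ 0<K)
        (λ h → ⊥-elim (not-univoque P-V h)) (λ h → ⊥-elim (not-univoque P-w h))
        where
        P-w : P w
        P-w = P-resp (solve 1 (λ q → q :+ :1 q :- q :* (q :* :D q) := :w q) refl q) (P-flip (P-zoom (P-zoom P-D)))

      continuum-never-univoque : HasCardinalityContinuum (expansions q 1#)
      continuum-never-univoque = continuum-if-branching branch-D (λ h _ k → ⊥-elim (not-univoque h k))

    module _ (0<u : 0# < u) (0<V : 0# < V) where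

      q-1≉0 : ¬ q - 1# ≈ 0#
      q-1≉0 e = ¬0<0 e 0<q-1

      -- q is a root of (x - 1) (x⁶ - x⁴ - x³ - 2x² - x - 1).
      loop₃ : q ^ 3 * V - q ^ 2 - 1# ≈ 0# → HasCardinalityContinuum (expansions q 1#)
      loop₃ h = NeverUnivoque.continuum-never-univoque 0<u 0<V (+ 1 ∷ + 1 ∷ + 2 ∷ + 1 ∷ + 1 ∷ + 0 ∷ []) (true ∷ true ∷ false ∷ true ∷ true ∷ false ∷ [])
        ((+ 0 , ≡.refl) ∷ (+ 0 , ≡.refl) ∷ (+ 1 , ≡.refl) ∷ (+ 0 , ≡.refl) ∷ (+ 0 , ≡.refl) ∷ (+ 0 , ≡.refl) ∷ [])
        (begin
          q ^ 6                                     ≈⟨ solve 2 (λ x y → x := (x :- y) :+ y) refl _ r ⟩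
          (q ^ 6 - r) + r                           ≈⟨ +-congʳ (*-zero-factor (trans (solve 1 (λ q → let z = con (+ 0) ; o = con (+ 1) in
              (q :- o) :* (q :^ 6 :- (o :+ q :* (o :+ q :* (con (+ 2) :+ q :* (o :+ q :* (o :+ q :* (z :+ q :* z))))))) := :- (q :^ 3 :* :V q :- q :^ 2 :- :1 q)) refl q)
              (trans (-‿cong h) (solve 0 (:- con (+ 0) := con (+ 0)) refl))) q-1≉0) ⟩
          0# + r                                    ≈⟨ +-identityˡ r ⟩
          r                                         ∎)
        tt (+ 5) ≡.refl (λ ())
        where
        r = value (+ 1 ∷ + 1 ∷ + 2 ∷ + 1 ∷ + 1 ∷ + 0 ∷ []) q

      -- q is a root of (x - 1) (x⁶ - 2x⁴ - x³ - 1).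
      loop₁ : q ^ 1 * ρ₁ ≈ 1# → HasCardinalityContinuum (expansions q 1#)
      loop₁ h = NeverUnivoque.continuum-never-univoque 0<u 0<V (+ 1 ∷ + 0 ∷ + 0 ∷ + 1 ∷ + 2 ∷ + 0 ∷ []) (true ∷ false ∷ false ∷ true ∷ false ∷ false ∷ [])
        ((+ 0 , ≡.refl) ∷ (+ 0 , ≡.refl) ∷ (+ 0 , ≡.refl) ∷ (+ 0 , ≡.refl) ∷ (+ 1 , ≡.refl) ∷ (+ 0 , ≡.refl) ∷ [])
        (begin
          q ^ 6                                     ≈⟨ solve 2 (λ x y → x := (x :- y) :+ y) refl _ r ⟩
          (q ^ 6 - r) + r                           ≈⟨ +-congʳ (*-zero-factor (trans (solve 1 (λ q → let z = con (+ 0) ; o = con (+ 1) in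
              (q :- o) :* (q :^ 6 :- (o :+ q :* (z :+ q :* (z :+ q :* (o :+ q :* (con (+ 2) :+ q :* (z :+ q :* z))))))) := o :- q :^ 1 :* :ρ₁ q) refl q)
              (trans (+-congˡ (-‿cong h)) (-‿inverseʳ 1#))) q-1≉0) ⟩
          0# + r                                    ≈⟨ +-identityˡ r ⟩
          r                                         ∎)
        tt (+ 3) ≡.refl (λ ())
        where
        r = value (+ 1 ∷ + 0 ∷ + 0 ∷ + 1 ∷ + 2 ∷ + 0 ∷ []) q

    open Bounds

    -- Case distinction by the sign of u.

    module _ {√5 q₃} (is√5 : IsSqrt (fromℕ 5) √5) (isQ₃ : IsQ₃ q₃) (q<q₃ : q < q₃) where

      quintic<0 : 0# < 0# - quintic q
      quintic<0 = quintic-negative 1<q q<q₃ isQ₃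

      continuum-above-golden : 0# < u → HasCardinalityContinuum (expansions q 1#)
      continuum-above-golden 0<u = cases em em
        where
        0<e : 0# < e
        -- `e` is the negated quintic, so q < q₃ says that `V` exceeds q⁻¹.
        0<e = 0<-resp (solve 1 (λ q → con (+ 0) :- :quintic q := :e q) refl q) quintic<0

        open Generic 0<u 0<e (golden-below 1<q 0<u , below-q₃ q<q₃ isQ₃)

        cases : Dec (q ^ 3 * V - q ^ 2 - 1# ≈ 0#) → Dec (q ^ 1 * ρ₁ ≈ 1#) → HasCardinalityContinuum (expansions q 1#)
        cases (yes h) _       = loop₃ 0<u 0<V h
        cases (no _)  (yes h) = loop₁ 0<u 0<V h
        cases (no h₃) (no h₁) = continuum-unless-loop quintic<0 h₃ h₁

      continuum-below-q₃ : ¬ q ≈ (1# + √5) / fromℕ 2 → HasCardinalityContinuum (expansions q 1#)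
      continuum-below-q₃ q≉golden with compare 0# u
      ... | tri< p _ _ = continuum-above-golden p
      ... | tri≈ _ p _ = ⊥-elim (q≉golden (golden 1<q is√5 (sym p)))
      ... | tri> _ _ p = Small.continuum-below-golden (<⇒0< p)

corollary1p3 :
    ExcludedMiddle 0ℓ →
    (ℝ : CompleteOrderedField) →
    let open CompleteOrderedField ℝ
        open Expansions ℝ in
    ∀ √5 → IsSqrt (fromℕ 5) √5 →
    ∀ q₃ → IsQ₃ q₃ →
    ∀ q → 1# < q → q < q₃ → ¬ (q ≈ (1# + √5) / fromℕ 2) →
    HasCardinalityContinuum (expansions q 1#)
corollary1p3 em ℝ √5 is√5 q₃ isQ₃ q 1<q = Reals.Base.continuum-below-q₃ ℝ em q 1<q is√5 isQ₃
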